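{- For $\Delta>0$, let $\mathrm{CM}^{\mathrm{LB}}_{|D|\le\Delta}$ denote the set of CM points of discriminant $D$ with $|D|\le\Delta$ lying on the left boundary $\{ -\frac12+iy : y\ge \frac{\sqrt3}{2}\}$ of $\mathcal F$, and let $\mathrm{CM}^{\mathrm{LA}}_{|D|\le\Delta}$ denote the set of CM points of discriminant $D$ with $|D|\le\Delta$ lying on the lower arc $\{e^{i\theta} : \frac{\pi}{2}\le\theta\le\frac{2\pi}{3}\}$ of $\mathcal F$. Then as $\Delta\to\infty$: (1) For every fixed real $K>\frac{\sqrt3}{2}$, the set $\{\operatorname{Im}\tau : \tau\in \mathrm{CM}^{\mathrm{LB}}_{|D|\le\Delta}\}$ is equidistributed over $[\frac{\sqrt3}{2},K]$ via the metric $d\mu=\frac1y\,dy$; that is, for every fixed interval $[X,Y]\subseteq[\frac{\sqrt3}{2},K]$, $$\frac{\#\{\tau\in \mathrm{CM}^{\mathrm{LB}}_{|D|\le\Delta} : X\le\operatorname{Im}\tau\le Y\}}{\#\{\tau\in \mathrm{CM}^{\mathrm{LB}}_{|D|\le\Delta} : \frac{\sqrt3}{2}\le\operatorname{Im}\tau\le K\}}\longrightarrow\frac{\int_X^Y \frac{dy}{y}}{\int_{\sqrt3/2}^{K}\frac{dy}{y}}\qquad(\Delta\to\infty).$$ (2) The set $\{\arg\tau : \tau\in \mathrm{CM}^{\mathrm{LA}}_{|D|\le\Delta}\}$ is equidistributed over $[\frac{\pi}{2},\frac{2\pi}{3}]$ via the metric $d\nu=\frac{1}{\sin\theta}\,d\theta$;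 that is, for every fixed interval $[\alpha,\beta]\subseteq[\frac{\pi}{2},\frac{2\pi}{3}]$, $$\frac{\#\{\tau\in \mathrm{CM}^{\mathrm{LA}}_{|D|\le\Delta} : \alpha\le\arg\tau\le\beta\}}{\#\,\mathrm{CM}^{\mathrm{LA}}_{|D|\le\Delta}}\longrightarrow\frac{\int_\alpha^\beta \frac{d\theta}{\sin\theta}}{\int_{\pi/2}^{2\pi/3}\frac{d\theta}{\sin\theta}}\qquad(\Delta\to\infty).$$
   Context: Let $\mathcal H=\{z\in\mathbb C:\operatorname{Im}z>0\}$ and let $\mathcal F=\{z=x+iy\in\mathcal H : |z|\ge1,\ -\frac12\le x\le0\}\cup\{z=x+iy\in\mathcal H : |z|>1,\ 0<x<\frac12\}$ be the standard fundamental domain for $\mathrm{SL}_2(\mathbb Z)$ acting on $\mathcal H$. A CM point is a $\tau\in\mathcal H$ satisfying $a\tau^2+b\tau+c=0$ for integers $a,b,c$ with $a\ge1$ and $\gcd(a,b,c)=1$; the triple $[a,b,c]$ is uniquely determined by $\tau$, and the discriminant of $\tau$ is $D=b^2-4ac<0$. All negative discriminants (not only fundamental ones) are considered. -}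

module Defs where

open import Algebra.Bundles using (CommutativeRing; Semiring)
open import Axiom.ExcludedMiddle using (ExcludedMiddle)
open import Data.Fin.Base using (Fin; zero; suc; toℕ; fromℕ; inject₁)
open import Data.Integer.Base as ℤ using (ℤ; +_; -[1+_])
open import Data.Integer.GCD using (gcd)
open import Data.Nat.Base as ℕ using (ℕ; _!)
open import Data.Product.Base using (∃; ∃-syntax; _×_; _,_; proj₁; proj₂)
open import Data.Product.Relation.Binary.Pointwise.NonDependent using (×-setoid)
open import Data.Sum.Base using ([_,_]′)
open import Data.Vec.Functional using (Vector)
open import Function.Base using (const)
open import Function.Bundles using (Bijection)
open import Level using (0ℓ)
open import Relation.Binary.Bundles using (Setoid)
open import Relation.Binary.Core using (Rel)
open import Relation.Binary.PropositionalEquality using (_≡_)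
open import Relation.Binary.PropositionalEquality.Properties using () renaming (setoid to ≡-setoid)
open import Relation.Binary.Structures using (IsTotalOrder)
open import Relation.Nullary using (¬_; yes; no)
open import Relation.Unary using (Pred; _∈_; Satisfiable)
import Algebra.Definitions.RawSemiring as RawSemiringOps
import Relation.Binary.Construct.NonStrictToStrict as NonStrictToStrict
import Relation.Binary.Construct.On as On

-- The standard library has no real numbers.  Classically, the axioms below
-- determine ℝ up to unique isomorphism.  Completeness quantifies over
-- arbitrary predicates, not only those respecting _≈_; this is no stronger,
-- since a predicate and its _≈_-closure have the same upper bounds.

record CompleteOrderedField : Set₁ where
  infix 4 _≤_
  field
    commutativeRing : CommutativeRing 0ℓ 0ℓ

  open CommutativeRing commutativeRing public
    hiding (_≉_)

  field
    _≤_          : Rel Carrier 0ℓ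
    isTotalOrder : IsTotalOrder _≈_ _≤_
    0≉1          : ¬ (0# ≈ 1#)
    inverse      : ∀ x → ¬ (x ≈ 0#) → ∃[ y ] x * y ≈ 1#
    +-mono-≤     : ∀ {x y} z → x ≤ y → x + z ≤ y + z
    *-nonneg     : ∀ {x y} → 0# ≤ x → 0# ≤ y → 0# ≤ x * y

  UpperBound : Pred Carrier 0ℓ → Pred Carrier 0ℓ
  UpperBound P u = ∀ {x} → x ∈ P → x ≤ u

  field
    supremum : ∀ (P : Pred Carrier 0ℓ) → Satisfiable P → Satisfiable (UpperBound P) →
               ∃[ s ] (s ∈ UpperBound P × (∀ {u} → u ∈ UpperBound P → s ≤ u))

  open NonStrictToStrict _≈_ _≤_ public using (_<_)
  open IsTotalOrder isTotalOrder public using (total)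
  open RawSemiringOps (Semiring.rawSemiring semiring) public
    using (_^_; sum) renaming (_×_ to _·_)

module Analysis (em : ExcludedMiddle 0ℓ) (R : CompleteOrderedField) where

  open CompleteOrderedField R public hiding (zero)

  ℝ : Set
  ℝ = Carrier

  -- Definite description: an element of P, or the default d if P is empty.
  -- Partial operations (inverse, square root, limit, integral, cardinality, …)
  -- are introduced through it, each with the default 0.

  the : {A : Set} → A → Pred A 0ℓ → A
  the d P with em {∃ P}
  ... | yes (x , _) = x
  ... | no  _       = d

  ℕ→ℝ : ℕ → ℝ
  ℕ→ℝ n = n · 1#

  ℤ→ℝ : ℤ → ℝ
  ℤ→ℝ (+ n)    = ℕ→ℝ n
  ℤ→ℝ -[1+ n ] = - ℕ→ℝ (ℕ.suc n)

  infixl 7 _/_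

  _⁻¹ : ℝ → ℝ
  x ⁻¹ = the 0# λ y → x * y ≈ 1#

  _/_ : ℝ → ℝ → ℝ
  x / y = x * y ⁻¹

  √_ : ℝ → ℝ
  √ x = the 0# λ s → 0# ≤ s × s * s ≈ x

  ∣_∣ : ℝ → ℝ
  ∣ x ∣ = [ const x , const (- x) ]′ (total 0# x)

  lim : (ℕ → ℝ) → ℝ
  lim u = the 0# λ L →
    ∀ ε → 0# < ε → ∃[ N ] (∀ n → N ℕ.≤ n → ∣ u n - L ∣ < ε)

  infix 4 _⟶_[at-∞]

  _⟶_[at-∞] : (ℝ → ℝ) → ℝ → Set
  f ⟶ L [at-∞] = ∀ ε → 0# < ε → ∃[ M ] (∀ x → M ≤ x → ∣ f x - L ∣ < ε)

  ∑∞ : (ℕ → ℝ) → ℝ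
  ∑∞ a = lim λ n → sum {n} λ k → a (toℕ k)

  cos sin : ℝ → ℝ
  cos x = ∑∞ λ n → (- 1#) ^ n * x ^ (2 ℕ.* n) / ℕ→ℝ ((2 ℕ.* n) !)
  sin x = ∑∞ λ n → (- 1#) ^ n * x ^ (2 ℕ.* n ℕ.+ 1) / ℕ→ℝ ((2 ℕ.* n ℕ.+ 1) !)

  π : ℝ
  π = the 0# λ p → 0# < p × sin p ≈ 0# × (∀ x → 0# < x → x < p → ¬ (sin x ≈ 0#))

  record TaggedPartition (a b : ℝ) (n : ℕ) : Set where
    field
      point    : Vector ℝ (ℕ.suc n)
      tag      : Vector ℝ n
      first    : point zero ≈ a
      last     : point (fromℕ n) ≈ b
      tag-low  : ∀ i → point (inject₁ i) ≤ tag i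
      tag-high : ∀ i → tag i ≤ point (suc i)

    width : Vector ℝ n
    width i = point (suc i) - point (inject₁ i)

    riemannSum : (ℝ → ℝ) → ℝ
    riemannSum f = sum λ i → f (tag i) * width i

  -- Meaningful for a ≤ b only: otherwise there are no partitions.

  ∫ : ℝ → ℝ → (ℝ → ℝ) → ℝ
  ∫ a b f = the 0# λ I →
    ∀ ε → 0# < ε → ∃[ δ ] (0# < δ ×
      (∀ {n} (p : TaggedPartition a b n) → let open TaggedPartition p in
         (∀ i → width i < δ) → ∣ riemannSum f - I ∣ < ε))

  ℂ-setoid : Setoid 0ℓ 0ℓ
  ℂ-setoid = ×-setoid setoid setoid

  open Setoid ℂ-setoid public using () renaming (Carrier to ℂ; _≈_ to _≈ᶜ_)

  re im : ℂ → ℝ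
  re = proj₁
  im = proj₂

  infixl 6 _+ᶜ_
  infixl 7 _*ᶜ_

  _+ᶜ_ _*ᶜ_ : ℂ → ℂ → ℂ
  (x , y) +ᶜ (u , v) = x + u , y + v
  (x , y) *ᶜ (u , v) = x * u - y * v , x * v + y * u

  ℝ→ℂ : ℝ → ℂ
  ℝ→ℂ x = x , 0#

  ℤ→ℂ : ℤ → ℂ
  ℤ→ℂ n = ℝ→ℂ (ℤ→ℝ n)

  ∥_∥ : ℂ → ℝ
  ∥ z ∥ = √ (re z * re z + im z * im z)

  e^i_ : ℝ → ℂ
  e^i θ = cos θ , sin θ

  arg : ℂ → ℝ
  arg z = the 0# λ θ → - π < θ × θ ≤ π × z ≈ᶜ ℝ→ℂ ∥ z ∥ *ᶜ (e^i θ)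

  -- Cardinality of a set of complex numbers (0 if the set is infinite);
  -- elements are counted up to _≈ᶜ_.

  subset : Pred ℂ 0ℓ → Setoid 0ℓ 0ℓ
  subset P = On.setoid {B = ∃ P} ℂ-setoid proj₁

  #_ : Pred ℂ 0ℓ → ℕ
  # P = the 0 λ n → Bijection (≡-setoid (Fin n)) (subset P)

  ℋ : Pred ℂ 0ℓ
  ℋ z = 0# < im z

  record IsCMPointOfDiscriminant (τ : ℂ) (D : ℤ) : Set where
    field
      τ∈ℋ          : τ ∈ ℋ
      a b c        : ℤ
      a≥1          : a ℤ.≥ ℤ.1ℤ
      coprime      : gcd a (gcd b c) ≡ ℤ.1ℤ
      root         : ℤ→ℂ a *ᶜ (τ *ᶜ τ) +ᶜ ℤ→ℂ b *ᶜ τ +ᶜ ℤ→ℂ c ≈ᶜ ℝ→ℂ 0#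
      discriminant : D ≡ b ℤ.* b ℤ.- + 4 ℤ.* a ℤ.* c

  CM : ℝ → Pred ℂ 0ℓ
  CM Δ τ = ∃[ D ] (IsCMPointOfDiscriminant τ D × ℕ→ℝ ℤ.∣ D ∣ ≤ Δ)

  ½ √3/2 : ℝ
  ½    = 1# / ℕ→ℝ 2
  √3/2 = √ ℕ→ℝ 3 / ℕ→ℝ 2

  π/2 2π/3 : ℝ
  π/2  = π / ℕ→ℝ 2
  2π/3 = ℕ→ℝ 2 * π / ℕ→ℝ 3

  LeftBoundary LowerArc : Pred ℂ 0ℓ
  LeftBoundary τ = ∃[ y ] (√3/2 ≤ y × τ ≈ᶜ (- ½ , y))
  LowerArc     τ = ∃[ θ ] (π/2 ≤ θ × θ ≤ 2π/3 × τ ≈ᶜ e^i θ)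

  CMᴸᴮ CMᴸᴬ : ℝ → Pred ℂ 0ℓ
  CMᴸᴮ Δ τ = τ ∈ CM Δ × τ ∈ LeftBoundary
  CMᴸᴬ Δ τ = τ ∈ CM Δ × τ ∈ LowerArc

{-# OPTIONS --safe #-}
module Submission where

-- Call b/a the slope of an integer pair (a, b).  The CM points -½ + iy are the roots of the forms
-- [a, a, c] with a, c coprime: the slope is c/a = y² + ¼ and |D| = a (4c - a).  The CM points e^iθ
-- are the roots of the forms [a, b, a] with a, b coprime: the slope is b/a = -2 cos θ and
-- |D| = 4a² - b².  In both cases |D| = a² q(slope) for a positive function q on slopes, and under
-- these substitutions 2 ds/q(s) becomes dy/y and dθ/sin θ respectively.
--
-- Cutting a slope interval I into thin sectors shows that the number A_I(n) of all pairs with slope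
-- in I and |D| ≤ n is κ_I n/2 + o(n), where κ_I = ∫_I ds/q(s).  Sorting pairs by their gcd g gives
-- A_I(n) = Σ_g P_I(n/g²) for the number P_I of coprime pairs.  For two intervals I and J the main
-- terms of κ_J A_I - κ_I A_J cancel, so Q = κ_J P_I - κ_I P_J satisfies
-- Q(n) = o(n) - Σ_{g ≥ 2} Q(n/g²).  As Σ_{g ≥ 2} 1/g² ≤ 3/4, a bound |Q(n)| ≤ kn + O(1) improves
-- to (3k/4 + ε)n + O(1), hence Q = o(n); the value of ζ(2) is not needed.
--
-- A function f is treated as the derivative of H on [a, b] if |H y - H x - f x (y - x)| ≤ C (y - x)²
-- there.  Summed over a partition this bound gives the Riemann integral of f, and a zero derivative
-- forces H to be constant.

open import Defs
open import Algebra.Bundles using (RawRing)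
open import Axiom.ExcludedMiddle using (ExcludedMiddle)
open import Data.Empty using (⊥; ⊥-elim)
open import Data.Fin.Base as Fin using (Fin; toℕ; fromℕ; inject₁)
open import Data.Integer.Base as ℤ using (ℤ; +_; -[1+_])
open import Data.List.Base using (List; []; _∷_; length; lookup; map; _++_; filter; upTo; cartesianProduct)
open import Data.List.Membership.Propositional using () renaming (_∈_ to _∈ₗ_)
open import Data.List.Membership.Propositional.Properties using (∈-lookup; ∈-map⁺; ∈-map⁻; ∈-++⁺ˡ; ∈-++⁺ʳ; ∈-++⁻; ∈-filter⁺; ∈-filter⁻; ∈-upTo⁺; ∈-upTo⁻; ∈-cartesianProduct⁺; ∈-cartesianProduct⁻)
open import Data.List.Membership.Setoid.Properties using (index-injective)
open import Data.List.Properties using (length-map; length-upTo; length-++)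
open import Data.List.Relation.Unary.Any using (index)
open import Data.List.Relation.Unary.Any.Properties using (lookup-index)
open import Data.List.Relation.Unary.Unique.Propositional using (Unique)
open import Data.Maybe.Base using (just; nothing)
open import Data.Nat.Base as ℕ using (ℕ; zero; suc; _!)
open import Data.Nat.Coprimality using (gcd≡1⇒coprime; coprime-divisor)
open import Data.Nat.GCD using (gcd; gcd-comm; gcd-greatest; gcd[m,n]∣m; gcd[m,n]∣n; gcd[m,n]≡0⇒m≡0; c*gcd[m,n]≡gcd[cm,cn])
open import Data.Product.Base using (∃; ∃-syntax; _×_; _,_; proj₁; proj₂)
open import Data.Sum.Base using (_⊎_; inj₁; inj₂; [_,_]′)
open import Function.Bundles using (Bijection)
open import Level using (0ℓ)
open import Relation.Binary.Definitions using (WeaklyDecidable)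
open import Relation.Binary.PropositionalEquality as ≡ using (_≡_)
open import Relation.Binary.PropositionalEquality.Properties using () renaming (setoid to ≡-setoid)
open import Relation.Binary.Structures using (IsTotalOrder)
open import Relation.Nullary using (¬_; Dec; yes; no)
open import Relation.Unary using (Pred; _∈_)
import Algebra.Properties.Ring
import Algebra.Properties.Semiring.Mult
import Algebra.Solver.Ring
import Algebra.Solver.Ring.AlmostCommutativeRing as ACR
import Data.Fin.Properties as Finₚ
import Data.Integer.GCD as ℤGCD
import Data.Integer.Properties as ℤₚ
import Data.List.Relation.Unary.All as All
import Data.List.Relation.Unary.AllPairs as AllPairs
import Data.List.Relation.Unary.Unique.Propositional.Properties as Uniqueₚ
import Data.Nat.Divisibility as Div
import Data.Nat.DivMod as DivMod
import Data.Nat.Properties as ℕₚ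

-- The inverse, square root, limit, π, integral, argument and cardinality of the statement are
-- arbitrary witnesses picked by `the`. Each becomes usable only after existence and uniqueness have
-- been proved, with suprema as the only source of limits. Hence sine, π and the logarithm are built
-- from scratch. A uniform quadratic error is chosen for derivatives because sums, products,
-- compositions and power series keep it with explicit constants, without compactness or a mean
-- value theorem. A sector of width w lies between two triangles whose areas differ by O(w²) n.
-- Cutting it into N parts leaves a total loss of O(1/N) n, so it is enough that q is Lipschitz and
-- bounded below. A negligible κ_J P_I - κ_I P_J says something about P_I / P_J only if P_J grows
-- linearly; that lower bound is proved separately and again rests on 3/4 < 1. Both families pass
-- through the record `Form`, with q(s) = 4s - 1 on the left boundary and q(s) = 4 - s² on the arc.

module Development (em : ExcludedMiddle 0ℓ) (R : CompleteOrderedField) where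

  open Analysis em R
  open import Relation.Binary.Reasoning.Setoid setoid using (begin_; step-≈-⟩; step-≈-⟨; step-≡-⟩; step-≡-⟨; _∎)

  private
    module RP = Algebra.Properties.Ring ring
    module SM = Algebra.Properties.Semiring.Mult semiring

  -- Embedding of the integers and the ring solver

  ℕ→ℝ-+ : ∀ m n → ℕ→ℝ (m ℕ.+ n) ≈ ℕ→ℝ m + ℕ→ℝ n
  ℕ→ℝ-+ m n = SM.×-homo-+ 1# m n

  ℕ→ℝ-* : ∀ m n → ℕ→ℝ (m ℕ.* n) ≈ ℕ→ℝ m * ℕ→ℝ n
  ℕ→ℝ-* = SM.×1-homo-*

  ≡→≈ : ∀ {x y : ℝ} → x ≡ y → x ≈ y
  ≡→≈ ≡.refl = refl

  ℤ→ℝ-neg : ∀ i → ℤ→ℝ (ℤ.- i) ≈ - ℤ→ℝ i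
  ℤ→ℝ-neg (+ zero)  = sym RP.-0#≈0#
  ℤ→ℝ-neg (+ suc n) = refl
  ℤ→ℝ-neg -[1+ n ]  = sym (RP.-‿involutive _)

  ℤ→ℝ-⊖ : ∀ m n → ℤ→ℝ (m ℤ.⊖ n) ≈ ℕ→ℝ m - ℕ→ℝ n
  ℤ→ℝ-⊖ m zero = begin
    ℕ→ℝ m          ≈⟨ +-identityʳ _ ⟨
    ℕ→ℝ m + 0#     ≈⟨ +-congˡ RP.-0#≈0# ⟨
    ℕ→ℝ m - 0#     ∎
  ℤ→ℝ-⊖ zero (suc n) = sym (+-identityˡ _)
  ℤ→ℝ-⊖ (suc m) (suc n) = begin
    ℤ→ℝ (suc m ℤ.⊖ suc n)           ≡⟨ ≡.cong ℤ→ℝ (ℤₚ.[1+m]⊖[1+n]≡m⊖n m n) ⟩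
    ℤ→ℝ (m ℤ.⊖ n)                   ≈⟨ ℤ→ℝ-⊖ m n ⟩
    ℕ→ℝ m - ℕ→ℝ n                   ≈⟨ +-identityˡ _ ⟨
    0# + (ℕ→ℝ m - ℕ→ℝ n)            ≈⟨ +-congʳ (-‿inverseʳ 1#) ⟨
    1# - 1# + (ℕ→ℝ m - ℕ→ℝ n)       ≈⟨ +-assoc _ _ _ ⟩
    1# + (- 1# + (ℕ→ℝ m - ℕ→ℝ n))   ≈⟨ +-congˡ (+-comm _ _) ⟩
    1# + (ℕ→ℝ m - ℕ→ℝ n - 1#)       ≈⟨ +-congˡ (+-assoc _ _ _) ⟩
    1# + (ℕ→ℝ m + (- ℕ→ℝ n - 1#))   ≈⟨ +-assoc _ _ _ ⟨
    1# + ℕ→ℝ m + (- ℕ→ℝ n - 1#)     ≈⟨ +-congˡ (RP.-‿anti-homo-+ 1# _) ⟨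
    ℕ→ℝ (suc m) - ℕ→ℝ (suc n)       ∎

  ℤ→ℝ-+ : ∀ i j → ℤ→ℝ (i ℤ.+ j) ≈ ℤ→ℝ i + ℤ→ℝ j
  ℤ→ℝ-+ (+ m)    (+ n)    = ℕ→ℝ-+ m n
  ℤ→ℝ-+ (+ m)    -[1+ n ] = ℤ→ℝ-⊖ m (suc n)
  ℤ→ℝ-+ -[1+ m ] (+ n)    = trans (ℤ→ℝ-⊖ n (suc m)) (+-comm _ _)
  ℤ→ℝ-+ -[1+ m ] -[1+ n ] = begin
    - ℕ→ℝ (suc (suc (m ℕ.+ n)))       ≡⟨ ≡.cong (λ k → - ℕ→ℝ k) (≡.cong suc (≡.sym (ℕₚ.+-suc m n))) ⟩
    - ℕ→ℝ (suc m ℕ.+ suc n)           ≈⟨ -‿cong (ℕ→ℝ-+ (suc m) (suc n)) ⟩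
    - (ℕ→ℝ (suc m) + ℕ→ℝ (suc n))     ≈⟨ RP.-‿anti-homo-+ _ _ ⟩
    - ℕ→ℝ (suc n) - ℕ→ℝ (suc m)       ≈⟨ +-comm _ _ ⟩
    - ℕ→ℝ (suc m) - ℕ→ℝ (suc n)       ∎

  ℤ→ℝ-* : ∀ i j → ℤ→ℝ (i ℤ.* j) ≈ ℤ→ℝ i * ℤ→ℝ j
  ℤ→ℝ-* (+ m) j = +-* m j
    where
    +-* : ∀ m j → ℤ→ℝ (+ m ℤ.* j) ≈ ℕ→ℝ m * ℤ→ℝ j
    +-* m (+ n)    = trans (≡→≈ (≡.cong ℤ→ℝ (≡.sym (ℤₚ.pos-* m n)))) (ℕ→ℝ-* m n)
    +-* m -[1+ n ] = begin
      ℤ→ℝ (+ m ℤ.* -[1+ n ])         ≡⟨ ≡.cong ℤ→ℝ (ℤₚ.neg-distribʳ-* (+ m) (+ suc n)) ⟨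
      ℤ→ℝ (ℤ.- (+ m ℤ.* + suc n))    ≈⟨ ℤ→ℝ-neg (+ m ℤ.* + suc n) ⟩
      - ℤ→ℝ (+ m ℤ.* + suc n)        ≈⟨ -‿cong (+-* m (+ suc n)) ⟩
      - (ℕ→ℝ m * ℕ→ℝ (suc n))        ≈⟨ RP.-‿distribʳ-* _ _ ⟩
      ℕ→ℝ m * - ℕ→ℝ (suc n)          ∎
  ℤ→ℝ-* -[1+ m ] j = begin
    ℤ→ℝ (-[1+ m ] ℤ.* j)             ≡⟨ ≡.cong ℤ→ℝ (ℤₚ.neg-distribˡ-* (+ suc m) j) ⟨
    ℤ→ℝ (ℤ.- (+ suc m ℤ.* j))        ≈⟨ ℤ→ℝ-neg (+ suc m ℤ.* j) ⟩
    - ℤ→ℝ (+ suc m ℤ.* j)            ≈⟨ -‿cong (ℤ→ℝ-* (+ suc m) j) ⟩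
    - (ℕ→ℝ (suc m) * ℤ→ℝ j)          ≈⟨ RP.-‿distribˡ-* _ _ ⟩
    - ℕ→ℝ (suc m) * ℤ→ℝ j            ∎

  private
    ℤ-rawRing : RawRing 0ℓ 0ℓ
    ℤ-rawRing = record
      { Carrier = ℤ ; _≈_ = _≡_ ; _+_ = ℤ._+_ ; _*_ = ℤ._*_ ; -_ = ℤ.-_ ; 0# = ℤ.0ℤ ; 1# = ℤ.1ℤ }

    ℤ⟶ℝ : ℤ-rawRing ACR.-Raw-AlmostCommutative⟶ ACR.fromCommutativeRing commutativeRing
    ℤ⟶ℝ = record
      { ⟦_⟧ = ℤ→ℝ ; +-homo = ℤ→ℝ-+ ; *-homo = ℤ→ℝ-* ; -‿homo = ℤ→ℝ-neg
      ; 0-homo = refl ; 1-homo = +-identityʳ 1# }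

    -- Normalisation has to cancel coefficients by computation. Equality of integers computes,
    -- whereas an equality of reals decided by `em` would be stuck; so coefficients live in ℤ.
    coeff≟ : WeaklyDecidable (ACR.Induced-equivalence ℤ⟶ℝ)
    coeff≟ i j with i ℤₚ.≟ j
    ... | yes ≡.refl = just refl
    ... | no _       = nothing

  open Algebra.Solver.Ring ℤ-rawRing (ACR.fromCommutativeRing commutativeRing) ℤ⟶ℝ coeff≟
    using (Polynomial; solve; con; _:=_; _:+_; _:*_; _:-_; :-_; _:^_) public

  -- The solver's constant + 1 denotes 1# + 0#; a zeroth power denotes 1# on the nose.
  :1 : ∀ {n} → Polynomial n
  :1 = con (+ 0) :^ 0

  :0 : ∀ {n} → Polynomial n
  :0 = con (+ 0)

  :2 : ∀ {n} → Polynomial n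
  :2 = con (+ 2)

  :4 : ∀ {n} → Polynomial n
  :4 = con (+ 4)

  open IsTotalOrder isTotalOrder public
    using () renaming (refl to ≤-refl; reflexive to ≤-reflexive; trans to ≤-trans; antisym to ≤-antisym;
                       ≤-respˡ-≈ to ≤-respˡ; ≤-respʳ-≈ to ≤-respʳ)

  -- Ordered field arithmetic

  ≤-resp : ∀ {x y x′ y′} → x ≈ x′ → y ≈ y′ → x ≤ y → x′ ≤ y′
  ≤-resp p q r = ≤-respˡ p (≤-respʳ q r)

  decide : (P : Set) → Dec P
  decide P = em {P}

  by-contradiction : {P : Set} → ¬ ¬ P → P
  by-contradiction {P} f with decide P
  ... | yes p = p
  ... | no ¬p = ⊥-elim (f ¬p)

  <⇒≤ : ∀ {x y} → x < y → x ≤ y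
  <⇒≤ = proj₁

  <⇒≱ : ∀ {x y} → x < y → ¬ (y ≤ x)
  <⇒≱ (x≤y , x≉y) y≤x = x≉y (≤-antisym x≤y y≤x)

  ≰⇒> : ∀ {x y} → ¬ (x ≤ y) → y < x
  ≰⇒> {x} {y} x≰y with total x y
  ... | inj₁ x≤y = ⊥-elim (x≰y x≤y)
  ... | inj₂ y≤x = y≤x , λ y≈x → x≰y (≤-reflexive (sym y≈x))

  ≮⇒≥ : ∀ {x y} → ¬ (x < y) → y ≤ x
  ≮⇒≥ x≮y = by-contradiction λ y≰x → x≮y (≰⇒> y≰x)

  ≤-or-> : ∀ x y → x ≤ y ⊎ y < x
  ≤-or-> x y with decide (x ≤ y)
  ... | yes p = inj₁ p
  ... | no ¬p = inj₂ (≰⇒> ¬p)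

  ≤-<-trans : ∀ {x y z} → x ≤ y → y < z → x < z
  ≤-<-trans x≤y y<z = ≤-trans x≤y (<⇒≤ y<z) , λ x≈z → <⇒≱ y<z (≤-respˡ x≈z x≤y)

  <-≤-trans : ∀ {x y z} → x < y → y ≤ z → x < z
  <-≤-trans x<y y≤z = ≤-trans (<⇒≤ x<y) y≤z , λ x≈z → <⇒≱ x<y (≤-respʳ (sym x≈z) y≤z)

  <-trans : ∀ {x y z} → x < y → y < z → x < z
  <-trans x<y y<z = ≤-<-trans (<⇒≤ x<y) y<z

  <-irrefl : ∀ {x} → ¬ (x < x)
  <-irrefl x<x = <⇒≱ x<x ≤-refl

  <-respˡ : ∀ {x y z} → x ≈ z → x < y → z < y
  <-respˡ p (q , n) = ≤-respˡ p q , λ z≈y → n (trans p z≈y)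

  <-respʳ : ∀ {x y z} → y ≈ z → x < y → x < z
  <-respʳ p (q , n) = ≤-respʳ p q , λ x≈z → n (trans x≈z (sym p))

  gap : ∀ {x y} → x ≤ y → 0# ≤ y - x
  gap {x} {y} p = ≤-respˡ (-‿inverseʳ x) (+-mono-≤ (- x) p)

  -- Certificates for inequalities: t is assembled from known gaps, squares and positive constants
  -- with `_⊞_` and `_⊠_`, and the ring solver checks t = y - x. Most estimates below have this
  -- shape.
  ≤-by : ∀ {t x y} → 0# ≤ t → t ≈ y - x → x ≤ y
  ≤-by {t} {x} {y} p e = ≤-resp (+-identityˡ x)
    (trans (+-congʳ e) (solve 2 (λ x y → y :- x :+ x := y) refl x y)) (+-mono-≤ x p)

  gap⁺ : ∀ {x y} → x < y → 0# < y - x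
  gap⁺ {x} {y} (p , n) = gap p , λ e →
    n (trans (sym (+-identityˡ x)) (trans (+-congʳ e) (solve 2 (λ x y → y :- x :+ x := y) refl x y)))

  <-by : ∀ {t x y} → 0# < t → t ≈ y - x → x < y
  <-by {t} {x} {y} (p , n) e = ≤-by p e , λ x≈y →
    n (sym (trans e (trans (+-congʳ (sym x≈y)) (-‿inverseʳ x))))

  ≈-by : ∀ {t x y} → t ≈ 0# → t ≈ y - x → x ≈ y
  ≈-by {t} {x} {y} p e = sym (trans (solve 2 (λ x y → y := (y :- x) :+ x) refl x y)
    (trans (+-congʳ (trans (sym e) p)) (+-identityˡ x)))

  gap₀ : ∀ {x y} → x ≈ y → y - x ≈ 0#
  gap₀ {x} {y} p = trans (+-congʳ (sym p)) (-‿inverseʳ x)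

  infixl 6 _⊞_ _⊞⁺_
  infixl 7 _⊠_ _⊠⁺_

  _⊞_ : ∀ {x y} → 0# ≤ x → 0# ≤ y → 0# ≤ x + y
  _⊞_ {x} {y} p q = ≤-trans q (≤-respˡ (+-identityˡ y) (+-mono-≤ y p))

  _⊠_ : ∀ {x y} → 0# ≤ x → 0# ≤ y → 0# ≤ x * y
  _⊠_ = *-nonneg

  _⊞⁺_ : ∀ {x y} → 0# < x → 0# ≤ y → 0# < x + y
  _⊞⁺_ {x} {y} p q = <-≤-trans p
    (≤-by {y} q (solve 2 (λ x y → y := x :+ y :- x) refl x y))

  +-mono : ∀ {x y u v} → x ≤ y → u ≤ v → x + u ≤ y + v
  +-mono {x} {y} {u} {v} p q = ≤-by (gap p ⊞ gap q)
    (solve 4 (λ x y u v → (y :- x) :+ (v :- u) := (y :+ v) :- (x :+ u)) refl x y u v)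

  *-monoˡ : ∀ {k x y} → 0# ≤ k → x ≤ y → k * x ≤ k * y
  *-monoˡ {k} {x} {y} p q = ≤-by (p ⊠ gap q)
    (solve 3 (λ k x y → k :* (y :- x) := k :* y :- k :* x) refl k x y)

  *-monoʳ : ∀ {k x y} → 0# ≤ k → x ≤ y → x * k ≤ y * k
  *-monoʳ {k} {x} {y} p q = ≤-by (gap q ⊠ p)
    (solve 3 (λ k x y → (y :- x) :* k := y :* k :- x :* k) refl k x y)

  neg-mono : ∀ {x y} → x ≤ y → - y ≤ - x
  neg-mono {x} {y} p = ≤-by (gap p) (solve 2 (λ x y → y :- x := (:- x) :- (:- y)) refl x y)

  *-mono : ∀ {x y u v} → 0# ≤ x → 0# ≤ u → x ≤ y → u ≤ v → x * u ≤ y * v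
  *-mono p q r s = ≤-trans (*-monoʳ q r) (*-monoˡ (≤-trans p r) s)

  sq≥0 : ∀ x → 0# ≤ x * x
  sq≥0 x with total 0# x
  ... | inj₁ p = p ⊠ p
  ... | inj₂ p = ≤-respʳ (solve 1 (λ x → (:0 :- x) :* (:0 :- x) := x :* x) refl x) (gap p ⊠ gap p)

  0<1 : 0# < 1#
  0<1 = ≤-respʳ (*-identityˡ 1#) (sq≥0 1#) , 0≉1

  ≤-+1 : ∀ x → x ≤ x + 1#
  ≤-+1 x = ≤-by (<⇒≤ 0<1) (solve 1 (λ x → :1 := x :+ :1 :- x) refl x)

  +1>0 : ∀ {x} → 0# ≤ x → 0# < x + 1#
  +1>0 {x} p = ≤-<-trans p (<-by 0<1 (solve 1 (λ x → :1 := x :+ :1 :- x) refl x))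

  ℕ→ℝ≥0 : ∀ n → 0# ≤ ℕ→ℝ n
  ℕ→ℝ≥0 zero    = ≤-refl
  ℕ→ℝ≥0 (suc n) = <⇒≤ 0<1 ⊞ ℕ→ℝ≥0 n

  ℕ→ℝ>0 : ∀ n → 0# < ℕ→ℝ (suc n)
  ℕ→ℝ>0 n = 0<1 ⊞⁺ ℕ→ℝ≥0 n

  >⇒≉ : ∀ {x} → 0# < x → ¬ (x ≈ 0#)
  >⇒≉ (_ , n) e = n (sym e)

  -- The witness picked by `em` need not be the one supplied here. Only its membership in P is
  -- known, so every use is followed by a uniqueness argument.
  the-∈ : ∀ {A : Set} {d : A} {P : Pred A 0ℓ} → ∃ P → P (the d P)
  the-∈ {P = P} w with em {∃ P}
  ... | yes (_ , p) = p
  ... | no ¬w = ⊥-elim (¬w w)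

  inv-right : ∀ {x} → ¬ (x ≈ 0#) → x * x ⁻¹ ≈ 1#
  inv-right {x} n = the-∈ (inverse x n)

  inv-unique : ∀ {x y} → x * y ≈ 1# → y ≈ x ⁻¹
  inv-unique {x} {y} e = trans (sym (*-identityʳ y)) (trans (*-congˡ (sym (inv-right n)))
    (trans (solve 3 (λ x y z → y :* (x :* z) := (x :* y) :* z) refl x y (x ⁻¹))
      (trans (*-congʳ e) (*-identityˡ _))))
    where
    n : ¬ (x ≈ 0#)
    n p = 0≉1 (trans (sym (zeroˡ y)) (trans (*-congʳ (sym p)) e))

  zero-product : ∀ {x y} → x * y ≈ 0# → ¬ (x ≈ 0#) → y ≈ 0#
  zero-product {x} {y} e n = trans (sym (*-identityˡ y)) (trans (*-congʳ (sym (inv-right n)))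
    (trans (solve 3 (λ x y z → (x :* z) :* y := z :* (x :* y)) refl x y (x ⁻¹))
      (trans (*-congˡ e) (zeroʳ _))))

  _⊠⁺_ : ∀ {x y} → 0# < x → 0# < y → 0# < x * y
  p ⊠⁺ q = <⇒≤ p ⊠ <⇒≤ q , λ e → >⇒≉ q (zero-product (sym e) (>⇒≉ p))

  cancel≤ : ∀ {k x y} → 0# < k → k * x ≤ k * y → x ≤ y
  cancel≤ {k} {x} {y} p q with ≤-or-> x y
  ... | inj₁ r = r
  ... | inj₂ r = ⊥-elim (<⇒≱ (<-by (p ⊠⁺ gap⁺ r)
    (solve 3 (λ k x y → k :* (x :- y) := k :* x :- k :* y) refl k x y)) q)

  cancel≈ : ∀ {k x y} → ¬ (k ≈ 0#) → k * x ≈ k * y → x ≈ y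
  cancel≈ {k} {x} {y} n e = ≈-by {y - x} (zero-product {k}
    (trans (solve 3 (λ k x y → k :* (y :- x) := k :* y :- k :* x) refl k x y) (gap₀ e)) n) refl

  inv>0 : ∀ {x} → 0# < x → 0# < x ⁻¹
  inv>0 {x} p = ≰⇒> λ q → <⇒≱ 0<1 (≤-by (<⇒≤ p ⊠ gap q)
    (trans (solve 2 (λ x y → x :* (:0 :- y) := :0 :- x :* y) refl x (x ⁻¹)) (+-congˡ (-‿cong (inv-right (>⇒≉ p))))))

  inv-cong : ∀ {x y} → ¬ (x ≈ 0#) → x ≈ y → x ⁻¹ ≈ y ⁻¹
  inv-cong {x} {y} n e = inv-unique (trans (*-congʳ (sym e)) (inv-right n))

  /-cancel : ∀ {x y} → ¬ (y ≈ 0#) → x / y * y ≈ x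
  /-cancel {x} {y} n = trans (solve 3 (λ x y z → x :* z :* y := x :* (y :* z)) refl x y (y ⁻¹))
    (trans (*-congˡ (inv-right n)) (*-identityʳ x))

  /-unique : ∀ {x y z} → ¬ (y ≈ 0#) → z * y ≈ x → z ≈ x / y
  /-unique {x} {y} {z} n e = cancel≈ {y} n (trans (*-comm y z) (trans e (trans (sym (/-cancel n)) (*-comm _ y))))

  /-cong : ∀ {x y u v} → ¬ (y ≈ 0#) → x ≈ u → y ≈ v → x / y ≈ u / v
  /-cong n e f = *-cong e (inv-cong n f)

  2≉0 : ¬ (ℕ→ℝ 2 ≈ 0#)
  2≉0 = >⇒≉ (ℕ→ℝ>0 1)

  ℕ→ℝ≉0 : ∀ n → ¬ (ℕ→ℝ (suc n) ≈ 0#)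
  ℕ→ℝ≉0 n = >⇒≉ (ℕ→ℝ>0 n)

  ½+½ : ½ + ½ ≈ 1#
  ½+½ = trans (solve 1 (λ h → h :+ h := h :* :2) refl ½) (/-cancel 2≉0)

  ½>0 : 0# < ½
  ½>0 = 0<1 ⊠⁺ inv>0 (ℕ→ℝ>0 1)

  opaque
    -- Sealed, so that halves stay atoms for the solver and the type checker; outside this block
    -- only the three facts proved with it are available.
    half : ℝ → ℝ
    half x = ½ * x

    half-sum : ∀ x → half x + half x ≈ x
    half-sum x = trans (solve 2 (λ h x → h :* x :+ h :* x := (h :+ h) :* x) refl ½ x) (trans (*-congʳ ½+½) (*-identityˡ x))

    half≈½* : ∀ x → half x ≈ ½ * x
    half≈½* x = refl

    half>0 : ∀ {x} → 0# < x → 0# < half x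
    half>0 p = ½>0 ⊠⁺ p

  half<self : ∀ {x} → 0# < x → half x < x
  half<self {x} p = <-by (half>0 p) (trans (solve 1 (λ h → h := (h :+ h) :- h) refl (half x)) (+-congʳ (half-sum x)))

  -- Two-sided bounds

  infix 4 _∈±_

  -- Stands for |x| ≤ k. The function `∣_∣` branches on `total`, which is awkward in calculations,
  -- while a pair of inequalities combines linearly; `±-abs` and `abs-≤` translate between the two.
  record _∈±_ (x k : ℝ) : Set where
    constructor _,_
    field
      lower : - k ≤ x
      upper : x ≤ k
  open _∈±_ public

  ±-resp : ∀ {x y k l} → x ≈ y → k ≈ l → x ∈± k → y ∈± l
  ±-resp p q (a , b) = ≤-resp (-‿cong q) p a , ≤-resp p q b

  ±-respˡ : ∀ {x y k} → x ≈ y → x ∈± k → y ∈± k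
  ±-respˡ p = ±-resp p refl

  ±-respʳ : ∀ {x k l} → k ≈ l → x ∈± k → x ∈± l
  ±-respʳ = ±-resp refl

  ±-≤ : ∀ {x k l} → k ≤ l → x ∈± k → x ∈± l
  ±-≤ p (a , b) = ≤-trans (neg-mono p) a , ≤-trans b p

  ±-≥0 : ∀ {x k} → x ∈± k → 0# ≤ k
  ±-≥0 {x} {k} (a , b) with total 0# k
  ... | inj₁ p = p
  ... | inj₂ p = ≤-trans (≤-by (gap p) (solve 1 (λ k → :0 :- k := (:- k) :- :0) refl k)) (≤-trans a b)

  ±-+ : ∀ {x y k l} → x ∈± k → y ∈± l → x + y ∈± k + l
  ±-+ {x} {y} {k} {l} (a , b) (c , d) =
    ≤-by (gap a ⊞ gap c) (solve 4 (λ x y k l → (x :- :- k) :+ (y :- :- l) := (x :+ y) :- (:- (k :+ l))) refl x y k l)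
    , +-mono b d

  ±-neg : ∀ {x k} → x ∈± k → - x ∈± k
  ±-neg {x} {k} (a , b) = neg-mono b , ≤-respʳ (solve 1 (λ k → :- (:- k) := k) refl k) (neg-mono a)

  ±-- : ∀ {x y k l} → x ∈± k → y ∈± l → x - y ∈± k + l
  ±-- p q = ±-+ p (±-neg q)

  ±-scale : ∀ {x k c} → 0# ≤ c → x ∈± k → c * x ∈± c * k
  ±-scale {x} {k} {c} p (a , b) =
    ≤-respˡ (solve 2 (λ c k → c :* (:- k) := :- (c :* k)) refl c k) (*-monoˡ p a) , *-monoˡ p b

  ±-* : ∀ {x y k l} → x ∈± k → y ∈± l → x * y ∈± k * l
  ±-* {x} {y} {k} {l} p q with total 0# x
  ... | inj₁ x≥0 = ±-≤ (*-monoʳ (±-≥0 q) (upper p)) (±-scale x≥0 q)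
  ... | inj₂ x≤0 = ±-respˡ (solve 2 (λ x y → (:- x) :* (:- y) := x :* y) refl x y)
    (±-≤ (*-monoʳ (±-≥0 q) (upper (±-neg p)))
      (±-scale (≤-by (gap x≤0) (solve 1 (λ x → :0 :- x := :- x :- :0) refl x)) (±-neg q)))

  ±-0 : ∀ {k} → 0# ≤ k → 0# ∈± k
  ±-0 {k} p = ≤-by p (solve 1 (λ k → k := :0 :- (:- k)) refl k) , p

  ±-self : ∀ {x} → 0# ≤ x → x ∈± x
  ±-self {x} p = ≤-by (p ⊞ p) (solve 1 (λ k → k :+ k := k :- (:- k)) refl x) , ≤-refl

  ±-nonneg : ∀ {x k} → 0# ≤ x → x ≤ k → x ∈± k
  ±-nonneg p q = ±-≤ q (±-self p)

  ±-zero : ∀ {x} → x ∈± 0# → x ≈ 0#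
  ±-zero (a , b) = ≤-antisym b (≤-respˡ (solve 0 (:- :0 := :0) refl) a)

  ±-abs : ∀ x → x ∈± ∣ x ∣
  ±-abs x with total 0# x
  ... | inj₁ p = ±-self p
  ... | inj₂ p = ±-resp (solve 1 (λ x → :- (:- x) := x) refl x) refl (±-neg (±-self (≤-by (gap p) (solve 1 (λ x → :0 :- x := :- x :- :0) refl x))))

  abs≥0 : ∀ x → 0# ≤ ∣ x ∣
  abs≥0 x = ±-≥0 (±-abs x)

  abs-≤ : ∀ {x k} → x ∈± k → ∣ x ∣ ≤ k
  abs-≤ {x} p with total 0# x
  ... | inj₁ _ = upper p
  ... | inj₂ _ = upper (±-neg p)

  abs-< : ∀ {x k l} → x ∈± k → k < l → ∣ x ∣ < l
  abs-< p q = ≤-<-trans (abs-≤ p) q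

  ±-abs< : ∀ {x k} → ∣ x ∣ < k → x ∈± k
  ±-abs< {x} p = ±-≤ (<⇒≤ p) (±-abs x)

  ≤-by-small : ∀ {x y} → (∀ ε → 0# < ε → x ≤ y + ε) → x ≤ y
  ≤-by-small {x} {y} h with ≤-or-> x y
  ... | inj₁ p = p
  ... | inj₂ p = ⊥-elim (<⇒≱ (<-by (gap⁺ (half<self (gap⁺ p)))
    (solve 3 (λ x y e → x :- y :- e := x :- (y :+ e)) refl x y (half (x - y)))) (h _ (half>0 (gap⁺ p))))

  zero-by-small : ∀ {x} → (∀ ε → 0# < ε → x ∈± ε) → x ≈ 0#
  zero-by-small {x} h = ≤-antisym
    (≤-by-small λ ε p → ≤-respʳ (sym (+-identityˡ ε)) (upper (h ε p)))
    (≤-by-small λ ε p → ≤-by (gap (lower (h ε p))) (solve 2 (λ x e → x :- :- e := (x :+ e) :- :0) refl x ε))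

  -- The Archimedean property and suprema

  opaque
    -- If x exceeded every natural number, the reals lying below some natural number would have a
    -- supremum s. This set is closed under adding 1, so s - 1 would be an upper bound too.
    archimedean : ∀ x → ∃[ n ] (x ≤ ℕ→ℝ n)
    archimedean x = by-contradiction λ none →
      let P : Pred ℝ 0ℓ
          P y = ∃[ n ] (y ≤ ℕ→ℝ n)
          (s , ub , least) = supremum P (0# , 0 , ≤-refl)
            (x , λ { {y} (n , p) → ≤-trans p (<⇒≤ (≰⇒> λ q → none (n , q))) })
          sub : ∀ {y} → P y → y ≤ s - 1#
          sub = λ { {y} (n , p) → ≤-by (gap (ub {y + 1#} (suc n ,
            ≤-by (gap p) (solve 2 (λ y n → n :- y := (:1 :+ n) :- (y :+ :1)) refl y (ℕ→ℝ n)))))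
            (solve 2 (λ s y → s :- (y :+ :1) := (s :- :1) :- y) refl s y) }
      in <⇒≱ 0<1 (≤-by (gap (least (λ {y} → sub {y}))) (solve 1 (λ s → s :- :1 :- s := :0 :- :1) refl s))

  archimedean⁺ : ∀ x → ∃[ n ] (x ≤ ℕ→ℝ (suc n))
  archimedean⁺ x = let (n , p) = archimedean x in n , ≤-trans p (≤-by (<⇒≤ 0<1) (solve 1 (λ n → :1 := :1 :+ n :- n) refl (ℕ→ℝ n)))

  ℕ→ℝ-mono : ∀ {m n} → m ℕ.≤ n → ℕ→ℝ m ≤ ℕ→ℝ n
  ℕ→ℝ-mono {n = n} ℕ.z≤n = ℕ→ℝ≥0 n
  ℕ→ℝ-mono (ℕ.s≤s p) = +-mono ≤-refl (ℕ→ℝ-mono p)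

  ℕ→ℝ-mono⁻ : ∀ {m n} → ℕ→ℝ m ≤ ℕ→ℝ n → m ℕ.≤ n
  ℕ→ℝ-mono⁻ {m} {n} p with m ℕₚ.≤? n
  ... | yes q = q
  ... | no ¬q = ⊥-elim (<⇒≱ (<-≤-trans
    (<-by {1#} 0<1 (solve 1 (λ n → :1 := :1 :+ n :- n) refl (ℕ→ℝ n))) (ℕ→ℝ-mono (ℕₚ.≰⇒> ¬q))) p)

  ℕ→ℝ-injective : ∀ {m n} → ℕ→ℝ m ≈ ℕ→ℝ n → m ≡ n
  ℕ→ℝ-injective p = ℕₚ.≤-antisym (ℕ→ℝ-mono⁻ (≤-reflexive p)) (ℕ→ℝ-mono⁻ (≤-reflexive (sym p)))

  sup-approx : ∀ {P : Pred ℝ 0ℓ} {s} → (∀ {u} → u ∈ UpperBound P → s ≤ u) →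
               ∀ {ε} → 0# < ε → ∃[ x ] (P x × s - ε < x)
  sup-approx {P} {s} least {ε} ε>0 = by-contradiction λ none →
    <⇒≱ ε>0 (≤-by (gap (least {s - ε} (λ {x} x∈P → ≮⇒≥ λ q → none (x , x∈P , q))))
      (solve 2 (λ s e → s :- e :- s := :0 :- e) refl s ε))

  -- Finite sums

  ∑< : ℕ → (ℕ → ℝ) → ℝ
  ∑< n a = sum {n} λ k → a (toℕ k)

  ∑-cong : ∀ n {a b : ℕ → ℝ} → (∀ k → k ℕ.< n → a k ≈ b k) → ∑< n a ≈ ∑< n b
  ∑-cong zero    h = refl
  ∑-cong (suc n) {a} {b} h = +-cong (h 0 ℕ.z<s) (∑-cong n {λ k → a (suc k)} {λ k → b (suc k)} λ k p → h (suc k) (ℕ.s<s p))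

  ∑-snoc : ∀ n (a : ℕ → ℝ) → ∑< (suc n) a ≈ ∑< n a + a n
  ∑-snoc zero    a = +-comm (a 0) 0#
  ∑-snoc (suc n) a = trans (+-congˡ (∑-snoc n (λ k → a (suc k)))) (sym (+-assoc _ _ _))

  ∑-+ : ∀ n (a b : ℕ → ℝ) → ∑< n (λ k → a k + b k) ≈ ∑< n a + ∑< n b
  ∑-+ zero    a b = sym (+-identityˡ 0#)
  ∑-+ (suc n) a b = trans (+-congˡ (∑-+ n (λ k → a (suc k)) (λ k → b (suc k))))
    (solve 4 (λ a b c d → a :+ b :+ (c :+ d) := a :+ c :+ (b :+ d)) refl (a 0) (b 0) _ _)

  ∑-* : ∀ n c (a : ℕ → ℝ) → ∑< n (λ k → c * a k) ≈ c * ∑< n a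
  ∑-* zero    c a = sym (zeroʳ c)
  ∑-* (suc n) c a = trans (+-congˡ (∑-* n c (λ k → a (suc k)))) (sym (distribˡ c _ _))

  ∑-≤ : ∀ n {a b : ℕ → ℝ} → (∀ k → k ℕ.< n → a k ≤ b k) → ∑< n a ≤ ∑< n b
  ∑-≤ zero    h = ≤-refl
  ∑-≤ (suc n) {a} {b} h = +-mono (h 0 ℕ.z<s) (∑-≤ n {λ k → a (suc k)} {λ k → b (suc k)} λ k p → h (suc k) (ℕ.s<s p))

  ∑-± : ∀ n {a b : ℕ → ℝ} → (∀ k → k ℕ.< n → a k ∈± b k) → ∑< n a ∈± ∑< n b
  ∑-± zero    h = ±-0 ≤-refl
  ∑-± (suc n) {a} {b} h = ±-+ (h 0 ℕ.z<s) (∑-± n {λ k → a (suc k)} {λ k → b (suc k)} λ k p → h (suc k) (ℕ.s<s p))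

  ∑-const : ∀ n c → ∑< n (λ _ → c) ≈ ℕ→ℝ n * c
  ∑-const zero    c = sym (zeroˡ c)
  ∑-const (suc n) c = trans (+-congˡ (∑-const n c))
    (solve 2 (λ n c → c :+ n :* c := (:1 :+ n) :* c) refl (ℕ→ℝ n) c)

  ∑-telescope : ∀ n (a : ℕ → ℝ) → ∑< n (λ k → a (suc k) - a k) ≈ a n - a 0
  ∑-telescope zero    a = sym (-‿inverseʳ (a 0))
  ∑-telescope (suc n) a = trans (+-congˡ (∑-telescope n (λ k → a (suc k))))
    (solve 3 (λ x y z → (y :- x) :+ (z :- y) := z :- x) refl (a 0) (a 1) (a (suc n)))

  -- Limits of sequences

  Converges : (ℕ → ℝ) → ℝ → Set
  Converges u L = ∀ ε → 0# < ε → ∃[ N ] (∀ n → N ℕ.≤ n → u n - L ∈± ε)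

  ±-by-small : ∀ {x k} → (∀ ε → 0# < ε → x ∈± k + ε) → x ∈± k
  ±-by-small {x} {k} h =
    (≤-by-small λ ε p → ≤-by (gap (lower (h ε p)))
      (solve 3 (λ x k e → x :- :- (k :+ e) := (x :+ e) :- (:- k)) refl x k ε)) ,
    (≤-by-small λ ε p → upper (h ε p))

  limit-± : ∀ {u L x k} → Converges u L → ∃[ N ] (∀ n → N ℕ.≤ n → u n - x ∈± k) → L - x ∈± k
  limit-± {u} {L} {x} {k} conv (N , h) = ±-by-small bound
    where
    bound : ∀ ε → 0# < ε → L - x ∈± k + ε
    bound ε p = let (M , c) = conv ε p in ±-respˡ (solve 3 (λ u x l → u :- x :- (u :- l) := l :- x) refl (u (N ℕ.⊔ M)) x L)
      (±-- (h _ (ℕₚ.m≤m⊔n N M)) (c _ (ℕₚ.m≤n⊔m N M)))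

  limit-unique : ∀ {u L L′} → Converges u L → Converges u L′ → L ≈ L′
  limit-unique {u} {L} {L′} p q = ≈-by {L′ - L}
    (zero-by-small λ ε ε>0 → limit-± q (p ε ε>0)) refl

  lim-≈ : ∀ {u L} → Converges u L → lim u ≈ L
  lim-≈ {u} {L} p = limit-unique (λ ε ε>0 → let (N , h) = spec ε ε>0 in N , λ n n≥N → ±-abs< (h n n≥N)) p
    where
    IsLimit : Pred ℝ 0ℓ
    IsLimit L = ∀ ε → 0# < ε → ∃[ N ] (∀ n → N ℕ.≤ n → ∣ u n - L ∣ < ε)
    spec : IsLimit (lim u)
    spec = the-∈ {d = 0#} {IsLimit} (L , λ ε ε>0 → let (N , h) = p (half ε) (half>0 ε>0) in
      N , λ n n≥N → abs-< (h n n≥N) (half<self ε>0))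

  Converges-cong : ∀ {u v L} → (∀ n → u n ≈ v n) → Converges u L → Converges v L
  Converges-cong e p ε ε>0 = let (N , h) = p ε ε>0 in N , λ n n≥N → ±-respˡ (+-congʳ (e n)) (h n n≥N)

  Converges-+ : ∀ {u v L M} → Converges u L → Converges v M → Converges (λ n → u n + v n) (L + M)
  Converges-+ {u} {v} {L} {M} p q ε ε>0 = let (N₁ , h₁) = p (half ε) (half>0 ε>0) ; (N₂ , h₂) = q (half ε) (half>0 ε>0) in
    N₁ ℕ.⊔ N₂ , λ n n≥N → ±-resp
    (solve 4 (λ u v l m → (u :- l) :+ (v :- m) := (u :+ v) :- (l :+ m)) refl (u n) (v n) L M) (half-sum ε)
    (±-+ (h₁ n (ℕₚ.m⊔n≤o⇒m≤o N₁ N₂ n≥N)) (h₂ n (ℕₚ.m⊔n≤o⇒n≤o N₁ N₂ n≥N)))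

  Converges-neg : ∀ {u L} → Converges u L → Converges (λ n → - u n) (- L)
  Converges-neg {u} {L} p ε ε>0 = let (N , h) = p ε ε>0 in N , λ n n≥N →
    ±-respˡ (solve 2 (λ u l → :- (u :- l) := (:- u) :- (:- l)) refl (u n) L) (±-neg (h n n≥N))

  Converges-scale : ∀ {u L} c → Converges u L → Converges (λ n → u n * c) (L * c)
  Converges-scale {u} {L} c p ε ε>0 = let (N , h) = p (ε / (∣ c ∣ + 1#)) (ε>0 ⊠⁺ inv>0 k>0) in
    N , λ n n≥N → ±-respʳ (/-cancel (>⇒≉ k>0)) (±-respˡ
      (solve 3 (λ u l c → (u :- l) :* c := u :* c :- l :* c) refl (u n) L c)
      (±-* (h n n≥N) (±-≤ (≤-+1 ∣ c ∣) (±-abs c))))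
    where
    k>0 : 0# < ∣ c ∣ + 1#
    k>0 = +1>0 (abs≥0 c)

  monotone-≤ : ∀ {u : ℕ → ℝ} → (∀ n → u n ≤ u (suc n)) → ∀ {m n} → m ℕ.≤ n → u m ≤ u n
  monotone-≤ {u} h {m} p = go (ℕₚ.≤⇒≤′ p)
    where
    go : ∀ {n} → m ℕ.≤′ n → u m ≤ u n
    go (ℕ.≤′-reflexive ≡.refl) = ≤-refl
    go (ℕ.≤′-step q) = ≤-trans (go q) (h _)

  monotone-convergence : ∀ {u B} → (∀ n → u n ≤ u (suc n)) → (∀ n → u n ≤ B) → ∃ (Converges u)
  monotone-convergence {u} {B} mono bound = let (s , ub , least) = supremum (λ x → ∃[ n ] (x ≤ u n))
                                                      (u 0 , 0 , ≤-refl) (B , λ { (n , p) → ≤-trans p (bound n) }) in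
    s , λ ε ε>0 → let (x , (N , x≤) , s-ε<x) = sup-approx (λ {u} → least {u}) ε>0 in
    N , λ n n≥N →
      ≤-by (gap (≤-trans (<⇒≤ s-ε<x) (≤-trans x≤ (monotone-≤ mono n≥N))))
        (solve 3 (λ s e u → u :- (s :- e) := (u :- s) :- (:- e)) refl s ε (u n)) ,
      ≤-trans (≤-by (gap (ub {u n} (n , ≤-refl))) (solve 2 (λ s u → s :- u := :0 :- (u :- s)) refl s (u n))) (<⇒≤ ε>0)

  -- Both Σ (a + b) and Σ b have nonnegative terms and bounded partial sums, so monotone convergence
  -- applies to each, and Σ a is their difference. This avoids a Cauchy criterion.
  comparison-test : ∀ {a b : ℕ → ℝ} {B} → (∀ k → a k ∈± b k) → (∀ n → ∑< n b ≤ B) → ∃ (Converges λ n → ∑< n a)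
  comparison-test {a} {b} {B} a≤b bound =
    let (L₁ , c₁) = monotone-convergence {λ n → ∑< n λ k → a k + b k} {B + B}
          (λ n → grow n λ k → ≤-by (gap (lower (a≤b k))) (solve 2 (λ a b → a :- :- b := a :+ b :- :0) refl (a k) (b k)))
          (λ n → ≤-respˡ (sym (∑-+ n a b)) (+-mono (≤-trans (∑-≤ n λ k _ → upper (a≤b k)) (bound n)) (bound n)))
        (L₂ , c₂) = monotone-convergence {λ n → ∑< n b} {B} (λ n → grow n λ k → ±-≥0 (a≤b k)) bound
    in L₁ - L₂ , Converges-cong
         (λ n → trans (+-congʳ (∑-+ n a b)) (solve 2 (λ a b → a :+ b :- b := a) refl (∑< n a) (∑< n b)))
         (Converges-+ c₁ (Converges-neg c₂))
    where
    grow : ∀ {c : ℕ → ℝ} n → (∀ k → 0# ≤ c k) → ∑< n c ≤ ∑< (suc n) c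
    grow {c} n c≥0 = ≤-respʳ (sym (∑-snoc n c))
      (≤-by (c≥0 n) (solve 2 (λ s c → c := s :+ c :- s) refl (∑< n c) (c n)))

  -- Zeros of Lipschitz functions

  Lipschitz : ℝ → ℝ → ℝ → (ℝ → ℝ) → Set
  Lipschitz a b C g = ∀ {x y} → a ≤ x → x ≤ b → a ≤ y → y ≤ b → ∀ {δ} → y - x ∈± δ → g y - g x ∈± C * δ

  Lipschitz-cong : ∀ {a b C g} → Lipschitz a b C g → ∀ {x y} → a ≤ x → x ≤ b → a ≤ y → y ≤ b → x ≈ y → g x ≈ g y
  Lipschitz-cong lip p q r s e = ≈-by (±-zero (±-respʳ (zeroʳ _) (lip p q r s
    (±-respˡ (sym (gap₀ e)) (±-0 ≤-refl))))) refl

  opaque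
    -- Here z is the supremum of the x for which g > 0 on [a, x]. A nonzero value g z would keep its
    -- sign on a neighbourhood of radius η with C η = |g z| / 2, contradicting the choice of z.
    -- Positivity to the left of z, not only the existence of a zero, is what the construction of π
    -- uses.
    first-zero : ∀ {a b C g} → 0# < C → Lipschitz a b C g → a ≤ b → 0# < g a → g b ≤ 0# →
                 ∃[ z ] (a ≤ z × z ≤ b × g z ≈ 0# × (∀ y → a ≤ y → y < z → 0# < g y))
    first-zero {a} {b} {C} {g} C>0 lip a≤b ga>0 gb≤0 = z , a≤z , z≤b , ≤-antisym gz≤0 gz≥0 , λ y → below {y}
      where
      P : Pred ℝ 0ℓ
      P x = a ≤ x × x ≤ b × (∀ y → a ≤ y → y ≤ x → 0# < g y)
      Pa : P a
      Pa = ≤-refl , a≤b , λ y a≤y y≤a →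
        <-respʳ (Lipschitz-cong {g = g} lip ≤-refl a≤b a≤y (≤-trans y≤a a≤b) (≤-antisym a≤y y≤a)) ga>0
      sup : ∃[ s ] (s ∈ UpperBound P × (∀ {u} → u ∈ UpperBound P → s ≤ u))
      sup = supremum P (a , Pa) (b , λ p → proj₁ (proj₂ p))
      z : ℝ
      z = proj₁ sup
      ub : ∀ {x} → P x → x ≤ z
      ub = proj₁ (proj₂ sup)
      a≤z : a ≤ z
      a≤z = ub Pa
      z≤b : z ≤ b
      z≤b = proj₂ (proj₂ sup) {b} λ p → proj₁ (proj₂ p)
      approx : ∀ {ε} → 0# < ε → ∃[ x ] (P x × z - ε < x)
      approx = sup-approx (λ {u} → proj₂ (proj₂ sup) {u})
      below : ∀ {y} → a ≤ y → y < z → 0# < g y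
      below {y} a≤y y<z = let (x , (_ , _ , pos) , q) = approx (gap⁺ y<z) in
        pos y a≤y (<⇒≤ (<-respˡ (solve 2 (λ y z → z :- (z :- y) := y) refl y z) q))
      radius : ∀ {t} → 0# < t → ∃[ η ] (0# < η × C * η ≈ half t)
      radius {t} t>0 = half t / C , half>0 t>0 ⊠⁺ inv>0 C>0 , trans (*-comm C _) (/-cancel (>⇒≉ C>0))
      near : ∀ {x y η t} → 0# < t → C * η ≈ half t → a ≤ x → x ≤ b → a ≤ y → y ≤ b → y - x ∈± η → g x ≈ t → 0# < g y
      near {x} {y} {η} {t} t>0 e p q r s h gx = <-≤-trans (half>0 t>0)
        (≤-by (gap (lower (±-respʳ e (lip p q r s h))))
          (trans (solve 3 (λ gx gy t → gy :- gx :- :- t := gy :- gx :+ t) refl (g x) (g y) (half t))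
            (trans (+-congʳ (+-congˡ (-‿cong (trans gx (sym (half-sum t))))))
              (solve 2 (λ gy t → gy :- (t :+ t) :+ t := gy :- t) refl (g y) (half t)))))
      -- Positivity at z would spread to z + η, past the supremum, or reach b if b is closer, where
      -- g b ≤ 0.
      gz≤0 : g z ≤ 0#
      gz≤0 = ≮⇒≥ λ gz>0 → let (η , η>0 , e) = radius gz>0 in pos-case gz>0 η η>0 e
        where
        pos-case : 0# < g z → ∀ η → 0# < η → C * η ≈ half (g z) → ⊥
        pos-case gz>0 η η>0 e = [ far , close ]′ (≤-or-> b (z + η))
          where
          far : b ≤ z + η → ⊥
          far b≤ = <⇒≱ (near gz>0 e a≤z z≤b a≤b ≤-refl
            (±-nonneg (gap z≤b) (≤-by (gap b≤) (solve 3 (λ b z e → z :+ e :- b := e :- (b :- z)) refl b z η))) refl) gb≤0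
          z≤ : z ≤ z + η
          z≤ = ≤-by (<⇒≤ η>0) (solve 2 (λ z e → e := z :+ e :- z) refl z η)
          cases : z + η < b → ∀ y → a ≤ y → y ≤ z + η → 0# < g y
          cases <b y a≤y y≤ = [ (λ z≤y → near gz>0 e a≤z z≤b a≤y (≤-trans y≤ (<⇒≤ <b))
            (±-nonneg (gap z≤y) (≤-by (gap y≤) (solve 3 (λ y z e → z :+ e :- y := e :- (y :- z)) refl y z η))) refl) , below a≤y ]′ (≤-or-> z y)
          close : z + η < b → ⊥
          close <b = <⇒≱ η>0 (≤-by (gap (ub {z + η} (≤-trans a≤z z≤ , <⇒≤ <b , cases <b)))
            (solve 2 (λ z e → z :- (z :+ e) := :0 :- e) refl z η))
      -- Some x within η of z has g > 0, but a negative value at z would force g x < 0 there.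
      gz≥0 : 0# ≤ g z
      gz≥0 = ≮⇒≥ λ gz<0 → neg-case gz<0 (radius (gap⁺ gz<0))
        where
        neg-case : g z < 0# → ∃[ η ] (0# < η × C * η ≈ half (0# - g z)) → ⊥
        neg-case gz<0 (η , η>0 , e) = let (x , (a≤x , x≤b , pos) , q) = approx η>0 in
          <⇒≱ (pos x a≤x ≤-refl) (≤-trans
            (≤-by (gap (upper (±-respʳ e (lip a≤z z≤b a≤x x≤b (±-respˡ
                 (solve 2 (λ x z → :- (z :- x) := x :- z) refl x z) (±-neg (±-nonneg (gap (ub (a≤x , x≤b , pos)))
                   (≤-by (gap (<⇒≤ q)) (solve 3 (λ x z e → x :- (z :- e) := e :- (z :- x)) refl x z η)))))))))
              (trans (solve 3 (λ gx gz h → h :- (gx :- gz) := h :+ gz :- gx) refl (g x) (g z) (half (0# - g z)))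
                (+-congʳ (trans (+-congˡ (trans (solve 1 (λ g → g := :0 :- (:0 :- g)) refl (g z)) (+-congˡ (-‿cong (sym (half-sum (0# - g z)))))))
                  (solve 1 (λ h → h :+ (:0 :- (h :+ h)) := :- h) refl (half (0# - g z)))))))
            (≤-by (<⇒≤ (half>0 (gap⁺ gz<0))) (solve 1 (λ h → h := :0 :- (:- h)) refl (half (0# - g z)))))

  -- Square roots

  sq-cancel≤ : ∀ {x y} → 0# ≤ y → x * x ≤ y * y → x ≤ y
  sq-cancel≤ {x} {y} y≥0 h = ≮⇒≥ λ y<x → <⇒≱
    (<-by (gap⁺ y<x ⊠⁺ (gap⁺ y<x ⊞⁺ (y≥0 ⊞ y≥0)))
      (solve 2 (λ x y → (x :- y) :* (x :- y :+ (y :+ y)) := x :* x :- y :* y) refl x y)) h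

  sq-cancel≈ : ∀ {x y} → 0# ≤ x → 0# ≤ y → x * x ≈ y * y → x ≈ y
  sq-cancel≈ p q e = ≤-antisym (sq-cancel≤ q (≤-reflexive e)) (sq-cancel≤ p (≤-reflexive (sym e)))

  sqrt-exists : ∀ {x} → 0# ≤ x → ∃[ s ] (0# ≤ s × s * s ≈ x)
  sqrt-exists {x} x≥0 = [ (λ x≤0 → 0# , ≤-refl , trans (zeroˡ 0#) (≤-antisym x≥0 x≤0)) , positive ]′ (≤-or-> x 0#)
    where
    x+1>0 : 0# < x + 1#
    x+1>0 = +1>0 x≥0
    lip : Lipschitz 0# (x + 1#) (ℕ→ℝ 2 * (x + 1#)) (λ t → x - t * t)
    lip {u} {v} p q r s {δ} h = ±-respˡ (solve 3 (λ x u v → (u :+ v) :* (:- (v :- u)) := (x :- v :* v) :- (x :- u :* u)) refl x u v)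
      (±-* (±-nonneg (p ⊞ r) (≤-by (gap q ⊞ gap s)
         (solve 3 (λ k u v → (k :- u) :+ (k :- v) := :2 :* k :- (u :+ v)) refl (x + 1#) u v)))
       (±-neg h))
    positive : 0# < x → ∃[ s ] (0# ≤ s × s * s ≈ x)
    -- The endpoint x + 1 works for small and large x alike, because (x + 1)² ≥ x; the Lipschitz
    -- constant 2 (x + 1) bounds u + v on [0, x + 1].
    positive x>0 =
      let (z , z≥0 , _ , e , _) = first-zero {0#} {x + 1#} {ℕ→ℝ 2 * (x + 1#)} {λ t → x - t * t}
            (ℕ→ℝ>0 1 ⊠⁺ x+1>0) lip (<⇒≤ x+1>0)
            (<-respʳ (solve 1 (λ x → x := x :- :0 :* :0) refl x) x>0)
            (≤-by (x≥0 ⊠ x≥0 ⊞ x≥0 ⊞ <⇒≤ 0<1)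
              (solve 1 (λ x → x :* x :+ x :+ :1 := :0 :- (x :- (x :+ :1) :* (x :+ :1))) refl x))
      in z , z≥0 , ≈-by e refl

  √-spec : ∀ {x} → 0# ≤ x → 0# ≤ √ x × √ x * √ x ≈ x
  √-spec {x} x≥0 = the-∈ {d = 0#} {λ s → 0# ≤ s × s * s ≈ x} (sqrt-exists x≥0)

  √-unique : ∀ {x s} → 0# ≤ s → s * s ≈ x → √ x ≈ s
  √-unique {x} {s} s≥0 e = let (p , q) = √-spec (≤-respʳ e (sq≥0 s)) in sq-cancel≈ p s≥0 (trans q (sym e))

  -- Differentiation with a uniform quadratic error

  infix 4 _∈[_,_]

  _∈[_,_] : ℝ → ℝ → ℝ → Set
  x ∈[ a , b ] = a ≤ x × x ≤ b

  abs-sq : ∀ x → ∣ x ∣ * ∣ x ∣ ≈ x * x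
  abs-sq x = [ (λ p → cong-sq (≤-antisym (abs-≤ (±-self p)) (upper (±-abs x)))) ,
               (λ p → trans (cong-sq (≤-antisym (abs-≤ (neg p)) (upper (±-neg (±-abs x)))))
                            (solve 1 (λ x → (:- x) :* (:- x) := x :* x) refl x)) ]′ (total 0# x)
    where
    cong-sq : ∀ {u v} → u ≈ v → u * u ≈ v * v
    cong-sq e = *-cong e e
    neg : x ≤ 0# → x ∈± - x
    neg p = ±-respˡ (solve 1 (λ x → :- (:- x) := x) refl x) (±-neg (±-self
      (≤-by (gap p) (solve 1 (λ x → :0 :- x := (:- x) :- :0) refl x))))

  abs-cancel : ∀ {t c h} → 0# ≤ c → ¬ (h ≈ 0#) → t * h ∈± c * (h * h) → t ∈± c * ∣ h ∣
  abs-cancel {t} {c} {h} c≥0 n p =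
    cancel≤ k>0 (≤-by (gap (lower q)) (solve 3 (λ k c t → k :* t :- :- (c :* (k :* k)) := k :* t :- k :* (:- (c :* k))) refl k c t)) ,
    cancel≤ k>0 (≤-by (gap (upper q)) (solve 3 (λ k c t → c :* (k :* k) :- k :* t := k :* (c :* k) :- k :* t) refl k c t))
    where
    k = ∣ h ∣
    k>0 : 0# < k
    k>0 = abs≥0 h , λ e → n (±-zero (±-respʳ (sym e) (±-abs h)))
    q : k * t ∈± c * (k * k)
    q = [ (λ h≥0 → ±-resp (trans (*-comm t h) (*-congʳ (≤-antisym (upper (±-abs h)) (abs-≤ (±-self h≥0)))))
                    (*-congˡ (sym (abs-sq h))) p) ,
          (λ h≤0 → let -h≥0 = ≤-by (gap h≤0) (solve 1 (λ h → :0 :- h := (:- h) :- :0) refl h) in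
            ±-resp (trans (solve 2 (λ t h → :- (t :* h) := (:- h) :* t) refl t h)
                      (*-congʳ (≤-antisym (upper (±-neg (±-abs h)))
                        (abs-≤ (±-respˡ (solve 1 (λ h → :- (:- h) := h) refl h) (±-neg (±-self -h≥0)))))))
                    (*-congˡ (sym (abs-sq h))) (±-neg p)) ]′ (total 0# h)

  -- The field `f-cong` is recorded because a function on the carrier need not respect `_≈_`, and
  -- for x ≈ y the inequality `bound` does not compare f x with f y. For H the congruence follows
  -- from `bound`.
  record Deriv (a b : ℝ) (H f : ℝ → ℝ) : Set where
    field
      C      : ℝ
      C≥0    : 0# ≤ C
      f-cong : ∀ {x y} → x ∈[ a , b ] → y ∈[ a , b ] → x ≈ y → f x ≈ f y
      bound  : ∀ {x y} → x ∈[ a , b ] → y ∈[ a , b ] →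
               H y - H x - f x * (y - x) ∈± C * ((y - x) * (y - x))

    H-cong : ∀ {x y} → x ∈[ a , b ] → y ∈[ a , b ] → x ≈ y → H x ≈ H y
    H-cong {x} {y} p q e = ≈-by (trans (solve 3 (λ u v z → v :- u := v :- u :- z :* :0) refl (H x) (H y) (f x))
        (trans (+-congˡ (-‿cong (*-congˡ (sym (gap₀ e)))))
          (±-zero (±-respʳ (trans (*-congˡ (trans (*-congʳ (gap₀ e)) (zeroˡ _))) (zeroʳ C)) (bound p q))))) refl

    -- Adding the bounds for (x, y) and (y, x) eliminates H and leaves (f y - f x)(y - x) within 2C
    -- (y - x)²; then y - x is cancelled.
    f-Lipschitz : ∀ {x y} → x ∈[ a , b ] → y ∈[ a , b ] → f y - f x ∈± (C + C) * ∣ y - x ∣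
    f-Lipschitz {x} {y} p q = case (decide (x ≈ y))
      where
      case : Dec (x ≈ y) → _
      case (yes e) = ±-respˡ (sym (gap₀ (f-cong p q e))) (±-0 ((C≥0 ⊞ C≥0) ⊠ abs≥0 _))
      case (no n)  = abs-cancel (C≥0 ⊞ C≥0) (λ e → n (≈-by e refl)) (±-resp
        (solve 6 (λ x y u v f g → (v :- u :- f :* (y :- x)) :+ (u :- v :- g :* (x :- y)) := (g :- f) :* (y :- x)) refl
          x y (H x) (H y) (f x) (f y))
        (solve 3 (λ x y c → c :* ((y :- x) :* (y :- x)) :+ c :* ((x :- y) :* (x :- y)) := (c :+ c) :* ((y :- x) :* (y :- x))) refl
          x y C)
        (±-+ (bound p q) (bound q p)))

    width-± : ∀ {x y} → x ∈[ a , b ] → y ∈[ a , b ] → y - x ∈± b - a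
    width-± {x} {y} (p , q) (r , s) =
      ≤-by (gap r ⊞ gap q) (solve 4 (λ a b x y → (y :- a) :+ (b :- x) := (y :- x) :- (:- (b :- a))) refl a b x y) ,
      ≤-by (gap p ⊞ gap s) (solve 4 (λ a b x y → (x :- a) :+ (b :- y) := (b :- a) :- (y :- x)) refl a b x y)

    f-bounded : ∃[ B ] (0# ≤ B × (∀ {x} → x ∈[ a , b ] → f x ∈± B))
    f-bounded = [ (λ a≤b → let B≥0 = abs≥0 (f a) ⊞ (C≥0 ⊞ C≥0) ⊠ gap a≤b in _ , B≥0 , λ {x} p →
                    ±-respˡ (solve 2 (λ u v → u :+ (v :- u) := v) refl (f a) (f x))
                      (±-+ (±-abs (f a)) (±-≤ (*-monoˡ (C≥0 ⊞ C≥0) (abs-≤ (width-± (≤-refl , a≤b) p))) (f-Lipschitz (≤-refl , a≤b) p)))) ,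
                  (λ b<a → 0# , ≤-refl , λ p → ⊥-elim (<⇒≱ b<a (≤-trans (proj₁ p) (proj₂ p)))) ]′ (≤-or-> a b)

    H-Lipschitz : ∃[ L ] (0# ≤ L × (∀ {x y} → x ∈[ a , b ] → y ∈[ a , b ] → ∀ {δ} → y - x ∈± δ → H y - H x ∈± L * δ))
    H-Lipschitz = let (B , B≥0 , fb) = f-bounded in
      [ (λ a≤b → C * (b - a) + B , C≥0 ⊠ gap a≤b ⊞ B≥0 , λ {x} {y} p q {δ} h → ±-resp
          (solve 5 (λ u v x y f → (v :- u :- f :* (y :- x)) :+ f :* (y :- x) := v :- u) refl (H x) (H y) x y (f x))
          (solve 4 (λ c w b d → c :* (w :* d) :+ b :* d := (c :* w :+ b) :* d) refl C (b - a) B δ)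
          (±-+ (±-≤ (*-monoˡ C≥0 (upper (±-* (width-± p q) h))) (bound p q)) (±-* (fb p) h))) ,
        (λ b<a → 0# , ≤-refl , λ p → ⊥-elim (<⇒≱ b<a (≤-trans (proj₁ p) (proj₂ p)))) ]′ (≤-or-> a b)

    H-bounded : ∃[ B ] (0# ≤ B × (∀ {x} → x ∈[ a , b ] → H x ∈± B))
    H-bounded = let (L , L≥0 , hl) = H-Lipschitz in
      [ (λ a≤b → ∣ H a ∣ + L * (b - a) , abs≥0 _ ⊞ L≥0 ⊠ gap a≤b , λ {x} p →
          ±-respˡ (solve 2 (λ u v → u :+ (v :- u) := v) refl (H a) (H x))
            (±-+ (±-abs _) (hl (≤-refl , a≤b) p (width-± (≤-refl , a≤b) p)))) ,
        (λ b<a → 0# , ≤-refl , λ p → ⊥-elim (<⇒≱ b<a (≤-trans (proj₁ p) (proj₂ p)))) ]′ (≤-or-> a b)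

  Deriv-cong : ∀ {a b H H′ f f′} → (∀ {x} → x ∈[ a , b ] → H x ≈ H′ x) → (∀ {x} → x ∈[ a , b ] → f x ≈ f′ x) →
               Deriv a b H f → Deriv a b H′ f′
  Deriv-cong e e′ d = record
    { C = C ; C≥0 = C≥0
    ; f-cong = λ p q r → trans (sym (e′ p)) (trans (f-cong p q r) (e′ q))
    ; bound = λ p q → ±-respˡ (+-cong (+-cong (e q) (-‿cong (e p))) (-‿cong (*-congʳ (e′ p)))) (bound p q) }
    where open Deriv d

  Deriv-const : ∀ {a b} c → Deriv a b (λ _ → c) (λ _ → 0#)
  Deriv-const c = record
    { C = 0# ; C≥0 = ≤-refl ; f-cong = λ _ _ _ → refl
    ; bound = λ {x} {y} _ _ → ±-resp (solve 3 (λ x y c → :0 := c :- c :- :0 :* (y :- x)) refl x y c)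
        (sym (zeroˡ _)) (±-0 ≤-refl) }

  Deriv-id : ∀ {a b} → Deriv a b (λ x → x) (λ _ → 1#)
  Deriv-id = record
    { C = 0# ; C≥0 = ≤-refl ; f-cong = λ _ _ _ → refl
    ; bound = λ {x} {y} _ _ → ±-resp (solve 2 (λ x y → :0 := y :- x :- :1 :* (y :- x)) refl x y)
        (sym (zeroˡ _)) (±-0 ≤-refl) }

  Deriv-+ : ∀ {a b H f G g} → Deriv a b H f → Deriv a b G g → Deriv a b (λ x → H x + G x) (λ x → f x + g x)
  Deriv-+ {H = H} {f} {G} {g} d e = record
    { C = D.C + E.C ; C≥0 = D.C≥0 ⊞ E.C≥0
    ; f-cong = λ p q r → +-cong (D.f-cong p q r) (E.f-cong p q r)
    ; bound = λ {x} {y} p q → ±-resp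
        (solve 7 (λ h′ h g′ g f k w → (h′ :- h :- f :* w) :+ (g′ :- g :- k :* w) := (h′ :+ g′) :- (h :+ g) :- (f :+ k) :* w) refl
          (H y) (H x) (G y) (G x) (f x) (g x) (y - x))
        (sym (distribʳ _ _ _)) (±-+ (D.bound p q) (E.bound p q)) }
    where
    module D = Deriv d
    module E = Deriv e

  -- The error splits into the error of H times G y, the cross term f x (y - x)(G y - G x), which is
  -- quadratic because G is Lipschitz, and H x times the error of G. These give the three summands
  -- of `C`.
  Deriv-* : ∀ {a b H f G g} → Deriv a b H f → Deriv a b G g →
            Deriv a b (λ x → H x * G x) (λ x → f x * G x + H x * g x)
  Deriv-* {a} {b} {H} {f} {G} {g} d e =
    let (Bf , Bf≥0 , fb) = D.f-bounded
        (BH , BH≥0 , Hb) = D.H-bounded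
        (BG , BG≥0 , Gb) = E.H-bounded
        (L , L≥0 , lip)  = E.H-Lipschitz
    in record
    { C = D.C * BG + Bf * L + BH * E.C ; C≥0 = D.C≥0 ⊠ BG≥0 ⊞ Bf≥0 ⊠ L≥0 ⊞ BH≥0 ⊠ E.C≥0
    ; f-cong = λ p q r → +-cong (*-cong (D.f-cong p q r) (E.H-cong p q r)) (*-cong (D.H-cong p q r) (E.f-cong p q r))
    ; bound = λ {x} {y} p q → ±-resp
        (solve 7 (λ h′ h g′ g f k w → (h′ :- h :- f :* w) :* g′ :+ (f :* w) :* (g′ :- g) :+ h :* (g′ :- g :- k :* w)
                                        := h′ :* g′ :- h :* g :- (f :* g :+ h :* k) :* w) refl
          (H y) (H x) (G y) (G x) (f x) (g x) (y - x))
        (trans (+-congʳ (+-congˡ (trans (solve 3 (λ b l w → b :* w :* (l :* w) := b :* l :* (w :* w)) refl Bf L ∣ y - x ∣)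
                                   (*-congˡ (abs-sq _)))))
          (solve 7 (λ c k b l m n w → c :* w :* b :+ k :* l :* w :+ m :* (n :* w) := (c :* b :+ k :* l :+ m :* n) :* w) refl
            D.C Bf BG L BH E.C ((y - x) * (y - x))))
        (±-+ (±-+ (±-* (D.bound p q) (Gb q)) (±-* (±-* (fb p) (±-abs _)) (lip p q (±-abs _)))) (±-* (Hb p) (E.bound p q))) }
    where
    module D = Deriv d
    module E = Deriv e

  Deriv-scale : ∀ {a b H f} c → Deriv a b H f → Deriv a b (λ x → c * H x) (λ x → c * f x)
  Deriv-scale {H = H} {f} c d = Deriv-cong (λ _ → refl)
    (λ {x} _ → trans (+-congʳ (zeroˡ _)) (+-identityˡ _)) (Deriv-* (Deriv-const c) d)

  Deriv-neg : ∀ {a b H f} → Deriv a b H f → Deriv a b (λ x → - H x) (λ x → - f x)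
  Deriv-neg {H = H} {f} d = Deriv-cong
    (λ {x} _ → solve 1 (λ x → (:- :1) :* x := :- x) refl (H x))
    (λ {x} _ → solve 1 (λ x → (:- :1) :* x := :- x) refl (f x)) (Deriv-scale (- 1#) d)

  Deriv-∘ : ∀ {a b c d K k H f} → (∀ {x} → x ∈[ a , b ] → H x ∈[ c , d ]) → Deriv c d K k → Deriv a b H f →
            Deriv a b (λ x → K (H x)) (λ x → k (H x) * f x)
  Deriv-∘ {K = K} {k} {H} {f} maps d e =
    let (Bk , Bk≥0 , kb) = D.f-bounded
        (L , L≥0 , lip)  = E.H-Lipschitz
    in record
    { C = D.C * (L * L) + Bk * E.C ; C≥0 = D.C≥0 ⊠ (L≥0 ⊠ L≥0) ⊞ Bk≥0 ⊠ E.C≥0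
    ; f-cong = λ p q r → *-cong (D.f-cong (maps p) (maps q) (E.H-cong p q r)) (E.f-cong p q r)
    ; bound = λ {x} {y} p q → ±-resp
        (solve 7 (λ k′ k h′ h m f w → (k′ :- k :- m :* (h′ :- h)) :+ m :* (h′ :- h :- f :* w)
                                        := k′ :- k :- (m :* f) :* w) refl
          (K (H y)) (K (H x)) (H y) (H x) (k (H x)) (f x) (y - x))
        (trans (+-congʳ (*-congˡ (trans (solve 2 (λ l w → l :* w :* (l :* w) := l :* l :* (w :* w)) refl L ∣ y - x ∣)
                                   (*-congˡ (abs-sq _)))))
          (solve 5 (λ c l k m w → c :* (l :* w) :+ k :* (m :* w) := (c :* l :+ k :* m) :* w) refl
            D.C (L * L) Bk E.C ((y - x) * (y - x))))
        (±-+ (±-≤ (*-monoˡ D.C≥0 (upper (let q′ = lip p q (±-abs _) in ±-* q′ q′))) (D.bound (maps p) (maps q)))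
             (±-* (kb (maps p)) (E.bound p q))) }
    where
    module D = Deriv d
    module E = Deriv e

  Deriv-sub : ∀ {a b c d H f} → a ≤ c → d ≤ b → Deriv a b H f → Deriv c d H f
  Deriv-sub p q d = record
    { C = C ; C≥0 = C≥0 ; f-cong = λ r s → f-cong (inside r) (inside s) ; bound = λ r s → bound (inside r) (inside s) }
    where
    open Deriv d
    inside : ∀ {x} → _ → x ∈[ _ , _ ]
    inside (r , s) = ≤-trans p r , ≤-trans s q

  -- Riemann integrals of derivatives

  module _ {a b : ℝ} {H f : ℝ → ℝ} (d : Deriv a b H f) where
    open Deriv d

    -- Both endpoints are expanded about the tag t. As t lies between them, (t - u)² + (v - t)² ≤ (v
    -- - u)², so the tag costs nothing in the constant.
    step-error : ∀ {u t v} → u ∈[ a , b ] → v ∈[ a , b ] → u ≤ t → t ≤ v →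
                 f t * (v - u) - (H v - H u) ∈± C * ((v - u) * (v - u))
    step-error {u} {t} {v} u∈ v∈ u≤t t≤v = ±-≤ square≤ (±-respˡ
      (solve 7 (λ u t v hu ht hv f → (hu :- ht :- f :* (u :- t)) :- (hv :- ht :- f :* (v :- t)) := f :* (v :- u) :- (hv :- hu)) refl
        u t v (H u) (H t) (H v) (f t))
      (±-- (bound t∈ u∈) (bound t∈ v∈)))
      where
      t∈ : t ∈[ a , b ]
      t∈ = ≤-trans (proj₁ u∈) u≤t , ≤-trans t≤v (proj₂ v∈)
      square≤ : C * ((u - t) * (u - t)) + C * ((v - t) * (v - t)) ≤ C * ((v - u) * (v - u))
      square≤ = ≤-by (ℕ→ℝ≥0 2 ⊠ (C≥0 ⊠ (gap u≤t ⊠ gap t≤v))) (solve 4 (λ c u t v →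
        :2 :* (c :* ((t :- u) :* (v :- t))) := c :* ((v :- u) :* (v :- u)) :- (c :* ((u :- t) :* (u :- t)) :+ c :* ((v :- t) :* (v :- t)))) refl C u t v)

    sum-error : ∀ {δ} n (p : Fin (suc n) → ℝ) (t : Fin n → ℝ) → (∀ i → p i ∈[ a , b ]) →
                (∀ i → p (inject₁ i) ≤ t i) → (∀ i → t i ≤ p (Fin.suc i)) → (∀ i → p (Fin.suc i) - p (inject₁ i) ≤ δ) →
                sum (λ i → f (t i) * (p (Fin.suc i) - p (inject₁ i))) - (H (p (fromℕ n)) - H (p Fin.zero))
                  ∈± C * (δ * (p (fromℕ n) - p Fin.zero))
    sum-error {δ} zero p t p∈ lo hi w = ±-resp
      (solve 1 (λ h → :0 := :0 :- (h :- h)) refl (H (p Fin.zero)))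
      (solve 3 (λ c d p → :0 := c :* (d :* (p :- p))) refl C δ (p Fin.zero)) (±-0 ≤-refl)
    sum-error {δ} (suc n) p t p∈ lo hi w = ±-resp
      (solve 5 (λ x y h₀ h₁ h₂ → (x :- (h₁ :- h₀)) :+ (y :- (h₂ :- h₁)) := x :+ y :- (h₂ :- h₀)) refl
        (f (t Fin.zero) * (p₁ - p₀)) (sum λ i → f (t (Fin.suc i)) * (p (Fin.suc (Fin.suc i)) - p (Fin.suc (inject₁ i))))
        (H p₀) (H p₁) (H p₂))
      (solve 5 (λ c d p₀ p₁ p₂ → c :* (d :* (p₁ :- p₀)) :+ c :* (d :* (p₂ :- p₁)) := c :* (d :* (p₂ :- p₀))) refl C δ p₀ p₁ p₂)
      (±-+ (±-≤ (*-monoˡ C≥0 (*-monoʳ (gap (≤-trans (lo Fin.zero) (hi Fin.zero))) (w Fin.zero)))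
              (step-error (p∈ Fin.zero) (p∈ (Fin.suc Fin.zero)) (lo Fin.zero) (hi Fin.zero)))
           (sum-error n (λ i → p (Fin.suc i)) (λ i → t (Fin.suc i)) (λ i → p∈ (Fin.suc i))
              (λ i → lo (Fin.suc i)) (λ i → hi (Fin.suc i)) (λ i → w (Fin.suc i))))
      where
      p₀ = p Fin.zero
      p₁ = p (Fin.suc Fin.zero)
      p₂ = p (fromℕ (suc n))

  steps-above : ∀ n (p : Fin (suc n) → ℝ) → (∀ i → p (inject₁ i) ≤ p (Fin.suc i)) → ∀ i → p Fin.zero ≤ p i
  steps-above n       p h Fin.zero    = ≤-refl
  steps-above (suc n) p h (Fin.suc i) =
    ≤-trans (h Fin.zero) (steps-above n (λ j → p (Fin.suc j)) (λ j → h (Fin.suc j)) i)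

  steps-below : ∀ n (p : Fin (suc n) → ℝ) → (∀ i → p (inject₁ i) ≤ p (Fin.suc i)) → ∀ i → p i ≤ p (fromℕ n)
  steps-below zero    p h Fin.zero    = ≤-refl
  steps-below (suc n) p h Fin.zero    =
    ≤-trans (h Fin.zero) (steps-below n (λ j → p (Fin.suc j)) (λ j → h (Fin.suc j)) Fin.zero)
  steps-below (suc n) p h (Fin.suc i) = steps-below n (λ j → p (Fin.suc j)) (λ j → h (Fin.suc j)) i

  riemann-error : ∀ {a b H f} (d : Deriv a b H f) → a ≤ b → ∀ {n} (p : TaggedPartition a b n) → let open TaggedPartition p in
                  ∀ {δ} → (∀ i → width i ≤ δ) → riemannSum f - (H b - H a) ∈± Deriv.C d * (δ * (b - a))
  riemann-error {a} {b} {H} {f} d a≤b {n} p {δ} w = ±-resp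
    (+-congˡ (-‿cong (+-cong (H-cong (inside _) (a≤b , ≤-refl) last) (-‿cong (H-cong (inside _) (≤-refl , a≤b) first)))))
    (*-congˡ (*-congˡ (+-cong last (-‿cong first))))
    (sum-error d n point tag inside tag-low tag-high w)
    where
    open TaggedPartition p
    open Deriv d
    steps : ∀ i → point (inject₁ i) ≤ point (Fin.suc i)
    steps i = ≤-trans (tag-low i) (tag-high i)
    inside : ∀ i → point i ∈[ a , b ]
    inside i = ≤-respˡ first (steps-above n point steps i) , ≤-respʳ last (steps-below n point steps i)

  fine-partition : ∀ {a b δ} → a ≤ b → 0# < δ →
                   ∃[ n ] (∃ λ (p : TaggedPartition a b n) → ∀ i → TaggedPartition.width p i < δ)
  fine-partition {a} {b} {δ} a≤b δ>0 = suc m , p , width<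
    where
    -- With m ≥ (b - a) / δ, taking m + 1 parts instead of m makes the width strictly smaller than
    -- δ.
    large = archimedean ((b - a) / δ)
    m = proj₁ large
    N = ℕ→ℝ (suc m)
    s = (b - a) / N
    N>0 : 0# < N
    N>0 = ℕ→ℝ>0 m
    Ns : s * N ≈ b - a
    Ns = /-cancel (>⇒≉ N>0)
    s≥0 : 0# ≤ s
    s≥0 = gap a≤b ⊠ <⇒≤ (inv>0 N>0)
    s<δ : s < δ
    s<δ = ≰⇒> λ δ≤s → <⇒≱ (<-by (δ>0 ⊞⁺ (<⇒≤ δ>0 ⊠ gap (proj₂ large) ⊞ gap δ≤s ⊠ <⇒≤ N>0))
      (trans (solve 4 (λ d q s m → d :+ (d :* (m :- q) :+ (s :- d) :* (:1 :+ m)) := s :* (:1 :+ m) :- q :* d) refl δ ((b - a) / δ) s (ℕ→ℝ m))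
        (+-cong Ns (-‿cong (/-cancel (>⇒≉ δ>0)))))) ≤-refl
    point : Fin (suc (suc m)) → ℝ
    point i = a + ℕ→ℝ (toℕ i) * s
    step : ∀ i → point (Fin.suc i) - point (inject₁ i) ≈ s
    step i = trans (+-congˡ (-‿cong (+-congˡ (*-congʳ (≡→≈ (≡.cong ℕ→ℝ (Finₚ.toℕ-inject₁ i)))))))
      (solve 3 (λ a k s → a :+ (:1 :+ k) :* s :- (a :+ k :* s) := s) refl a (ℕ→ℝ (toℕ i)) s)
    p : TaggedPartition a b (suc m)
    p = record
      { point = point ; tag = λ i → point (inject₁ i)
      ; first = solve 2 (λ a s → a :+ :0 :* s := a) refl a s
      ; last = trans (+-congˡ (trans (*-congʳ (≡→≈ (≡.cong ℕ→ℝ (Finₚ.toℕ-fromℕ (suc m))))) (trans (*-comm N s) Ns)))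
                 (solve 2 (λ a b → a :+ (b :- a) := b) refl a b)
      ; tag-low = λ _ → ≤-refl
      ; tag-high = λ i → ≤-by s≥0 (sym (step i)) }
    width< : ∀ i → TaggedPartition.width p i < δ
    width< i = <-respˡ (sym (step i)) s<δ

  -- `riemann-error` shows that H b - H a satisfies the defining condition of the integral. The
  -- value picked by `∫` then equals it, because both are close to the Riemann sum of one common
  -- fine partition.
  ∫-Deriv : ∀ {a b H f} → a ≤ b → Deriv a b H f → ∫ a b f ≈ H b - H a
  ∫-Deriv {a} {b} {H} {f} a≤b d = ≈-by {t = H b - H a - ∫ a b f} (zero-by-small close) refl
    where
    open Deriv d
    IsIntegral : Pred ℝ 0ℓ
    IsIntegral I = ∀ ε → 0# < ε → ∃[ δ ] (0# < δ ×
      (∀ {n} (p : TaggedPartition a b n) → let open TaggedPartition p in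
         (∀ i → width i < δ) → ∣ riemannSum f - I ∣ < ε))
    -- The summand 1 keeps the divisor positive and turns the error estimate for mesh ε / k into a
    -- strict one.
    k = C * (b - a) + 1#
    k>0 : 0# < k
    k>0 = +1>0 (C≥0 ⊠ gap a≤b)
    integral : IsIntegral (H b - H a)
    integral ε ε>0 = ε / k , δ>0 , λ p w → abs-< (riemann-error d a≤b p λ i → <⇒≤ (w i))
      (<-by δ>0 (trans (solve 4 (λ c w d e → d := (d :* (c :* w :+ :1)) :- (c :* (d :* w))) refl C (b - a) (ε / k) ε)
        (+-congʳ (/-cancel (>⇒≉ k>0)))))
      where
      δ>0 : 0# < ε / k
      δ>0 = ε>0 ⊠⁺ inv>0 k>0
    spec : IsIntegral (∫ a b f)
    spec = the-∈ {d = 0#} {IsIntegral} (H b - H a , integral)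
    min : ∀ {x y} → 0# < x → 0# < y → ∃[ z ] (0# < z × z ≤ x × z ≤ y)
    min {x} {y} x>0 y>0 = [ (λ x≤y → x , x>0 , ≤-refl , x≤y) , (λ y≤x → y , y>0 , y≤x , ≤-refl) ]′ (total x y)
    close : ∀ ε → 0# < ε → H b - H a - ∫ a b f ∈± ε
    close ε ε>0 =
      let (δ₁ , δ₁>0 , h₁) = spec (half ε) (half>0 ε>0)
          (δ₂ , δ₂>0 , h₂) = integral (half ε) (half>0 ε>0)
          (δ , δ>0 , δ≤δ₁ , δ≤δ₂) = min δ₁>0 δ₂>0
          (n , p , w) = fine-partition a≤b δ>0
      in ±-resp (solve 3 (λ s i j → s :- i :- (s :- j) := j :- i) refl (TaggedPartition.riemannSum p f) (∫ a b f) (H b - H a)) (half-sum ε)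
           (±-- (±-abs< (h₁ p λ i → <-≤-trans (w i) δ≤δ₁)) (±-abs< (h₂ p λ i → <-≤-trans (w i) δ≤δ₂)))

  -- Riemann sums of 0 vanish, so `riemann-error` bounds H b - H a by C δ (b - a) for every mesh δ.
  -- This takes the place of the mean value theorem.
  Deriv-zero : ∀ {a b H} → a ≤ b → Deriv a b H (λ _ → 0#) → H a ≈ H b
  Deriv-zero {a} {b} {H} a≤b d = ≈-by {t = H b - H a} (zero-by-small small) refl
    where
    open Deriv d
    k = C * (b - a) + 1#
    k>0 : 0# < k
    k>0 = +1>0 (C≥0 ⊠ gap a≤b)
    sum-zero : ∀ n (w : Fin n → ℝ) → sum (λ i → 0# * w i) ≈ 0#
    sum-zero zero    w = refl
    sum-zero (suc n) w = trans (+-cong (zeroˡ _) (sum-zero n (λ i → w (Fin.suc i)))) (+-identityˡ 0#)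
    small : ∀ ε → 0# < ε → H b - H a ∈± ε
    small ε ε>0 =
      let (n , p , w) = fine-partition a≤b (ε>0 ⊠⁺ inv>0 k>0)
      in ±-≤ (≤-by (<⇒≤ (ε>0 ⊠⁺ inv>0 k>0))
               (trans (solve 4 (λ c w d e → d := (d :* (c :* w :+ :1)) :- (c :* (d :* w))) refl C (b - a) (ε / k) ε)
                 (+-congʳ (/-cancel (>⇒≉ k>0)))))
           (±-respˡ (trans (-‿cong (+-congʳ (sum-zero n (TaggedPartition.width p))))
                      (solve 1 (λ h → :- (:0 :- h) := h) refl (H b - H a)))
             (±-neg (riemann-error d a≤b p λ i → <⇒≤ (w i))))

  -- The logarithm on [1, ∞)

  inv-anti : ∀ {x y} → 0# < x → x ≤ y → y ⁻¹ ≤ x ⁻¹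
  inv-anti {x} {y} x>0 x≤y = ≤-by (gap x≤y ⊠ (<⇒≤ (inv>0 x>0) ⊠ <⇒≤ (inv>0 y>0)))
    (trans (solve 4 (λ x y u v → (y :- x) :* (u :* v) := u :* (y :* v) :- v :* (x :* u)) refl x y (x ⁻¹) (y ⁻¹))
      (+-cong (trans (*-congˡ (inv-right (>⇒≉ y>0))) (*-identityʳ _)) (-‿cong (trans (*-congˡ (inv-right (>⇒≉ x>0))) (*-identityʳ _)))))
    where
    y>0 : 0# < y
    y>0 = <-≤-trans x>0 x≤y

  ≥1⇒>0 : ∀ {x} → 1# ≤ x → 0# < x
  ≥1⇒>0 = <-≤-trans 0<1

  1⁻¹≈1 : 1# ⁻¹ ≈ 1#
  1⁻¹≈1 = sym (inv-unique (*-identityˡ 1#))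

  inv≤1 : ∀ {x} → 1# ≤ x → x ⁻¹ ≤ 1#
  inv≤1 p = ≤-respʳ 1⁻¹≈1 (inv-anti 0<1 p)

  -- Lower Darboux sums of 1/y on [1, x]; the logarithm is their supremum.
  data LowerSum : ℝ → ℝ → Set where
    start : ∀ {x} → x ≈ 1# → LowerSum x 0#
    extend : ∀ {x y s} → LowerSum x s → x ≤ y → LowerSum y (s + (y - x) / y)

  LowerSum-≥1 : ∀ {x s} → LowerSum x s → 1# ≤ x
  LowerSum-≥1 (start e)   = ≤-reflexive (sym e)
  LowerSum-≥1 (extend l p) = ≤-trans (LowerSum-≥1 l) p

  -- On [1, ∞) the rectangles have height at most 1, which makes the sums bounded and their supremum
  -- available. Every logarithm used below has an argument of at least 1.
  LowerSum-≤ : ∀ {x s} → LowerSum x s → s ≤ x - 1#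
  LowerSum-≤ (start e) = ≤-reflexive (sym (gap₀ (sym e)))
  LowerSum-≤ (extend {x} {y} {s} l p) = ≤-by (gap (LowerSum-≤ l) ⊞ gap p ⊠ gap (inv≤1 (≤-trans (LowerSum-≥1 l) p)))
    (solve 4 (λ x y s i → (x :- :1 :- s) :+ (y :- x) :* (:1 :- i) := y :- :1 :- (s :+ (y :- x) :* i)) refl x y s (y ⁻¹))

  -- Cut the sum at u. Beyond u all heights are at most 1/u, so that part is covered by a single
  -- rectangle; this yields the upper estimate `log-upper`.
  LowerSum-split : ∀ {v s} → LowerSum v s → ∀ {u} → 1# ≤ u → u ≤ v → ∃[ s′ ] (LowerSum u s′ × s ≤ s′ + (v - u) / u)
  LowerSum-split (start {v} e) {u} 1≤u u≤v = 0# , start (≤-antisym (≤-respʳ e u≤v) 1≤u) ,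
    ≤-respʳ (sym (+-identityˡ _)) (gap u≤v ⊠ <⇒≤ (inv>0 (≥1⇒>0 1≤u)))
  LowerSum-split (extend {x} {y} {s} l x≤y) {u} 1≤u u≤y = [ before , after ]′ (≤-or-> u x)
    where
    i≤ : y ⁻¹ ≤ u ⁻¹
    i≤ = inv-anti (≥1⇒>0 1≤u) u≤y
    before : u ≤ x → _
    before u≤x = let (s′ , l′ , q) = LowerSum-split l 1≤u u≤x in s′ , l′ ,
      ≤-by (gap q ⊞ gap x≤y ⊠ gap i≤)
        (solve 7 (λ x y u s s′ i j → (s′ :+ (x :- u) :* i :- s) :+ (y :- x) :* (i :- j)
                                       := s′ :+ (y :- u) :* i :- (s :+ (y :- x) :* j)) refl x y u s s′ (u ⁻¹) (y ⁻¹))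
    after : x < u → _
    after x<u = _ , extend l (<⇒≤ x<u) ,
      ≤-by (gap x≤y ⊠ gap i≤)
        (solve 6 (λ x y u s i j → (y :- x) :* (i :- j)
                                       := s :+ (u :- x) :* i :+ (y :- u) :* i :- (s :+ (y :- x) :* j)) refl x y u s (u ⁻¹) (y ⁻¹))

  IsLogarithm : ℝ → Pred ℝ 0ℓ
  IsLogarithm x l = (∀ {s} → LowerSum x s → s ≤ l) × (∀ {u} → (∀ {s} → LowerSum x s → s ≤ u) → l ≤ u)

  opaque
    log : ℝ → ℝ
    log x = the 0# (IsLogarithm x)

    log-spec : ∀ {x} → 1# ≤ x → IsLogarithm x (log x)
    log-spec {x} 1≤x = the-∈ {d = 0#} {IsLogarithm x}
      (let (s , ub , least) = supremum (LowerSum x) (_ , extend (start refl) 1≤x) (x - 1# , LowerSum-≤) in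
        s , (λ {t} → ub {t}) , λ {u} → least {u})

  log-lower : ∀ {u v} → 1# ≤ u → u ≤ v → (v - u) / v ≤ log v - log u
  log-lower {u} {v} 1≤u u≤v =
    ≤-by (gap (proj₂ (log-spec 1≤u) {log v - (v - u) / v} λ {s} l →
      ≤-by (gap (proj₁ (log-spec (≤-trans 1≤u u≤v)) (extend l u≤v)))
        (solve 3 (λ s d v → v :- (s :+ d) := v :- d :- s) refl s ((v - u) / v) (log v))))
      (solve 3 (λ d u v → v :- d :- u := v :- u :- d) refl ((v - u) / v) (log u) (log v))

  log-upper : ∀ {u v} → 1# ≤ u → u ≤ v → log v - log u ≤ (v - u) / u
  log-upper {u} {v} 1≤u u≤v =
    ≤-by (gap (proj₂ (log-spec (≤-trans 1≤u u≤v)) {log u + (v - u) / u} λ l →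
      let (s′ , l′ , q) = LowerSum-split l 1≤u u≤v in ≤-trans q (+-mono-≤ _ (proj₁ (log-spec 1≤u) l′))))
      (solve 3 (λ d u v → u :+ d :- v := d :- (v :- u)) refl ((v - u) / u) (log u) (log v))

  Deriv-log : ∀ {b} → Deriv 1# b log (1# /_)
  Deriv-log {b} = record
    { C = 1# ; C≥0 = <⇒≤ 0<1
    ; f-cong = λ p _ e → *-congˡ (inv-cong (>⇒≉ (≥1⇒>0 (proj₁ p))) e)
    ; bound = λ {x} {y} p q → [ up (proj₁ p) , down (proj₁ q) ]′ (total x y) }
    where
    -- Both orders of the endpoints reduce to (y - x)(1/x - 1/y) ≤ (y - x)².
    slack : ∀ {x y} → 1# ≤ x → x ≤ y → (y - x) * (x ⁻¹ - y ⁻¹) ≤ (y - x) * (y - x)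
    slack {x} {y} 1≤x x≤y = ≤-by (gap x≤y ⊠ (gap x≤y ⊠ gap uv≤1))
      (trans (solve 4 (λ x y u v → (y :- x) :* ((y :- x) :* (:1 :- u :* v))
                          := (y :- x) :* (y :- x) :- (y :- x) :* (u :* (y :* v) :- v :* (x :* u))) refl x y (x ⁻¹) (y ⁻¹))
        (+-congˡ (-‿cong (*-congˡ (+-cong (trans (*-congˡ (inv-right (>⇒≉ y>0))) (*-identityʳ _))
                                     (-‿cong (trans (*-congˡ (inv-right (>⇒≉ x>0))) (*-identityʳ _))))))))
      where
      x>0 = ≥1⇒>0 1≤x
      y>0 = ≥1⇒>0 (≤-trans 1≤x x≤y)
      uv≤1 : x ⁻¹ * y ⁻¹ ≤ 1#
      uv≤1 = ≤-respʳ (*-identityˡ 1#) (*-mono (<⇒≤ (inv>0 x>0)) (<⇒≤ (inv>0 y>0)) (inv≤1 1≤x) (inv≤1 (≤-trans 1≤x x≤y)))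
    up : ∀ {x y} → 1# ≤ x → x ≤ y → log y - log x - 1# / x * (y - x) ∈± 1# * ((y - x) * (y - x))
    up {x} {y} 1≤x x≤y =
      ≤-by (gap (slack 1≤x x≤y) ⊞ gap (log-lower 1≤x x≤y))
        (solve 6 (λ x y i j lx ly → ((y :- x) :* (y :- x) :- (y :- x) :* (i :- j)) :+ (ly :- lx :- (y :- x) :* j)
                   := ly :- lx :- :1 :* i :* (y :- x) :- (:- (:1 :* ((y :- x) :* (y :- x))))) refl x y (x ⁻¹) (y ⁻¹) (log x) (log y)) ,
      ≤-by (gap (log-upper 1≤x x≤y) ⊞ sq≥0 (y - x))
        (solve 5 (λ x y i lx ly → ((y :- x) :* i :- (ly :- lx)) :+ (y :- x) :* (y :- x)
                   := :1 :* ((y :- x) :* (y :- x)) :- (ly :- lx :- :1 :* i :* (y :- x))) refl x y (x ⁻¹) (log x) (log y))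
    down : ∀ {x y} → 1# ≤ y → y ≤ x → log y - log x - 1# / x * (y - x) ∈± 1# * ((y - x) * (y - x))
    down {x} {y} 1≤y y≤x =
      ≤-by (gap (slack 1≤y y≤x) ⊞ gap (log-upper 1≤y y≤x))
        (solve 6 (λ x y i j lx ly → ((x :- y) :* (x :- y) :- (x :- y) :* (j :- i)) :+ ((x :- y) :* j :- (lx :- ly))
                   := ly :- lx :- :1 :* i :* (y :- x) :- (:- (:1 :* ((y :- x) :* (y :- x))))) refl x y (x ⁻¹) (y ⁻¹) (log x) (log y)) ,
      ≤-by (gap (log-lower 1≤y y≤x) ⊞ sq≥0 (y - x))
        (solve 5 (λ x y i lx ly → ((lx :- ly) :- (x :- y) :* i) :+ (y :- x) :* (y :- x)
                   := :1 :* ((y :- x) :* (y :- x)) :- (ly :- lx :- :1 :* i :* (y :- x))) refl x y (x ⁻¹) (log x) (log y))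

  -- Exponential-type power series

  cancel-± : ∀ {k x y} → 0# < k → k * x ∈± k * y → x ∈± y
  cancel-± {k} {x} {y} k>0 p =
    cancel≤ k>0 (≤-respˡ (solve 2 (λ k y → :- (k :* y) := k :* (:- y)) refl k y) (lower p)) , cancel≤ k>0 (upper p)

  monomial : ℝ → ℕ → ℝ
  monomial x k = x ^ k / ℕ→ℝ (k !)

  -- The derivative of x^k / k! is the previous monomial; `monomial″` is the second derivative,
  -- shifted once more.
  monomial′ : ℝ → ℕ → ℝ
  monomial′ x zero    = 0#
  monomial′ x (suc k) = monomial x k

  monomial″ : ℝ → ℕ → ℝ
  monomial″ x zero    = 0#
  monomial″ x (suc k) = monomial′ x k

  !>0 : ∀ k → 0# < ℕ→ℝ (k !)
  !>0 k = <-≤-trans (ℕ→ℝ>0 0) (ℕ→ℝ-mono (ℕₚ.1≤n! k))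

  monomial-suc : ∀ x k → ℕ→ℝ (suc k) * monomial x (suc k) ≈ x * monomial x k
  monomial-suc x k = cancel≈ (>⇒≉ (!>0 k)) (trans
    (solve 3 (λ f n m → f :* (n :* m) := m :* (n :* f)) refl (ℕ→ℝ (k !)) (ℕ→ℝ (suc k)) (monomial x (suc k)))
    (trans (*-congˡ (sym (ℕ→ℝ-* (suc k) (k !)))) (trans (/-cancel (>⇒≉ (!>0 (suc k))))
      (trans (*-congˡ (sym (/-cancel (>⇒≉ (!>0 k)))))
        (solve 3 (λ x m f → x :* (m :* f) := f :* (x :* m)) refl x (monomial x k) (ℕ→ℝ (k !)))))))

  monomial-scale : ∀ x k → ℕ→ℝ k * monomial x k ≈ x * monomial′ x k
  monomial-scale x zero    = trans (zeroˡ _) (sym (zeroʳ x))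
  monomial-scale x (suc k) = monomial-suc x k

  monomial-± : ∀ {x M} → x ∈± M → ∀ k → monomial x k ∈± monomial M k
  monomial-± p zero = ±-self (<⇒≤ 0<1 ⊠ <⇒≤ (inv>0 (ℕ→ℝ>0 0)))
  monomial-± {x} {M} p (suc k) = cancel-± (ℕ→ℝ>0 k)
    (±-resp (sym (monomial-suc x k)) (sym (monomial-suc M k)) (±-* p (monomial-± p k)))

  monomial′-± : ∀ {x M} → x ∈± M → ∀ k → monomial′ x k ∈± monomial′ M k
  monomial′-± p zero    = ±-0 ≤-refl
  monomial′-± p (suc k) = monomial-± p k

  monomial≥0 : ∀ {M} → 0# ≤ M → ∀ k → 0# ≤ monomial M k
  monomial≥0 p k = ±-≥0 (monomial-± (±-self p) k)

  Taylor : ℝ → ℝ → ℕ → ℝ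
  Taylor x y k = monomial y k - monomial x k - monomial′ x k * (y - x)

  -- The inductive step for the Taylor bound: the k-th remainder is at most M^(k-2)/(k-2)! times (y - x)².
  monomial″-growth : ∀ {M} → 0# ≤ M → ∀ k →
                     M * monomial″ M k + monomial′ M k ≤ ℕ→ℝ (suc k) * monomial″ M (suc k)
  monomial″-growth {M} p zero = ≤-reflexive (solve 1 (λ m → m :* :0 :+ :0 := (:1 :+ :0) :* :0) refl M)
  monomial″-growth {M} p (suc zero) = ≤-by (monomial≥0 p 0)
    (solve 2 (λ m e → e := (:1 :+ (:1 :+ :0)) :* e :- (m :* :0 :+ e)) refl M (monomial M 0))
  monomial″-growth {M} p (suc (suc k)) = ≤-by (monomial≥0 p (suc k))
    (trans (solve 2 (λ n m → m := (:1 :+ (:1 :+ n)) :* m :- (n :* m :+ m)) refl (ℕ→ℝ (suc k)) (monomial M (suc k)))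
      (+-congˡ (-‿cong (+-congʳ (monomial-suc M k)))))

  Taylor-± : ∀ {x y M} → x ∈± M → y ∈± M → ∀ k → Taylor x y k ∈± monomial″ M k * ((y - x) * (y - x))
  Taylor-± {x} {y} {M} p q zero = ±-resp
    (solve 3 (λ e x y → :0 := e :- e :- :0 :* (y :- x)) refl (monomial x 0) x y)
    (sym (zeroˡ _)) (±-0 ≤-refl)
  Taylor-± {x} {y} {M} p q (suc k) = cancel-± (ℕ→ℝ>0 k)
    (±-respˡ recurrence (±-≤ (≤-by (gap (monomial″-growth (±-≥0 p) k) ⊠ sq≥0 (y - x))
        (solve 6 (λ m e″ e′ n f h → (n :* f :- (m :* e″ :+ e′)) :* h := n :* (f :* h) :- (m :* (e″ :* h) :+ e′ :* h)) refl
          M (monomial″ M k) (monomial′ M k) (ℕ→ℝ (suc k)) (monomial″ M (suc k)) ((y - x) * (y - x))))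
      (±-+ (±-* q (Taylor-± p q k)) (±-* (monomial′-± p k) (±-self (sq≥0 (y - x)))))))
    where
    -- The remainders inherit the recursion of the monomials; the quadratic term is what remains
    -- when the linear term is expanded at x instead of y.
    recurrence : y * Taylor x y k + monomial′ x k * ((y - x) * (y - x)) ≈ ℕ→ℝ (suc k) * Taylor x y (suc k)
    recurrence = trans
      (solve 5 (λ x y a b c → y :* (a :- b :- c :* (y :- x)) :+ c :* ((y :- x) :* (y :- x))
                  := y :* a :- x :* b :- b :* (y :- x) :- (x :* c) :* (y :- x)) refl x y (monomial y k) (monomial x k) (monomial′ x k))
      (trans (+-cong (+-congʳ (+-cong (sym (monomial-suc y k)) (-‿cong (sym (monomial-suc x k)))))
               (-‿cong (*-congʳ (sym (monomial-scale x k)))))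
        (solve 6 (λ x y a b c n → (:1 :+ n) :* a :- (:1 :+ n) :* c :- b :* (y :- x) :- n :* b :* (y :- x)
                    := (:1 :+ n) :* (a :- c :- b :* (y :- x))) refl x y (monomial y (suc k)) (monomial x k) (monomial x (suc k)) (ℕ→ℝ k)))

  -- Once k ≥ 2M the terms at least halve.
  exponential-bounded : ∀ M → 0# ≤ M → ∃[ B ] (∀ n → ∑< n (monomial M) ≤ B)
  exponential-bounded M M≥0 = S N + (m N + m N) , λ n → ≤-trans (early n) (≤-trans (≤-by (m≥0 (n ℕ.+ N) ⊞ m≥0 (n ℕ.+ N))
      (solve 2 (λ s m → m :+ m := s :+ (m :+ m) :- s) refl (S (n ℕ.+ N)) (m (n ℕ.+ N)))) (late n))
    where
    m = monomial M
    S : ℕ → ℝ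
    S n = ∑< n m
    m≥0 = monomial≥0 M≥0
    large = archimedean (M + M)
    N = proj₁ large
    early : ∀ n → S n ≤ S (n ℕ.+ N)
    early n = monotone-≤ {S} (λ n → ≤-respʳ (sym (∑-snoc n m)) (≤-by (m≥0 n) (solve 2 (λ s m → m := s :+ m :- s) refl (S n) (m n))))
                (ℕₚ.m≤m+n n N)
    halve : ∀ k → N ℕ.≤ k → m (suc k) + m (suc k) ≤ m k
    halve k N≤k = cancel≤ (ℕ→ℝ>0 k) (≤-by (gap (≤-trans (proj₂ large) (ℕ→ℝ-mono (ℕₚ.m≤n⇒m≤1+n N≤k))) ⊠ m≥0 k)
      (trans (solve 3 (λ M n a → (n :- (M :+ M)) :* a := n :* a :- (M :* a :+ M :* a)) refl M (ℕ→ℝ (suc k)) (m k))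
        (+-congˡ (-‿cong (trans (+-cong (sym (monomial-suc M k)) (sym (monomial-suc M k))) (sym (distribˡ _ _ _)))))))
    late : ∀ n → S (n ℕ.+ N) + (m (n ℕ.+ N) + m (n ℕ.+ N)) ≤ S N + (m N + m N)
    late zero    = ≤-refl
    late (suc n) = ≤-trans (≤-respˡ (+-congʳ (sym (∑-snoc (n ℕ.+ N) m)))
      (≤-by (gap (halve (n ℕ.+ N) (ℕₚ.m≤n+m N n)))
        (solve 3 (λ s a b → a :- (b :+ b) := s :+ (a :+ a) :- (s :+ a :+ (b :+ b))) refl (S (n ℕ.+ N)) (m (n ℕ.+ N)) (m (suc (n ℕ.+ N))))))
      (late n)

  Coefficients : (ℕ → ℝ) → Set
  Coefficients c = ∀ k → c k ∈± 1#

  partial : (ℕ → ℝ) → ℝ → ℕ → ℝ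
  partial c x n = ∑< n λ k → c k * monomial x k

  opaque
    series : (ℕ → ℝ) → ℝ → ℝ
    series c x = lim (partial c x)

    series-converges : ∀ {c} → Coefficients c → ∀ x → Converges (partial c x) (series c x)
    series-converges {c} cb x =
      let (B , b) = exponential-bounded ∣ x ∣ (abs≥0 x)
          (L , conv) = comparison-test {λ k → c k * monomial x k} {monomial ∣ x ∣} {B}
            (λ k → ±-respʳ (*-identityˡ _) (±-* (cb k) (monomial-± (±-abs x) k))) b
          l≈L = lim-≈ conv
      in λ ε ε>0 → let (N , h) = conv ε ε>0 in N , λ n n≥N → ±-respˡ (+-congˡ (-‿cong (sym l≈L))) (h n n≥N)

  Converges-suc : ∀ {u L} → Converges u L → Converges (λ n → u (suc n)) L
  Converges-suc p ε ε>0 = let (N , h) = p ε ε>0 in N , λ n n≥N → h (suc n) (ℕₚ.m≤n⇒m≤1+n n≥N)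

  -- In the basis x^k / k! differentiation is a shift of the coefficients. The Taylor bounds are
  -- summed over the partial sums, where their constants total at most the bound B for the
  -- exponential series at M, and the inequality passes to the limit.
  Deriv-series : ∀ {c} → Coefficients c → ∀ M → 0# ≤ M → Deriv (- M) M (series c) (series λ k → c (suc k))
  Deriv-series {c} cb M M≥0 = record
    { C = B ; C≥0 = bounded 0
    ; f-cong = λ {x} {y} _ _ e → series-cong {λ k → c (suc k)} (λ k → cb (suc k)) e
    ; bound = λ {x} {y} (p , q) (r , s) → taylor (p , q) (r , s) }
    where
    bound = exponential-bounded M M≥0
    B = proj₁ bound
    bounded = proj₂ bound
    c′ : ℕ → ℝ
    c′ k = c (suc k)
    ^-congˡ : ∀ {x y} k → x ≈ y → x ^ k ≈ y ^ k
    ^-congˡ zero    e = refl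
    ^-congˡ (suc k) e = *-cong e (^-congˡ k e)
    series-cong : ∀ {c} → Coefficients c → ∀ {x y} → x ≈ y → series c x ≈ series c y
    series-cong {c} cb {x} {y} e = limit-unique
      (Converges-cong (λ n → ∑-cong n {λ k → c k * monomial x k} {λ k → c k * monomial y k} λ k _ → *-congˡ (*-congʳ (^-congˡ k e)))
        (series-converges cb x))
      (series-converges cb y)
    taylor : ∀ {x y} → x ∈± M → y ∈± M → series c y - series c x - series c′ x * (y - x) ∈± B * ((y - x) * (y - x))
    taylor {x} {y} p q = ±-respˡ (solve 1 (λ l → l :- :0 := l) refl _) (limit-± {x = 0#}
      (Converges-+ (Converges-+ (Converges-suc (series-converges cb y)) (Converges-neg (Converges-suc (series-converges cb x))))
        (Converges-neg (Converges-scale (y - x) (series-converges (λ k → cb (suc k)) x))))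
      (0 , λ n _ → ±-respˡ (trans (terms n) (solve 1 (λ l → l := l :- :0) refl _)) (±-≤ (total≤ n) (∑-± n λ k _ →
        ±-* (cb (suc k)) (Taylor-± p q (suc k))))))
      where
      h = y - x
      total≤ : ∀ n → ∑< n (λ k → 1# * (monomial″ M (suc k) * (h * h))) ≤ B * (h * h)
      total≤ n = ≤-respˡ (trans (sym (∑-* n (h * h) (λ k → monomial″ M (suc k))))
          (∑-cong n {λ k → h * h * monomial″ M (suc k)} {λ k → 1# * (monomial″ M (suc k) * (h * h))}
            λ k _ → solve 2 (λ h m → h :* m := :1 :* (m :* h)) refl (h * h) (monomial″ M (suc k))))
        (≤-respʳ (*-comm _ _) (*-monoˡ (sq≥0 h) (≤-trans (shift n) (bounded n))))
        where
        shift : ∀ n → ∑< n (λ k → monomial″ M (suc k)) ≤ ∑< n (monomial M)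
        shift zero    = ≤-refl
        shift (suc n) = ≤-respˡ (sym (+-identityˡ _)) (monotone-≤ {λ n → ∑< n (monomial M)}
          (λ n → ≤-respʳ (sym (∑-snoc n (monomial M)))
            (≤-by (monomial≥0 M≥0 n) (solve 2 (λ s m → m := s :+ m :- s) refl (∑< n (monomial M)) (monomial M n)))) (ℕₚ.n≤1+n n))
      terms : ∀ n → ∑< n (λ k → c (suc k) * Taylor x y (suc k)) ≈
              (partial c y (suc n) + - partial c x (suc n)) + - (partial c′ x n * h)
      terms zero = solve 4 (λ c e x h → :0 := (c :* e :+ :0) :+ :- (c :* e :+ :0) :+ :- (:0 :* h)) refl (c 0) (monomial x 0) x h
      terms (suc n) = trans (∑-snoc n (λ k → c (suc k) * Taylor x y (suc k))) (trans (+-congʳ (terms n)) (trans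
        (solve 8 (λ sy sx s h c ey ex e → ((sy :+ :- sx) :+ :- (s :* h)) :+ c :* (ey :- ex :- e :* h)
                    := (sy :+ c :* ey) :+ :- (sx :+ c :* ex) :+ :- ((s :+ c :* e) :* h)) refl
          (partial c y (suc n)) (partial c x (suc n)) (partial c′ x n) h (c (suc n)) (monomial y (suc n)) (monomial x (suc n)) (monomial x n))
        (+-cong (+-cong (sym (∑-snoc (suc n) (λ k → c k * monomial y k))) (-‿cong (sym (∑-snoc (suc n) (λ k → c k * monomial x k)))))
          (-‿cong (*-congʳ (sym (∑-snoc n (λ k → c′ k * monomial x k))))))))

  -- Sine and cosine

  series-at-0 : ∀ {c} → Coefficients c → series c 0# ≈ c 0
  series-at-0 {c} cb = limit-unique (series-converges cb 0#)
    λ ε ε>0 → 1 , λ { (suc n) _ → ±-respˡ (sym (≈⇒0 (first n))) (±-0 (<⇒≤ ε>0)) }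
    where
    ≈⇒0 : ∀ {x y} → x ≈ y → x - y ≈ 0#
    ≈⇒0 e = gap₀ (sym e)
    vanish : ∀ k → monomial 0# (suc k) ≈ 0#
    vanish k = trans (*-congʳ (zeroˡ _)) (zeroˡ _)
    tail : ∀ n {a : ℕ → ℝ} → (∀ k → a k ≈ 0#) → ∑< n a ≈ 0#
    tail zero    h = refl
    tail (suc n) {a} h = trans (+-cong (h 0) (tail n {λ k → a (suc k)} λ k → h (suc k))) (+-identityˡ 0#)
    one : monomial 0# 0 ≈ 1#
    one = trans (*-congˡ (inv-cong (ℕ→ℝ≉0 0) (+-identityʳ 1#))) (trans (*-congˡ 1⁻¹≈1) (*-identityˡ 1#))
    first : ∀ n → partial c 0# (suc n) ≈ c 0
    first n = trans (+-cong (trans (*-congˡ one) (*-identityʳ _))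
      (tail n {λ k → c (suc k) * monomial 0# (suc k)} λ k → trans (*-congˡ (vanish k)) (zeroʳ _))) (+-identityʳ _)

  series-neg : ∀ {c} → Coefficients c → ∀ x → series (λ k → - c k) x ≈ - series c x
  series-neg {c} cb x = limit-unique (series-converges (λ k → ±-neg (cb k)) x)
    (Converges-cong (λ n → partial-neg n) (Converges-neg (series-converges cb x)))
    where
    partial-neg : ∀ n → - partial c x n ≈ partial (λ k → - c k) x n
    partial-neg n = trans (solve 1 (λ s → :- s := (:- :1) :* s) refl (partial c x n))
      (trans (sym (∑-* n (- 1#) (λ k → c k * monomial x k)))
        (∑-cong n {λ k → - 1# * (c k * monomial x k)} {λ k → - c k * monomial x k}
          λ k _ → solve 2 (λ c m → (:- :1) :* (c :* m) := (:- c) :* m) refl (c k) (monomial x k)))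

  -- The sequence 0, 1, 0, -1 repeated. One shift gives the coefficients of cosine, and by the last
  -- clause two shifts give those of minus sine, so both derivatives can be read off.
  sin-coeff : ℕ → ℝ
  sin-coeff zero          = 0#
  sin-coeff (suc zero)    = 1#
  sin-coeff (suc (suc k)) = - sin-coeff k

  cos-coeff : ℕ → ℝ
  cos-coeff k = sin-coeff (suc k)

  sin-coeff-± : Coefficients sin-coeff
  sin-coeff-± zero          = ±-0 (<⇒≤ 0<1)
  sin-coeff-± (suc zero)    = ±-self (<⇒≤ 0<1)
  sin-coeff-± (suc (suc k)) = ±-neg (sin-coeff-± k)

  double-suc : ∀ n → 2 ℕ.* suc n ≡ suc (suc (2 ℕ.* n))
  double-suc n = ℕₚ.*-suc 2 n

  sin-coeff-even : ∀ n → sin-coeff (2 ℕ.* n) ≈ 0#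
  sin-coeff-even zero    = refl
  sin-coeff-even (suc n) = trans (≡→≈ (≡.cong sin-coeff (double-suc n)))
    (trans (-‿cong (sin-coeff-even n)) (solve 0 (:- :0 := :0) refl))

  sin-coeff-odd : ∀ n → sin-coeff (suc (2 ℕ.* n)) ≈ (- 1#) ^ n
  sin-coeff-odd zero    = refl
  sin-coeff-odd (suc n) = trans (≡→≈ (≡.cong (λ k → sin-coeff (suc k)) (double-suc n)))
    (trans (-‿cong (sin-coeff-odd n)) (solve 1 (λ x → :- x := (:- :1) :* x) refl ((- 1#) ^ n)))

  ∑-pairs : ∀ n (a : ℕ → ℝ) → ∑< (2 ℕ.* n) a ≈ ∑< n (λ k → a (2 ℕ.* k) + a (suc (2 ℕ.* k)))
  ∑-pairs zero    a = refl
  ∑-pairs (suc n) a = trans (≡→≈ (≡.cong (λ m → ∑< m a) (double-suc n)))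
    (trans (∑-snoc (suc (2 ℕ.* n)) a) (trans (+-congʳ (∑-snoc (2 ℕ.* n) a)) (trans (+-congʳ (+-congʳ (∑-pairs n a)))
      (trans (+-assoc _ _ _) (sym (∑-snoc n (λ k → a (2 ℕ.* k) + a (suc (2 ℕ.* k)))))))))

  -- `sin` and `cos` are defined by series without the vanishing terms. Grouping the terms 2k and 2k
  -- + 1 identifies their partial sums with the subsequence of partial sums of even length.
  even-partial-sums : ∀ {c x} (a : ℕ → ℝ) → Coefficients c →
    (∀ k → c (2 ℕ.* k) * monomial x (2 ℕ.* k) + c (suc (2 ℕ.* k)) * monomial x (suc (2 ℕ.* k)) ≈ a k) →
    ∑∞ a ≈ series c x
  even-partial-sums {c} {x} a cb e = lim-≈ (Converges-cong
    (λ n → trans (∑-pairs n (λ k → c k * monomial x k)) (∑-cong n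
      {λ k → c (2 ℕ.* k) * monomial x (2 ℕ.* k) + c (suc (2 ℕ.* k)) * monomial x (suc (2 ℕ.* k))} {a} λ k _ → e k))
    λ ε ε>0 → let (N , h) = series-converges cb x ε ε>0 in N , λ n n≥N → h (2 ℕ.* n) (ℕₚ.≤-trans n≥N (ℕₚ.m≤m+n n _)))

  sin≈series : ∀ x → sin x ≈ series sin-coeff x
  sin≈series x = even-partial-sums _ sin-coeff-± λ k → trans (+-cong (trans (*-congʳ (sin-coeff-even k)) (zeroˡ _))
      (trans (sym (*-assoc _ _ _)) (*-congʳ (*-congʳ (sin-coeff-odd k)))))
    (trans (+-identityˡ _) (≡→≈ (≡.cong (λ m → (- 1#) ^ k * x ^ m / ℕ→ℝ (m !)) (ℕₚ.+-comm 1 (2 ℕ.* k)))))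

  cos≈series : ∀ x → cos x ≈ series cos-coeff x
  cos≈series x = even-partial-sums _ (λ k → sin-coeff-± (suc k)) λ k → trans (+-cong
      (trans (sym (*-assoc _ _ _)) (*-congʳ (*-congʳ (sin-coeff-odd k))))
      (trans (*-congʳ (trans (-‿cong (sin-coeff-even k)) (solve 0 (:- :0 := :0) refl))) (zeroˡ _)))
    (+-identityʳ _)

  Deriv-sin : ∀ M → 0# ≤ M → Deriv (- M) M sin cos
  Deriv-sin M M≥0 = Deriv-cong (λ {x} _ → sym (sin≈series x)) (λ {x} _ → sym (cos≈series x))
    (Deriv-series sin-coeff-± M M≥0)

  Deriv-cos : ∀ M → 0# ≤ M → Deriv (- M) M cos (λ x → - sin x)
  Deriv-cos M M≥0 = Deriv-cong (λ {x} _ → sym (cos≈series x))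
    (λ {x} _ → trans (series-neg sin-coeff-± x) (-‿cong (sym (sin≈series x))))
    (Deriv-series (λ k → sin-coeff-± (suc k)) M M≥0)

  ±⇒∈ : ∀ {x M} → x ∈± M → x ∈[ - M , M ]
  ±⇒∈ (p , q) = p , q

  sin-cong : ∀ {x y} → x ≈ y → sin x ≈ sin y
  sin-cong {x} e = Deriv.H-cong (Deriv-sin ∣ x ∣ (abs≥0 x)) (±⇒∈ (±-abs x)) (±⇒∈ (±-respˡ e (±-abs x))) e

  cos-cong : ∀ {x y} → x ≈ y → cos x ≈ cos y
  cos-cong {x} e = Deriv.H-cong (Deriv-cos ∣ x ∣ (abs≥0 x)) (±⇒∈ (±-abs x)) (±⇒∈ (±-respˡ e (±-abs x))) e

  sin-0 : sin 0# ≈ 0#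
  sin-0 = trans (sin≈series 0#) (series-at-0 sin-coeff-±)

  cos-0 : cos 0# ≈ 1#
  cos-0 = trans (cos≈series 0#) (series-at-0 λ k → sin-coeff-± (suc k))

  -- Conservation of the energy u² + u′² for u″ = -u; as uniqueness for this equation it yields the addition formulas.
  energy : ∀ {a b u v} → Deriv a b u v → Deriv a b v (λ x → - u x) →
           ∀ {x y} → x ∈[ a , b ] → y ∈[ a , b ] → u x * u x + v x * v x ≈ u y * u y + v y * v y
  energy {a} {b} {u} {v} du dv {x} {y} p q =
    [ (λ x≤y → constant p q x≤y) , (λ y≤x → sym (constant q p y≤x)) ]′ (total x y)
    where
    conserved : Deriv a b (λ x → u x * u x + v x * v x) (λ _ → 0#)
    conserved = Deriv-cong (λ _ → refl)
      (λ {x} _ → solve 2 (λ u v → (v :* u :+ u :* v) :+ ((:- u) :* v :+ v :* (:- u)) := :0) refl (u x) (v x))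
      (Deriv-+ (Deriv-* du du) (Deriv-* dv dv))
    constant : ∀ {x y} → x ∈[ a , b ] → y ∈[ a , b ] → x ≤ y → u x * u x + v x * v x ≈ u y * u y + v y * v y
    constant p q x≤y = Deriv-zero x≤y (Deriv-sub (proj₁ p) (proj₂ q) conserved)

  sin²+cos² : ∀ x → sin x * sin x + cos x * cos x ≈ 1#
  sin²+cos² x = trans (energy (Deriv-sin M (abs≥0 x)) (Deriv-cos M (abs≥0 x)) (±⇒∈ (±-abs x)) (±⇒∈ (±-0 (abs≥0 x))))
    (trans (+-cong (*-cong sin-0 sin-0) (*-cong cos-0 cos-0)) (solve 0 (:0 :* :0 :+ :1 :* :1 := :1) refl))
    where M = ∣ x ∣

  square-zero : ∀ {x} → x * x ≤ 0# → x ≈ 0#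
  square-zero {x} p = by-contradiction λ n → n (zero-product (≤-antisym p (sq≥0 x)) n)

  sum-of-squares-zero : ∀ {x y} → x * x + y * y ≈ 0# → x ≈ 0# × y ≈ 0#
  sum-of-squares-zero {x} {y} e =
    square-zero (≤-respʳ e (≤-by (sq≥0 y) (solve 2 (λ x y → y := x :+ y :- x) refl (x * x) (y * y)))) ,
    square-zero (≤-respʳ e (≤-by (sq≥0 x) (solve 2 (λ x y → x := x :+ y :- y) refl (x * x) (y * y))))

  module _ (x : ℝ) where
    private
      -- The defects of the two addition formulas for fixed x. They satisfy u′ = v and v′ = -u and
      -- vanish at 0, so conservation of energy makes them vanish identically.
      u v : ℝ → ℝ
      u t = sin (x + t) - (sin x * cos t + cos x * sin t)
      v t = cos (x + t) - (cos x * cos t - sin x * sin t)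

      module _ (N : ℝ) (N≥0 : 0# ≤ N) where
        M = ∣ x ∣ + N
        M≥0 = abs≥0 x ⊞ N≥0

        shifted : ∀ {H f} → Deriv (- M) M H f → Deriv (- N) N (λ t → H (x + t)) (λ t → f (x + t))
        shifted {f = f} d = Deriv-cong (λ _ → refl)
          (λ {t} _ → trans (*-congˡ (+-identityˡ 1#)) (*-identityʳ (f (x + t))))
          (Deriv-∘ (λ t∈ → ±⇒∈ (±-+ (±-abs x) (proj₁ t∈ , proj₂ t∈))) d (Deriv-+ (Deriv-const x) Deriv-id))

        Deriv-u : Deriv (- N) N u v
        Deriv-u = Deriv-cong (λ _ → refl)
          (λ {t} _ → solve 5 (λ c s k ct st → c :+ :- (s :* (:- st) :+ k :* ct) := c :- (k :* ct :- s :* st)) refl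
            (cos (x + t)) (sin x) (cos x) (cos t) (sin t))
          (Deriv-+ (shifted (Deriv-sin M M≥0))
            (Deriv-neg (Deriv-+ (Deriv-scale (sin x) (Deriv-cos N N≥0)) (Deriv-scale (cos x) (Deriv-sin N N≥0)))))

        Deriv-v : Deriv (- N) N v (λ t → - u t)
        Deriv-v = Deriv-cong (λ _ → refl)
          (λ {t} _ → solve 5 (λ z s k ct st → (:- z) :+ :- (k :* (:- st) :+ :- (s :* ct)) := :- (z :- (s :* ct :+ k :* st))) refl
            (sin (x + t)) (sin x) (cos x) (cos t) (sin t))
          (Deriv-+ (shifted (Deriv-cos M M≥0))
            (Deriv-neg (Deriv-+ (Deriv-scale (cos x) (Deriv-cos N N≥0)) (Deriv-neg (Deriv-scale (sin x) (Deriv-sin N N≥0))))))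

      u0 : u 0# ≈ 0#
      u0 = trans (+-cong (sin-cong (+-identityʳ x)) (-‿cong (+-cong (*-congˡ cos-0) (*-congˡ sin-0))))
        (solve 2 (λ s c → s :- (s :* :1 :+ c :* :0) := :0) refl (sin x) (cos x))

      v0 : v 0# ≈ 0#
      v0 = trans (+-cong (cos-cong (+-identityʳ x)) (-‿cong (+-cong (*-congˡ cos-0) (-‿cong (*-congˡ sin-0)))))
        (solve 2 (λ s c → c :- (c :* :1 :- s :* :0) := :0) refl (sin x) (cos x))

      vanish : ∀ t → u t ≈ 0# × v t ≈ 0#
      vanish t = sum-of-squares-zero (trans
        (energy (Deriv-u N (abs≥0 t)) (Deriv-v N (abs≥0 t)) (±⇒∈ (±-abs t)) (±⇒∈ (±-0 (abs≥0 t))))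
        (trans (+-cong (*-cong u0 u0) (*-cong v0 v0)) (solve 0 (:0 :* :0 :+ :0 :* :0 := :0) refl)))
        where N = ∣ t ∣

    sin-+ : ∀ t → sin (x + t) ≈ sin x * cos t + cos x * sin t
    sin-+ t = sym (≈-by (proj₁ (vanish t)) refl)

    cos-+ : ∀ t → cos (x + t) ≈ cos x * cos t - sin x * sin t
    cos-+ t = sym (≈-by (proj₂ (vanish t)) refl)

  -- π

  private
    sin-x-x : ∀ x → sin x * cos (- x) + cos x * sin (- x) ≈ 0#
    sin-x-x x = trans (sym (sin-+ x (- x))) (trans (sin-cong (-‿inverseʳ x)) sin-0)

    cos-x-x : ∀ x → cos x * cos (- x) - sin x * sin (- x) ≈ 1#
    cos-x-x x = trans (sym (cos-+ x (- x))) (trans (cos-cong (-‿inverseʳ x)) cos-0)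

  -- The addition formulas at x + (-x) = 0 are linear equations for sin (-x) and cos (-x) with
  -- determinant sin² x + cos² x = 1; this is Cramer's rule.
  sin-neg : ∀ x → sin (- x) ≈ - sin x
  sin-neg x = begin
    sin (- x)
      ≈⟨ *-identityˡ _ ⟨
    1# * sin (- x)
      ≈⟨ *-congʳ (sin²+cos² x) ⟨
    (sin x * sin x + cos x * cos x) * sin (- x)
      ≈⟨ solve 4 (λ s c s′ c′ → (s :* s :+ c :* c) :* s′ := c :* (s :* c′ :+ c :* s′) :- s :* (c :* c′ :- s :* s′)) refl
           (sin x) (cos x) (sin (- x)) (cos (- x)) ⟩
    cos x * (sin x * cos (- x) + cos x * sin (- x)) - sin x * (cos x * cos (- x) - sin x * sin (- x))
      ≈⟨ +-cong (*-congˡ (sin-x-x x)) (-‿cong (*-congˡ (cos-x-x x))) ⟩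
    cos x * 0# - sin x * 1#
      ≈⟨ solve 2 (λ s c → c :* :0 :- s :* :1 := :- s) refl (sin x) (cos x) ⟩
    - sin x ∎

  cos-neg : ∀ x → cos (- x) ≈ cos x
  cos-neg x = begin
    cos (- x)
      ≈⟨ *-identityˡ _ ⟨
    1# * cos (- x)
      ≈⟨ *-congʳ (sin²+cos² x) ⟨
    (sin x * sin x + cos x * cos x) * cos (- x)
      ≈⟨ solve 4 (λ s c s′ c′ → (s :* s :+ c :* c) :* c′ := s :* (s :* c′ :+ c :* s′) :+ c :* (c :* c′ :- s :* s′)) refl
           (sin x) (cos x) (sin (- x)) (cos (- x)) ⟩
    sin x * (sin x * cos (- x) + cos x * sin (- x)) + cos x * (cos x * cos (- x) - sin x * sin (- x))
      ≈⟨ +-cong (*-congˡ (sin-x-x x)) (*-congˡ (cos-x-x x)) ⟩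
    sin x * 0# + cos x * 1#
      ≈⟨ solve 2 (λ s c → s :* :0 :+ c :* :1 := c) refl (sin x) (cos x) ⟩
    cos x ∎

  sin-- : ∀ x y → sin (x - y) ≈ sin x * cos y - cos x * sin y
  sin-- x y = trans (sin-+ x (- y)) (trans (+-cong (*-congˡ (cos-neg y)) (*-congˡ (sin-neg y)))
    (solve 4 (λ s c s′ c′ → s :* c′ :+ c :* (:- s′) := s :* c′ :- c :* s′) refl (sin x) (cos x) (sin y) (cos y)))

  cos-- : ∀ x y → cos (x - y) ≈ cos x * cos y + sin x * sin y
  cos-- x y = trans (cos-+ x (- y)) (trans (+-cong (*-congˡ (cos-neg y)) (-‿cong (*-congˡ (sin-neg y))))
    (solve 4 (λ s c s′ c′ → c :* c′ :- s :* (:- s′) := c :* c′ :+ s :* s′) refl (sin x) (cos x) (sin y) (cos y)))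

  sin-half : ∀ x → sin x ≈ ℕ→ℝ 2 * (sin (half x) * cos (half x))
  sin-half x = trans (sin-cong (sym (half-sum x))) (trans (sin-+ (half x) (half x))
    (solve 2 (λ s c → s :* c :+ c :* s := :2 :* (s :* c)) refl (sin (half x)) (cos (half x))))

  cos-half : ∀ x → cos x ≈ 1# - ℕ→ℝ 2 * (sin (half x) * sin (half x))
  cos-half x = trans (cos-cong (sym (half-sum x))) (trans (cos-+ (half x) (half x))
    (trans (solve 2 (λ s c → c :* c :- s :* s := (s :* s :+ c :* c) :- :2 :* (s :* s)) refl (sin (half x)) (cos (half x)))
      (+-congʳ (sin²+cos² (half x)))))

  -- This is 2^k x. The argument is doubled first, which matches inductions along the angle-doubling
  -- formulas.
  double : ℕ → ℝ → ℝ
  double zero    x = x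
  double (suc k) x = double k (x + x)

  double-large : ∀ k {x} → 0# ≤ x → ℕ→ℝ (suc k) * x ≤ double k x
  double-large zero    {x} p = ≤-reflexive (solve 1 (λ x → (:1 :+ :0) :* x := x) refl x)
  double-large (suc k) {x} p = ≤-trans
    (≤-by (ℕ→ℝ≥0 k ⊠ p) (solve 2 (λ k x → k :* x := (:1 :+ k) :* (x :+ x) :- (:1 :+ (:1 :+ k)) :* x) refl (ℕ→ℝ k) x))
    (double-large k (p ⊞ p))

  double≥0 : ∀ k {x} → 0# ≤ x → 0# ≤ double k x
  double≥0 k p = ≤-trans (ℕ→ℝ≥0 (suc k) ⊠ p) (double-large k p)

  eventually-above : ∀ {x} B → 0# < x → ∃[ k ] (B ≤ double k x)
  eventually-above {x} B x>0 = let (k , p) = archimedean⁺ (B / x) in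
    k , ≤-trans (≤-respˡ (/-cancel (>⇒≉ x>0)) (*-monoʳ (<⇒≤ x>0) p)) (double-large k (<⇒≤ x>0))

  -- sin h ≥ h - C h² is positive for 0 < h < 1/C.
  sin>0-near-0 : ∃[ h₀ ] (0# < h₀ × (∀ {h} → 0# < h → h ≤ h₀ → 0# < sin h))
  sin>0-near-0 = (C + 1#) ⁻¹ , inv>0 k>0 , positive
    where
    open Deriv (Deriv-sin 1# (<⇒≤ 0<1))
    k>0 : 0# < C + 1#
    k>0 = +1>0 C≥0
    positive : ∀ {h} → 0# < h → h ≤ (C + 1#) ⁻¹ → 0# < sin h
    positive {h} h>0 h≤ = <-≤-trans (h>0 ⊠⁺ 1-Ch>0) (≤-by (gap (lower sin-h))
      (solve 3 (λ s c h → (s :- h) :- (:- (c :* (h :* h))) := s :- h :* (:1 :- c :* h)) refl (sin h) C h))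
      where
      h≤1 : h ≤ 1#
      h≤1 = ≤-trans h≤ (inv≤1 (≤-by C≥0 (solve 1 (λ c → c := c :+ :1 :- :1) refl C)))
      1-Ch>0 : 0# < 1# - C * h
      1-Ch>0 = <-≤-trans h>0 (≤-by (gap (≤-respʳ (inv-right (>⇒≉ k>0)) (*-monoˡ (<⇒≤ k>0) h≤)))
        (solve 2 (λ c h → :1 :- (c :+ :1) :* h := (:1 :- c :* h) :- h) refl C h))
      sin-h : sin h - h ∈± C * (h * h)
      sin-h = ±-resp
        (trans (+-cong (+-congˡ (-‿cong sin-0)) (-‿cong (*-congʳ cos-0)))
          (solve 2 (λ s h → s :- :0 :- :1 :* (h :- :0) := s :- h) refl (sin h) h))
        (solve 2 (λ c h → c :* ((h :- :0) :* (h :- :0)) := c :* (h :* h)) refl C h)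
        (bound (±⇒∈ (±-0 (<⇒≤ 0<1))) (±⇒∈ (±-nonneg (<⇒≤ h>0) h≤1)))

  -- As long as cos ≥ 0, doubling the angle at least doubles 1 - cos, which cannot go on forever.
  cos≤0-somewhere : ∃[ b ] (0# ≤ b × cos b ≤ 0#)
  cos≤0-somewhere = by-contradiction λ none →
    let pos : ∀ {x} → 0# ≤ x → 0# < cos x
        pos = λ {x} x≥0 → ≰⇒> λ q → none (x , x≥0 , q)
        (h , h>0 , sin-pos) = sin>0-near-0
        grow : ∀ {x} → 0# ≤ x → (1# - cos x) + (1# - cos x) ≤ 1# - cos (x + x)
        -- With c = cos x the difference of the two sides is 2c (1 - c).
        grow = λ {x} x≥0 → ≤-by (ℕ→ℝ≥0 2 ⊠ (<⇒≤ (pos x≥0) ⊠ gap (cos≤1 x)))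
          (trans (solve 1 (λ c → :2 :* (c :* (:1 :- c)) := (:1 :+ :1) :- (:2 :* (c :* c)) :- ((:1 :- c) :+ (:1 :- c))) refl (cos x))
            (+-congʳ (trans (+-congʳ (+-congˡ (sym (sin²+cos² x)))) (trans
              (solve 2 (λ s c → (:1 :+ (s :* s :+ c :* c)) :- :2 :* (c :* c) := :1 :- (c :* c :- s :* s)) refl (sin x) (cos x))
              (+-congˡ (-‿cong (sym (cos-+ x x))))))))
        iterate : ∀ k {x} → 0# ≤ x → double k (1# - cos x) ≤ 1# - cos (double k x)
        iterate = iterate-grow pos grow
        -- Otherwise cos h ≥ 1, and sin² h + cos² h would exceed 1 because sin h > 0.
        x₀>0 : 0# < 1# - cos h
        x₀>0 = ≰⇒> λ q → <⇒≱ (sin-pos h>0 ≤-refl ⊠⁺ sin-pos h>0 ≤-refl)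
          (≤-by (gap (*-mono (<⇒≤ 0<1) (<⇒≤ 0<1) (1≤cos q) (1≤cos q)))
            (trans (solve 2 (λ s c → c :* c :- :1 :* :1 := (:0 :- s :* s) :+ (s :* s :+ c :* c :- :1)) refl (sin h) (cos h))
              (trans (+-congˡ (gap₀ (sym (sin²+cos² h)))) (+-identityʳ _))))
        -- For this k the inequality 1 ≤ 2^k (1 - cos h) ≤ 1 - cos (2^k h) leaves no room for a
        -- positive cosine.
        (k , p) = eventually-above 1# x₀>0
    in <⇒≱ (pos (double≥0 k (<⇒≤ h>0))) (≤-by (gap (≤-trans p (iterate k (<⇒≤ h>0))))
         (solve 1 (λ c → :1 :- c :- :1 := :0 :- c) refl (cos (double k h))))
    where
    cos≤1 : ∀ x → cos x ≤ 1#
    cos≤1 x = sq-cancel≤ (<⇒≤ 0<1) (≤-by (sq≥0 (sin x))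
      (trans (solve 2 (λ s c → s :* s := (s :* s :+ c :* c) :- c :* c) refl (sin x) (cos x))
        (+-congʳ (trans (sin²+cos² x) (sym (*-identityˡ 1#))))))
    1≤cos : ∀ {x} → 1# - cos x ≤ 0# → 1# ≤ cos x
    1≤cos {x} q = ≤-by (gap q) (solve 1 (λ c → :0 :- (:1 :- c) := c :- :1) refl (cos x))
    double-mono : ∀ k {x y} → x ≤ y → double k x ≤ double k y
    double-mono zero    p = p
    double-mono (suc k) p = double-mono k (+-mono p p)
    iterate-grow : (∀ {x} → 0# ≤ x → 0# < cos x) →
                   (∀ {x} → 0# ≤ x → (1# - cos x) + (1# - cos x) ≤ 1# - cos (x + x)) →
                   ∀ k {x} → 0# ≤ x → double k (1# - cos x) ≤ 1# - cos (double k x)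
    iterate-grow pos grow zero    p = ≤-refl
    iterate-grow pos grow (suc k) p = ≤-trans (double-mono k (grow p)) (iterate-grow pos grow k (p ⊞ p))

  opaque
    quarter-turn : ∃[ q ] (0# < q × cos q ≈ 0# × (∀ y → 0# ≤ y → y < q → 0# < cos y))
    quarter-turn =
      let (b , b≥0 , cos-b) = cos≤0-somewhere
          (L , L≥0 , lip) = Deriv.H-Lipschitz (Deriv-cos b b≥0)
          -b≤0 : - b ≤ 0#
          -b≤0 = lower (±-0 b≥0)
          (q , q≥0 , _ , e , pos) = first-zero {0#} {b} {L + 1#} {cos} (+1>0 L≥0)
            (λ p q r s h → ±-≤ (*-monoʳ (±-≥0 h) (≤-+1 L))
              (lip (≤-trans -b≤0 p , q) (≤-trans -b≤0 r , s) h))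
            b≥0 (<-respʳ (sym cos-0) 0<1) cos-b
      in q , (q≥0 , λ 0≈q → 0≉1 (trans (sym e) (trans (cos-cong (sym 0≈q)) cos-0))) , e , pos

  -- The first positive zero of cos, identified with π/2 below.
  ½π : ℝ
  ½π = proj₁ quarter-turn
  ½π>0 = proj₁ (proj₂ quarter-turn)
  cos-½π : cos ½π ≈ 0#
  cos-½π = proj₁ (proj₂ (proj₂ quarter-turn))
  cos>0-below-½π = proj₂ (proj₂ (proj₂ quarter-turn))

  SinPositiveUpTo : ℝ → Set
  SinPositiveUpTo t = ∀ {x} → 0# < x → x ≤ ½π → x ≤ t → 0# < sin x

  half-≤ : ∀ {x y} → x ≤ y + y → half x ≤ y
  half-≤ {x} {y} p = cancel≤ (ℕ→ℝ>0 1) (≤-by (gap p) (trans (+-congˡ (-‿cong (sym (half-sum x))))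
    (solve 2 (λ h y → y :+ y :- (h :+ h) := :2 :* y :- :2 :* h) refl (half x) y)))

  -- In sin x = 2 sin (x/2) cos (x/2) the sine is positive by the previous range and the cosine
  -- because x/2 < `½π`. Each use doubles the range, starting from a small interval at 0.
  sin>0-double : ∀ k {t} → SinPositiveUpTo t → SinPositiveUpTo (double k t)
  sin>0-double zero    base = base
  sin>0-double (suc k) base = sin>0-double k λ {x} x>0 x≤½π x≤2t → <-respʳ (sym (sin-half x))
    (ℕ→ℝ>0 1 ⊠⁺ (base (half>0 x>0) (≤-trans (<⇒≤ (half<self x>0)) x≤½π) (half-≤ x≤2t) ⊠⁺
      cos>0-below-½π (half x) (<⇒≤ (half>0 x>0)) (<-≤-trans (half<self x>0) x≤½π)))

  sin>0-to-½π : ∀ {x} → 0# < x → x ≤ ½π → 0# < sin x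
  sin>0-to-½π {x} x>0 x≤½π =
    let (h₀ , h₀>0 , base) = sin>0-near-0
        (k , ½π≤) = eventually-above ½π h₀>0
    in sin>0-double k {h₀} (λ r _ s → base r s) x>0 x≤½π (≤-trans x≤½π ½π≤)

  sin-½π : sin ½π ≈ 1#
  sin-½π = sq-cancel≈ (<⇒≤ (sin>0-to-½π ½π>0 ≤-refl)) (<⇒≤ 0<1) (trans
    (trans (solve 1 (λ s → s :* s := s :* s :+ :0 :* :0) refl (sin ½π)) (+-congˡ (*-cong (sym cos-½π) (sym cos-½π))))
    (trans (sin²+cos² ½π) (sym (*-identityˡ 1#))))

  sin-[½π+½π] : sin (½π + ½π) ≈ 0#
  sin-[½π+½π] = trans (sin-+ ½π ½π) (trans (+-cong (*-congˡ cos-½π) (*-congʳ cos-½π))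
    (solve 1 (λ s → s :* :0 :+ :0 :* s := :0) refl (sin ½π)))

  cos-[½π+½π] : cos (½π + ½π) ≈ - 1#
  cos-[½π+½π] = trans (cos-+ ½π ½π) (trans (+-cong (*-cong cos-½π cos-½π) (-‿cong (*-cong sin-½π sin-½π)))
    (solve 0 (:0 :* :0 :- :1 :* :1 := :- :1) refl))

  sin>0-below-½π+½π : ∀ {x} → 0# < x → x < ½π + ½π → 0# < sin x
  sin>0-below-½π+½π {x} x>0 x<2½π = [ sin>0-to-½π x>0 , reflect ]′ (≤-or-> x ½π)
    where
    reflect : ½π < x → 0# < sin x
    reflect ½π<x = <-respʳ
      (trans (sin-- (½π + ½π) x) (trans (+-cong (*-congʳ sin-[½π+½π]) (-‿cong (*-congʳ cos-[½π+½π])))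
        (solve 2 (λ s c → :0 :* c :- (:- :1) :* s := s) refl (sin x) (cos x))))
      (sin>0-to-½π (gap⁺ x<2½π) (≤-by (gap (<⇒≤ ½π<x)) (solve 2 (λ q x → x :- q := q :- (q :+ q :- x)) refl ½π x)))

  IsPi : Pred ℝ 0ℓ
  IsPi p = 0# < p × sin p ≈ 0# × (∀ x → 0# < x → x < p → ¬ (sin x ≈ 0#))

  π-spec : IsPi π
  π-spec = the-∈ {d = 0#} {IsPi} (½π + ½π , ½π>0 ⊞⁺ <⇒≤ ½π>0 , sin-[½π+½π] , λ x x>0 x<2½π → >⇒≉ (sin>0-below-½π+½π x>0 x<2½π))

  π≈½π+½π : π ≈ ½π + ½π
  π≈½π+½π = ≤-antisym
    (≮⇒≥ λ ½π+½π<π → proj₂ (proj₂ π-spec) (½π + ½π) (½π>0 ⊞⁺ <⇒≤ ½π>0) ½π+½π<π sin-[½π+½π])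
    (≮⇒≥ λ π<½π+½π → >⇒≉ (sin>0-below-½π+½π (proj₁ π-spec) π<½π+½π) (proj₁ (proj₂ π-spec)))

  π/2≈½π : π/2 ≈ ½π
  π/2≈½π = sym (/-unique 2≉0 (trans (solve 1 (λ q → q :* :2 := q :+ q) refl ½π) (sym π≈½π+½π)))

  π>0 : 0# < π
  π>0 = proj₁ π-spec

  sin-π : sin π ≈ 0#
  sin-π = proj₁ (proj₂ π-spec)

  cos-π : cos π ≈ - 1#
  cos-π = trans (cos-cong π≈½π+½π) cos-[½π+½π]

  sin>0 : ∀ {x} → 0# < x → x < π → 0# < sin x
  sin>0 x>0 x<π = sin>0-below-½π+½π x>0 (<-respʳ π≈½π+½π x<π)

  cos-π/2 : cos π/2 ≈ 0#
  cos-π/2 = trans (cos-cong π/2≈½π) cos-½π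

  π/2>0 : 0# < π/2
  π/2>0 = <-respʳ (sym π/2≈½π) ½π>0

  π/2+π/2 : π/2 + π/2 ≈ π
  π/2+π/2 = trans (solve 1 (λ x → x :+ x := x :* :2) refl π/2) (/-cancel 2≉0)

  2π/3*3 : 2π/3 * ℕ→ℝ 3 ≈ ℕ→ℝ 2 * π
  2π/3*3 = /-cancel (ℕ→ℝ≉0 2)

  π/2<2π/3 : π/2 < 2π/3
  π/2<2π/3 = ≰⇒> λ r → <⇒≱ π>0 (≤-by (ℕ→ℝ≥0 6 ⊠ gap r)
    (trans (solve 2 (λ h t → con (+ 6) :* (h :- t) := con (+ 3) :* (h :+ h) :- :2 :* (t :* con (+ 3))) refl π/2 2π/3)
      (trans (+-cong (*-congˡ π/2+π/2) (-‿cong (*-congˡ 2π/3*3)))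
        (solve 1 (λ p → con (+ 3) :* p :- :2 :* (:2 :* p) := :0 :- p) refl π))))

  2π/3<π : 2π/3 < π
  2π/3<π = ≰⇒> λ r → <⇒≱ π>0 (≤-by (ℕ→ℝ≥0 3 ⊠ gap r)
    (trans (solve 2 (λ p t → con (+ 3) :* (t :- p) := t :* con (+ 3) :- con (+ 3) :* p) refl π 2π/3)
      (trans (+-congʳ 2π/3*3) (solve 1 (λ p → :2 :* p :- con (+ 3) :* p := :0 :- p) refl π))))

  -- With c = cos (2π/3), the triple-angle formula gives (c - 1)(2c + 1)² = 0, and c = 1 would force sin (2π/3) = 0.
  cos-2π/3 : ℕ→ℝ 2 * cos 2π/3 ≈ - 1#
  cos-2π/3 = sym (≈-by (trans (solve 1 (λ c → :2 :* c :+ :1 := :2 :* c :+ :1) refl c) 2c+1≈0) (solve 1 (λ c → :2 :* c :+ :1 := :2 :* c :- (:- :1)) refl c))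
    where
    t = 2π/3
    c = cos t
    s = sin t
    t>0 : 0# < t
    t>0 = <-trans π/2>0 π/2<2π/3
    s²+c² : s * s + c * c ≈ 1#
    s²+c² = sin²+cos² t
    cos-3t : cos (t + t + t) ≈ 1#
    cos-3t = trans (cos-cong (trans (solve 1 (λ t → t :+ t :+ t := t :* con (+ 3)) refl t) (trans 2π/3*3 (solve 1 (λ p → :2 :* p := p :+ p) refl π))))
      (trans (cos-+ π π) (trans (+-cong (*-cong cos-π cos-π) (-‿cong (*-cong sin-π sin-π)))
        (solve 0 ((:- :1) :* (:- :1) :- :0 :* :0 := :1) refl)))
    triple : cos (t + t + t) ≈ ℕ→ℝ 4 * (c * c * c) - ℕ→ℝ 3 * c
    triple = trans (cos-+ (t + t) t) (trans (+-cong (*-congʳ (cos-+ t t)) (-‿cong (*-congʳ (sin-+ t t))))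
      (trans (solve 2 (λ s c → (c :* c :- s :* s) :* c :- (s :* c :+ c :* s) :* s
                                 := :4 :* (c :* c :* c) :- con (+ 3) :* (c :* (s :* s :+ c :* c))) refl s c)
        (+-congˡ (-‿cong (*-congˡ (trans (*-congˡ s²+c²) (*-identityʳ c)))))))
    c≉1 : ¬ (c - 1# ≈ 0#)
    c≉1 e = >⇒≉ (sin>0 t>0 2π/3<π ⊠⁺ sin>0 t>0 2π/3<π) (trans
      (solve 2 (λ s c → s :* s := (s :* s :+ c :* c) :- :1 :- (c :- :1) :* (c :+ :1)) refl s c)
      (trans (+-cong (gap₀ (sym s²+c²)) (-‿cong (*-congʳ e))) (solve 1 (λ c → :0 :- :0 :* (c :+ :1) := :0) refl c)))
    factored : (c - 1#) * ((ℕ→ℝ 2 * c + 1#) * (ℕ→ℝ 2 * c + 1#)) ≈ 0#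
    factored = trans (solve 1 (λ c → (c :- :1) :* ((:2 :* c :+ :1) :* (:2 :* c :+ :1)) := :4 :* (c :* c :* c) :- con (+ 3) :* c :- :1) refl c)
      (gap₀ (sym (trans (sym triple) cos-3t)))
    2c+1≈0 : ℕ→ℝ 2 * c + 1# ≈ 0#
    2c+1≈0 = square-zero (≤-reflexive (zero-product factored c≉1))

  cos-difference : ∀ x y → cos x - cos y ≈ ℕ→ℝ 2 * (sin (half (y + x)) * sin (half (y - x)))
  cos-difference x y = trans
    (+-cong (trans (cos-cong (sym m-d)) (cos-- m d)) (-‿cong (trans (cos-cong (sym m+d)) (cos-+ m d))))
    (solve 4 (λ cm cd sm sd → (cm :* cd :+ sm :* sd) :- (cm :* cd :- sm :* sd) := :2 :* (sm :* sd)) refl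
      (cos m) (cos d) (sin m) (sin d))
    where
    m = half (y + x)
    d = half (y - x)
    halve : ∀ {u v} → u + u ≈ v + v → u ≈ v
    halve {u} {v} e = cancel≈ 2≉0 (trans (solve 1 (λ u → :2 :* u := u :+ u) refl u) (trans e (solve 1 (λ u → u :+ u := :2 :* u) refl v)))
    m+d : m + d ≈ y
    m+d = halve (trans (solve 2 (λ m d → m :+ d :+ (m :+ d) := m :+ m :+ (d :+ d)) refl m d)
      (trans (+-cong (half-sum _) (half-sum _)) (solve 2 (λ x y → y :+ x :+ (y :- x) := y :+ y) refl x y)))
    m-d : m - d ≈ x
    m-d = halve (trans (solve 2 (λ m d → m :- d :+ (m :- d) := m :+ m :- (d :+ d)) refl m d)
      (trans (+-cong (half-sum _) (-‿cong (half-sum _))) (solve 2 (λ x y → y :+ x :- (y :- x) := x :+ x) refl x y)))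

  half<π : ∀ {x} → x < π + π → half x < π
  half<π {x} p = ≰⇒> λ r → <⇒≱ p (≤-respʳ (half-sum x) (+-mono r r))

  cos-decreasing< : ∀ {x y} → 0# ≤ x → x < y → y ≤ π → cos y < cos x
  cos-decreasing< {x} {y} x≥0 x<y y≤π = <-by (ℕ→ℝ>0 1 ⊠⁺ (sin>0 (half>0 (y>0 ⊞⁺ x≥0)) (half<π y+x<2π) ⊠⁺
      sin>0 (half>0 (gap⁺ x<y)) (half<π y-x<2π))) (sym (cos-difference x y))
    where
    y>0 : 0# < y
    y>0 = ≤-<-trans x≥0 x<y
    y+x<2π : y + x < π + π
    y+x<2π = <-by (gap⁺ x<y ⊞⁺ (gap y≤π ⊞ gap y≤π)) (solve 3 (λ x y p → (y :- x) :+ ((p :- y) :+ (p :- y)) := (p :+ p) :- (y :+ x)) refl x y π)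
    y-x<2π : y - x < π + π
    y-x<2π = <-by (π>0 ⊞⁺ (gap y≤π ⊞ x≥0)) (solve 3 (λ x y p → p :+ ((p :- y) :+ x) := (p :+ p) :- (y :- x)) refl x y π)

  cos-decreasing : ∀ {x y} → 0# ≤ x → x ≤ y → y ≤ π → cos y ≤ cos x
  cos-decreasing {x} {y} x≥0 x≤y y≤π = [ (λ y≤x → ≤-reflexive (cos-cong (≤-antisym y≤x x≤y))) ,
    (λ x<y → <⇒≤ (cos-decreasing< x≥0 x<y y≤π)) ]′ (≤-or-> y x)

  cos-reflects-≤ : ∀ {x y} → 0# ≤ y → x ≤ π → cos y ≤ cos x → x ≤ y
  cos-reflects-≤ y≥0 x≤π p = ≮⇒≥ λ y<x → <⇒≱ (cos-decreasing< y≥0 y<x x≤π) p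

  private
    -- Equal values give cos (y - x) = 1, hence sin² ((y - x) / 2) = 0, although 0 < (y - x) / 2 <
    -- π.
    angle-unique< : ∀ {x y} → - π < x → y ≤ π → x < y → cos x ≈ cos y → sin x ≈ sin y → ⊥
    angle-unique< {x} {y} -π<x y≤π x<y ec es = >⇒≉ (sin-d/2>0 ⊠⁺ sin-d/2>0)
      (zero-product {ℕ→ℝ 2} (trans
        (trans (solve 1 (λ z → z := :1 :- (:1 :- z)) refl _) (+-congˡ (-‿cong (trans (sym (cos-half d)) cos-d))))
        (-‿inverseʳ 1#)) 2≉0)
      where
      d = y - x
      cos-d : cos d ≈ 1#
      cos-d = trans (cos-- y x) (trans (+-cong (*-congˡ ec) (*-congˡ es)) (trans (+-comm _ _) (sin²+cos² y)))
      d<2π : d < π + π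
      d<2π = <-by (gap⁺ -π<x ⊞⁺ gap y≤π) (solve 3 (λ x y p → (x :- (:- p)) :+ (p :- y) := (p :+ p) :- (y :- x)) refl x y π)
      sin-d/2>0 : 0# < sin (half d)
      sin-d/2>0 = sin>0 (half>0 (gap⁺ x<y)) (half<π d<2π)

  angle-unique : ∀ {x y} → - π < x → x ≤ π → - π < y → y ≤ π → cos x ≈ cos y → sin x ≈ sin y → x ≈ y
  angle-unique x>-π x≤π y>-π y≤π ec es = ≤-antisym
    (≮⇒≥ λ y<x → angle-unique< y>-π x≤π y<x (sym ec) (sym es))
    (≮⇒≥ λ x<y → angle-unique< x>-π y≤π x<y ec es)

  -- As z has norm 1, θ itself meets the defining condition of `arg`, and `angle-unique` identifies
  -- it with the witness that was picked.
  arg-spec : ∀ {z θ} → - π < θ → θ ≤ π → z ≈ᶜ e^i θ → arg z ≈ θ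
  arg-spec {z} {θ} θ>-π θ≤π (er , ei) =
    let (a>-π , a≤π , (ar , ai)) = spec in
    angle-unique a>-π a≤π θ>-π θ≤π
      (trans (sym (proj₁ (polar (arg z)))) (trans (sym ar) er))
      (trans (sym (proj₂ (polar (arg z)))) (trans (sym ai) ei))
    where
    norm : ∥ z ∥ ≈ 1#
    norm = √-unique (<⇒≤ 0<1) (trans (*-identityˡ 1#) (sym (trans (+-cong (*-cong er er) (*-cong ei ei))
      (trans (+-comm _ _) (sin²+cos² θ)))))
    polar : ∀ φ → ℝ→ℂ ∥ z ∥ *ᶜ (e^i φ) ≈ᶜ e^i φ
    polar φ = trans (+-congʳ (*-congʳ norm)) (solve 2 (λ c s → :1 :* c :- :0 :* s := c) refl (cos φ) (sin φ)) ,
      trans (+-congʳ (*-congʳ norm)) (solve 2 (λ c s → :1 :* s :+ :0 :* c := s) refl (cos φ) (sin φ))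
    IsArg : Pred ℝ 0ℓ
    IsArg θ = - π < θ × θ ≤ π × z ≈ᶜ ℝ→ℂ ∥ z ∥ *ᶜ (e^i θ)
    spec : IsArg (arg z)
    spec = the-∈ {d = 0#} {IsArg} (θ , θ>-π , θ≤π ,
      (trans er (sym (proj₁ (polar θ))) , trans ei (sym (proj₂ (polar θ)))))

  -- Counting lattice points

  Point : Set
  Point = ℕ × ℕ

  lookup-injective : ∀ {A : Set} {xs : List A} → Unique xs → ∀ i j → lookup xs i ≡ lookup xs j → i ≡ j
  lookup-injective (_ AllPairs.∷ _)  Fin.zero    Fin.zero    _ = ≡.refl
  lookup-injective (x∉ AllPairs.∷ _) Fin.zero    (Fin.suc j) e = ⊥-elim (All.lookup x∉ (∈-lookup j) e)
  lookup-injective (x∉ AllPairs.∷ _) (Fin.suc i) Fin.zero    e = ⊥-elim (All.lookup x∉ (∈-lookup i) (≡.sym e))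
  lookup-injective (_ AllPairs.∷ u)  (Fin.suc i) (Fin.suc j) e = ≡.cong Fin.suc (lookup-injective u i j e)

  record Listing (P : Pred Point 0ℓ) : Set where
    field
      elements : List Point
      distinct : Unique elements
      sound    : ∀ {x} → x ∈ₗ elements → P x
      complete : ∀ {x} → P x → x ∈ₗ elements

    size : ℕ
    size = length elements

  open Listing public

  size-injective : ∀ {P Q} (p : Listing P) (q : Listing Q) (f : Point → Point) → (∀ {x} → P x → Q (f x)) →
                   (∀ {x y} → P x → P y → f x ≡ f y → x ≡ y) → size p ℕ.≤ size q
  size-injective {P} p q f maps inj = Finₚ.injective⇒≤ {f = g} λ {i} {j} e →
    lookup-injective (distinct p) i j (inj (lookup-P i) (lookup-P j) (index-injective (≡.setoid Point) (image i) (image j) e))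
    where
    lookup-P : ∀ i → P (lookup (elements p) i)
    lookup-P i = sound p (∈-lookup {xs = elements p} i)
    image : ∀ i → f (lookup (elements p) i) ∈ₗ elements q
    image i = complete q (maps (lookup-P i))
    g : Fin (size p) → Fin (size q)
    g i = index (image i)

  opaque
    -- Sets without a listing are counted as 0, so the `Listing` arguments in the lemmas below
    -- certify finiteness; by `count-size` it does not matter which listing is given.
    count : Pred Point 0ℓ → ℕ
    count P = the 0 λ n → ∃ λ (l : Listing P) → size l ≡ n

    count-size : ∀ {P} (l : Listing P) → count P ≡ size l
    count-size {P} l =
      let (l′ , e) = the-∈ {d = 0} {λ n → ∃ λ (l : Listing P) → size l ≡ n} (size l , l , ≡.refl) in
      ≡.trans (≡.sym e) (ℕₚ.≤-antisym (size-injective l′ l (λ x → x) (λ p → p) (λ _ _ e → e))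
                                      (size-injective l l′ (λ x → x) (λ p → p) (λ _ _ e → e)))

  count-injective : ∀ {P Q} → Listing P → Listing Q → (f : Point → Point) → (∀ {x} → P x → Q (f x)) →
                    (∀ {x y} → P x → P y → f x ≡ f y → x ≡ y) → count P ℕ.≤ count Q
  count-injective p q f maps inj = ≡.subst₂ ℕ._≤_ (≡.sym (count-size p)) (≡.sym (count-size q)) (size-injective p q f maps inj)

  count-⊆ : ∀ {P Q} → Listing P → Listing Q → (∀ {x} → P x → Q x) → count P ℕ.≤ count Q
  count-⊆ p q h = count-injective p q (λ x → x) h (λ _ _ e → e)

  count-≐ : ∀ {P Q} → Listing P → Listing Q → (∀ {x} → P x → Q x) → (∀ {x} → Q x → P x) → count P ≡ count Q
  count-≐ p q h k = ℕₚ.≤-antisym (count-⊆ p q h) (count-⊆ q p k)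

  listing-⊆ : ∀ {P Q : Pred Point 0ℓ} → Listing Q → (∀ {x} → P x → Q x) → Listing P
  listing-⊆ {P} q h = record
    { elements = filter P? (elements q)
    ; distinct = Uniqueₚ.filter⁺ P? (distinct q)
    ; sound = λ x∈ → proj₂ (∈-filter⁻ P? {xs = elements q} x∈)
    ; complete = λ p → ∈-filter⁺ P? (complete q (h p)) p }
    where
    P? : ∀ x → Dec (P x)
    P? x = decide (P x)

  listing-bounded : ∀ {P : Pred Point 0ℓ} N → (∀ {a b} → P (a , b) → a ℕ.< N × b ℕ.< N) → Listing P
  listing-bounded N h = listing-⊆ box λ {x} p → h {proj₁ x} {proj₂ x} p
    where
    box : Listing (λ x → proj₁ x ℕ.< N × proj₂ x ℕ.< N)
    box = record
      { elements = cartesianProduct (upTo N) (upTo N)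
      ; distinct = Uniqueₚ.cartesianProduct⁺ (Uniqueₚ.upTo⁺ N) (Uniqueₚ.upTo⁺ N)
      ; sound = λ x∈ → let (p , q) = ∈-cartesianProduct⁻ (upTo N) (upTo N) x∈ in ∈-upTo⁻ p , ∈-upTo⁻ q
      ; complete = λ (p , q) → ∈-cartesianProduct⁺ (∈-upTo⁺ p) (∈-upTo⁺ q) }

  listing-⊎ : ∀ {P Q : Pred Point 0ℓ} → Listing P → Listing Q → (∀ {x} → P x → ¬ Q x) → Listing (λ x → P x ⊎ Q x)
  listing-⊎ p q disjoint = record
    { elements = elements p ++ elements q
    ; distinct = Uniqueₚ.++⁺ (distinct p) (distinct q) λ (x∈p , x∈q) → disjoint (sound p x∈p) (sound q x∈q)
    ; sound = λ x∈ → [ (λ r → inj₁ (sound p r)) , (λ r → inj₂ (sound q r)) ]′ (∈-++⁻ (elements p) x∈)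
    ; complete = [ (λ r → ∈-++⁺ˡ (complete p r)) , (λ r → ∈-++⁺ʳ (elements p) (complete q r)) ]′ }

  count-split : ∀ {P Q R : Pred Point 0ℓ} → Listing P → (∀ {x} → Q x → P x) → (∀ {x} → R x → P x) →
                (∀ {x} → P x → Q x ⊎ R x) → (∀ {x} → Q x → ¬ R x) → count P ≡ count Q ℕ.+ count R
  count-split p Q⊆P R⊆P P⊆ disjoint = ≡.trans (count-≐ p u P⊆ [ Q⊆P , R⊆P ]′)
    (≡.trans (count-size u) (≡.trans (length-++ (elements q)) (≡.cong₂ ℕ._+_ (≡.sym (count-size q)) (≡.sym (count-size r)))))
    where
    q = listing-⊆ p Q⊆P
    r = listing-⊆ p R⊆P
    u = listing-⊎ q r disjoint

  count-empty : ∀ {P : Pred Point 0ℓ} → (∀ {x} → ¬ P x) → count P ≡ 0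
  count-empty {P} h = count-size empty
    where
    empty : Listing P
    empty = record { elements = [] ; distinct = AllPairs.[] ; sound = λ () ; complete = λ p → ⊥-elim (h p) }

  count-row : ∀ a n → count (λ x → proj₁ x ≡ a × proj₂ x ℕ.< n) ≡ n
  count-row a n = ≡.trans (count-size row) (≡.trans (length-map (a ,_) (upTo n)) (length-upTo n))
    where
    row : Listing (λ x → proj₁ x ≡ a × proj₂ x ℕ.< n)
    row = record
      { elements = map (a ,_) (upTo n)
      ; distinct = Uniqueₚ.map⁺ (≡.cong proj₂) (Uniqueₚ.upTo⁺ n)
      ; sound = λ x∈ → let (b , b∈ , e) = ∈-map⁻ (a ,_) x∈ in ≡.cong proj₁ e , ≡.subst (ℕ._< n) (≡.sym (≡.cong proj₂ e)) (∈-upTo⁻ b∈)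
      ; complete = λ { (≡.refl , b<n) → ∈-map⁺ (a ,_) (∈-upTo⁺ b<n) } }

  -- Lattice points in sectors

  last-true : ∀ (Q : ℕ → Set) N → Q 0 → ¬ Q N → ∃[ n ] (Q n × ¬ Q (suc n))
  last-true Q zero    q₀ ¬q = ⊥-elim (¬q q₀)
  last-true Q (suc N) q₀ ¬q = case (decide (Q N))
    where
    case : Dec (Q N) → ∃[ n ] (Q n × ¬ Q (suc n))
    case (yes q) = N , q , ¬q
    case (no ¬q′) = last-true Q N q₀ ¬q′

  opaque
    ceiling : ∀ {x} → 0# ≤ x → ∃[ n ] (x ≤ ℕ→ℝ n × ℕ→ℝ n < x + 1#)
    ceiling {x} x≥0 = [ (λ x≤0 → 0 , x≤0 , <-≤-trans 0<1 (≤-by x≥0 (solve 1 (λ x → x := x :+ :1 :- :1) refl x))) , positive ]′ (≤-or-> x 0#)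
      where
      positive : 0# < x → ∃[ n ] (x ≤ ℕ→ℝ n × ℕ→ℝ n < x + 1#)
      positive x>0 =
        let (N , x≤N) = archimedean x
            (n , n<x , ≮) = last-true (λ n → ℕ→ℝ n < x) N x>0 (λ N<x → <⇒≱ N<x x≤N)
        in suc n , ≮⇒≥ ≮ , <-by (gap⁺ n<x) (solve 2 (λ n x → x :- n := x :+ :1 :- (:1 :+ n)) refl (ℕ→ℝ n) x)

  opaque
    integer-sqrt : ∀ {z} → 0# ≤ z → ∃[ m ] (ℕ→ℝ m * ℕ→ℝ m ≤ z × z < ℕ→ℝ (suc m) * ℕ→ℝ (suc m))
    integer-sqrt {z} z≥0 =
      let (N , z≤N) = archimedean z
          (m , p , q) = last-true (λ m → ℕ→ℝ m * ℕ→ℝ m ≤ z) (suc N) (≤-respˡ (sym (zeroˡ _)) z≥0)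
            (λ r → <⇒≱ (<-≤-trans (≤-<-trans z≤N (<-by (0<1 ⊞⁺ (ℕ→ℝ≥0 N ⊞ ℕ→ℝ≥0 N ⊠ ℕ→ℝ≥0 N))
              (solve 1 (λ n → :1 :+ (n :+ n :* n) := (:1 :+ n) :* (:1 :+ n) :- n) refl (ℕ→ℝ N)))) r) ≤-refl)
      in m , p , ≰⇒> q

  ℕ→ℝ-mono<⁻ : ∀ {m n} → ℕ→ℝ m < ℕ→ℝ n → m ℕ.< n
  ℕ→ℝ-mono<⁻ p = ℕₚ.≰⇒> λ q → <⇒≱ p (ℕ→ℝ-mono q)

  Row : ℕ → ℝ → ℝ → Pred Point 0ℓ
  Row a x y p = proj₁ p ≡ a × x ≤ ℕ→ℝ (proj₂ p) × ℕ→ℝ (proj₂ p) < y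

  -- The integers b with x ≤ b < y are those below y without those below x, so there are ⌈y⌉ - ⌈x⌉
  -- of them; each ceiling overshoots by at least 0 and less than 1.
  row-count : ∀ a {x y} → 0# ≤ x → x ≤ y → ℕ→ℝ (count (Row a x y)) - (y - x) ∈± 1#
  row-count a {x} {y} x≥0 x≤y =
    ≤-by (gap y≤n ⊞ gap (<⇒≤ m<x+1)) (trans
      (solve 4 (λ m n x y → (n :- y) :+ (x :+ :1 :- m) := n :- m :- (y :- x) :- (:- :1)) refl (ℕ→ℝ m) (ℕ→ℝ n) x y)
      (+-congʳ (+-congʳ (sym difference)))) ,
    ≤-by (gap (<⇒≤ n<y+1) ⊞ gap x≤m) (trans
      (solve 4 (λ m n x y → (y :+ :1 :- n) :+ (m :- x) := :1 :- (n :- m :- (y :- x))) refl (ℕ→ℝ m) (ℕ→ℝ n) x y)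
      (+-congˡ (-‿cong (+-congʳ (sym difference)))))
    where
    cx = ceiling x≥0
    cy = ceiling (≤-trans x≥0 x≤y)
    m = proj₁ cx
    n = proj₁ cy
    x≤m = proj₁ (proj₂ cx)
    m<x+1 = proj₂ (proj₂ cx)
    y≤n = proj₁ (proj₂ cy)
    n<y+1 = proj₂ (proj₂ cy)
    below : ∀ {b n x} → x ≤ ℕ→ℝ n → ℕ→ℝ b < x → b ℕ.< n
    below p q = ℕ→ℝ-mono<⁻ (<-≤-trans q p)
    -- Here b + 1 ≤ n < x + 1; the ceiling must overshoot by strictly less than 1.
    below⁻ : ∀ {b n x} → ℕ→ℝ n < x + 1# → b ℕ.< n → ℕ→ℝ b < x
    below⁻ {b} {n} {x} p q = <-by (gap⁺ (≤-<-trans (ℕ→ℝ-mono q) p))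
      (solve 2 (λ b x → x :+ :1 :- (:1 :+ b) := x :- b) refl (ℕ→ℝ b) x)
    split : n ≡ m ℕ.+ count (Row a x y)
    split = ≡.trans (≡.sym (count-row a n)) (≡.trans
      (count-split {Q = λ p → proj₁ p ≡ a × proj₂ p ℕ.< m} {R = Row a x y}
        (listing-bounded (suc a ℕ.+ n) λ { (≡.refl , b<n) → ℕ.s≤s (ℕₚ.m≤m+n a n) , ℕₚ.<-≤-trans b<n (ℕₚ.m≤n+m n (suc a)) })
        (λ (e , b<m) → e , below y≤n (<-≤-trans (below⁻ m<x+1 b<m) x≤y))
        (λ (e , _ , b<y) → e , below y≤n b<y)
        (λ {p} (e , b<n) → [ (λ x≤b → inj₂ (e , x≤b , below⁻ n<y+1 b<n)) , (λ b<x → inj₁ (e , below x≤m b<x)) ]′ (≤-or-> x (ℕ→ℝ (proj₂ p))))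
        (λ (_ , b<m) (_ , x≤b , _) → <⇒≱ (below⁻ m<x+1 b<m) x≤b))
      (≡.cong (ℕ._+ count (Row a x y)) (count-row a m)))
    difference : ℕ→ℝ (count (Row a x y)) ≈ ℕ→ℝ n - ℕ→ℝ m
    difference = trans (solve 2 (λ c m → c := m :+ c :- m) refl (ℕ→ℝ (count (Row a x y))) (ℕ→ℝ m))
      (+-congʳ (trans (sym (ℕ→ℝ-+ m _)) (≡→≈ (≡.cong ℕ→ℝ (≡.sym split)))))

  -- Slope conditions cleared of denominators. Half-open sectors are disjoint when adjacent, which
  -- makes counts additive; the closed ones match the intervals of the theorem.
  HalfOpen Closed : ℝ → ℝ → Pred Point 0ℓ
  HalfOpen u v (a , b) = ℕ→ℝ a * u ≤ ℕ→ℝ b × ℕ→ℝ b < ℕ→ℝ a * v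
  Closed   u v (a , b) = ℕ→ℝ a * u ≤ ℕ→ℝ b × ℕ→ℝ b ≤ ℕ→ℝ a * v

  Triangle : ℕ → ℝ → ℝ → Pred Point 0ℓ
  Triangle M u v p = 1 ℕ.≤ proj₁ p × proj₁ p ℕ.≤ M × HalfOpen u v p

  triangle-listing : ∀ M {u v} → 0# ≤ v → Listing (Triangle M u v)
  triangle-listing M {u} {v} v≥0 =
    let (K , Mv≤K) = archimedean (ℕ→ℝ M * v) in
    listing-bounded (suc M ℕ.+ K) λ (_ , a≤M , _ , b<) →
      ℕ.s≤s (ℕₚ.≤-trans a≤M (ℕₚ.m≤m+n M K)) ,
      ℕₚ.<-≤-trans (ℕ→ℝ-mono<⁻ (<-≤-trans b< (≤-trans (*-monoʳ v≥0 (ℕ→ℝ-mono a≤M)) Mv≤K))) (ℕₚ.m≤n+m K (suc M))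

  -- The row a has length a (v - u) and is counted with error at most 1. Summing over a = 1, ..., M
  -- gives (v - u) M (M + 1) / 2 with error M; everything is doubled to clear the denominator.
  triangle-count : ∀ M {u v} → 0# ≤ u → u ≤ v →
                   ℕ→ℝ 2 * ℕ→ℝ (count (Triangle M u v)) - (v - u) * (ℕ→ℝ M * (ℕ→ℝ M + 1#)) ∈± ℕ→ℝ 2 * ℕ→ℝ M
  triangle-count zero {u} {v} u≥0 u≤v = ±-resp
    (trans (solve 2 (λ u v → :0 := :2 :* :0 :- (v :- u) :* (:0 :* (:0 :+ :1))) refl u v)
      (+-congʳ (*-congˡ (≡→≈ (≡.cong ℕ→ℝ (≡.sym (count-empty λ {x} → none {x})))))))
    (sym (zeroʳ _)) (±-0 ≤-refl)
    where
    none : ∀ {x} → ¬ Triangle 0 u v x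
    none (1≤a , a≤0 , _) = ℕₚ.n≮0 (ℕₚ.≤-trans 1≤a a≤0)
  triangle-count (suc M) {u} {v} u≥0 u≤v = ±-resp
    (trans (solve 5 (λ c r m u v → (:2 :* c :- (v :- u) :* (m :* (m :+ :1))) :+ :2 :* (r :- ((:1 :+ m) :* v :- (:1 :+ m) :* u))
                  := :2 :* (c :+ r) :- (v :- u) :* ((:1 :+ m) :* ((:1 :+ m) :+ :1))) refl
        (ℕ→ℝ (count (Triangle M u v))) (ℕ→ℝ (count row)) (ℕ→ℝ M) u v)
      (+-congʳ (*-congˡ (trans (sym (ℕ→ℝ-+ (count (Triangle M u v)) (count row))) (≡→≈ (≡.cong ℕ→ℝ (≡.sym split)))))))
    (solve 1 (λ m → :2 :* m :+ :2 :* :1 := :2 :* (:1 :+ m)) refl (ℕ→ℝ M))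
    (±-+ (triangle-count M u≥0 u≤v) (±-scale (ℕ→ℝ≥0 2)
      (row-count (suc M) (ℕ→ℝ≥0 (suc M) ⊠ u≥0) (*-monoˡ (ℕ→ℝ≥0 (suc M)) u≤v))))
    where
    row = Row (suc M) (ℕ→ℝ (suc M) * u) (ℕ→ℝ (suc M) * v)
    split : count (Triangle (suc M) u v) ≡ count (Triangle M u v) ℕ.+ count row
    split = count-split (triangle-listing (suc M) (≤-trans u≥0 u≤v))
      (λ (1≤a , a≤M , h) → 1≤a , ℕₚ.m≤n⇒m≤1+n a≤M , h)
      (λ { (≡.refl , h) → ℕ.s≤s ℕ.z≤n , ℕₚ.≤-refl , h })
      (λ { {a , b} (1≤a , a≤ , h) → [ (λ a<sM → inj₁ (1≤a , ℕₚ.≤-pred a<sM , h)) , (λ { ≡.refl → inj₂ (≡.refl , h) }) ]′ (ℕₚ.m≤n⇒m<n∨m≡n a≤) })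
      (λ { (_ , a≤M , _) (≡.refl , _) → ℕₚ.<-irrefl ≡.refl a≤M })

  -- f(n) = o(n)
  Negligible : (ℕ → ℝ) → Set
  Negligible f = ∀ ε → 0# < ε → ∃[ C ] (∀ n → f n ∈± ε * ℕ→ℝ n + C)

  Negligible-+ : ∀ {f g} → Negligible f → Negligible g → Negligible (λ n → f n + g n)
  Negligible-+ {f} {g} p q ε ε>0 =
    let (C₁ , h₁) = p (half ε) (half>0 ε>0) ; (C₂ , h₂) = q (half ε) (half>0 ε>0) in
    C₁ + C₂ , λ n → ±-respʳ (trans (solve 4 (λ e n c d → e :* n :+ c :+ (e :* n :+ d) := (e :+ e) :* n :+ (c :+ d)) refl (half ε) (ℕ→ℝ n) C₁ C₂)
      (+-congʳ (*-congʳ (half-sum ε)))) (±-+ (h₁ n) (h₂ n))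

  Negligible-cong : ∀ {f g} → (∀ n → f n ≈ g n) → Negligible f → Negligible g
  Negligible-cong e p ε ε>0 = let (C , h) = p ε ε>0 in C , λ n → ±-respˡ (e n) (h n)

  Negligible-scale : ∀ {f} c → Negligible f → Negligible (λ n → c * f n)
  Negligible-scale {f} c p ε ε>0 =
    let k>0 : 0# < ∣ c ∣ + 1#
        k>0 = +1>0 (abs≥0 c)
        (C , h) = p (ε / (∣ c ∣ + 1#)) (ε>0 ⊠⁺ inv>0 k>0)
    in (∣ c ∣ + 1#) * C , λ n → ±-respʳ
      (trans (solve 4 (λ k d n c → k :* (d :* n :+ c) := d :* k :* n :+ k :* c) refl (∣ c ∣ + 1#) (ε / (∣ c ∣ + 1#)) (ℕ→ℝ n) C)
        (+-congʳ (*-congʳ (/-cancel (>⇒≉ k>0)))))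
      (±-* (±-≤ (≤-+1 ∣ c ∣) (±-abs c)) (h n))

  -- k m ≤ η m² + k²/η, because (2ηm - k)² + 3k² ≥ 0.
  linear≤quadratic : ∀ {η} k m → 0# < η → k * m ≤ η * (m * m) + k * k / η
  linear≤quadratic {η} k m η>0 = cancel≤ (ℕ→ℝ>0 3 ⊠⁺ η>0) (≤-by (sq≥0 (ℕ→ℝ 2 * η * m - k) ⊞ ℕ→ℝ≥0 3 ⊠ sq≥0 k)
    (trans (solve 3 (λ e k m → (:2 :* e :* m :- k) :* (:2 :* e :* m :- k) :+ con (+ 3) :* (k :* k)
                := :4 :* e :* (e :* (m :* m)) :+ :4 :* (k :* k) :- :4 :* e :* (k :* m)) refl η k m)
      (trans (+-congʳ (+-congˡ (*-congˡ (sym (/-cancel (>⇒≉ η>0))))))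
        (solve 4 (λ e k m q → :4 :* e :* (e :* (m :* m)) :+ :4 :* (q :* e) :- :4 :* e :* (k :* m)
                := :4 :* e :* (e :* (m :* m) :+ q) :- :4 :* e :* (k :* m)) refl η k m (k * k / η)))))

  -- Forms of degree two on a range of slopes

  Region : (ℕ → ℕ → ℕ) → Pred Point 0ℓ → ℕ → Pred Point 0ℓ
  Region D Z n p = 1 ℕ.≤ proj₁ p × Z p × D (proj₁ p) (proj₂ p) ℕ.≤ n

  -- A form D of degree 2 with D(a, b) = a² q(b/a) for slopes b/a ∈ [s, t], together with a
  -- primitive L of 1/q; lo and hi bound q on a slope interval.
  record Form (s t : ℝ) : Set where
    field
      D           : ℕ → ℕ → ℕ
      homogeneous : ∀ g a b → D (g ℕ.* a) (g ℕ.* b) ≡ g ℕ.* g ℕ.* D a b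
      L           : ℝ → ℝ
      lo hi       : ℝ → ℝ → ℝ
      c K         : ℝ
      s≥0         : 0# ≤ s
      c>0         : 0# < c
      K≥0         : 0# ≤ K
      c≤lo        : ∀ {u v} → s ≤ u → u ≤ v → v ≤ t → c ≤ lo u v
      lo≤hi       : ∀ {u v} → s ≤ u → u ≤ v → v ≤ t → lo u v ≤ hi u v
      hi-lo       : ∀ {u v} → s ≤ u → u ≤ v → v ≤ t → hi u v - lo u v ≤ K * (v - u)
      D-lo        : ∀ {u v} → s ≤ u → u ≤ v → v ≤ t → ∀ {a b} → Closed u v (a , b) → lo u v * (ℕ→ℝ a * ℕ→ℝ a) ≤ ℕ→ℝ (D a b)
      D-hi        : ∀ {u v} → s ≤ u → u ≤ v → v ≤ t → ∀ {a b} → Closed u v (a , b) → ℕ→ℝ (D a b) ≤ hi u v * (ℕ→ℝ a * ℕ→ℝ a)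
      L-lo        : ∀ {u v} → s ≤ u → u ≤ v → v ≤ t → (v - u) / hi u v ≤ L v - L u
      L-hi        : ∀ {u v} → s ≤ u → u ≤ v → v ≤ t → L v - L u ≤ (v - u) / lo u v

  module Sectors {s t : ℝ} (F : Form s t) where
    open Form F

    lo>0 : ∀ {u v} → s ≤ u → u ≤ v → v ≤ t → 0# < lo u v
    lo>0 p q r = <-≤-trans c>0 (c≤lo p q r)

    L-cong : ∀ {u v} → s ≤ u → v ≤ t → u ≈ v → L u ≈ L v
    L-cong {u} {v} p r e = ≈-by {t = L v - L u} (≤-antisym
        (≤-respʳ (vanish _) (L-hi p (≤-reflexive e) r)) (≤-respˡ (vanish _) (L-lo p (≤-reflexive e) r))) refl
      where
      vanish : ∀ z → (v - u) * z ≈ 0#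
      vanish z = trans (*-congʳ (gap₀ e)) (zeroˡ z)

    closed-weaken : ∀ {u v u′ v′} p → u′ ≤ u → v ≤ v′ → Closed u v p → Closed u′ v′ p
    closed-weaken (a , b) p q (h , k) = ≤-trans (*-monoˡ (ℕ→ℝ≥0 a) p) h , ≤-trans k (*-monoˡ (ℕ→ℝ≥0 a) q)

    half-open⇒closed : ∀ {u v} p → HalfOpen u v p → Closed u v p
    half-open⇒closed _ (h , k) = h , <⇒≤ k

    a²≤ : ∀ {n a b} → s ≤ t → Region D (Closed s t) n (a , b) → c * (ℕ→ℝ a * ℕ→ℝ a) ≤ ℕ→ℝ n
    a²≤ {a = a} s≤t (_ , Z , D≤n) = ≤-trans (*-monoʳ (sq≥0 (ℕ→ℝ a)) (c≤lo ≤-refl s≤t ≤-refl))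
      (≤-trans (D-lo ≤-refl s≤t ≤-refl Z) (ℕ→ℝ-mono D≤n))

    -- εc a² ≤ εn turns into a bound on a itself.
    a-bound : ∀ {ε} → 0# < ε → ∀ {n a b} → s ≤ t → Region D (Closed s t) n (a , b) →
              ℕ→ℝ a ≤ ε * ℕ→ℝ n + 1# * 1# / (ε * c)
    a-bound {ε} ε>0 {n} {a} s≤t r = ≤-respˡ (*-identityˡ _) (≤-trans (linear≤quadratic 1# (ℕ→ℝ a) (ε>0 ⊠⁺ c>0))
      (+-mono-≤ _ (≤-respˡ (sym (*-assoc ε c _)) (*-monoˡ (<⇒≤ ε>0) (a²≤ s≤t r)))))

    region-listing : s ≤ t → ∀ n → Listing (Region D (Closed s t) n)
    region-listing s≤t n =
      let (A , A≥) = archimedean (1# * ℕ→ℝ n + 1# * 1# / (1# * c))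
          (B , B≥) = archimedean (ℕ→ℝ A * t)
      in listing-bounded (suc A ℕ.+ suc B) λ {a} {b} r@(_ , (_ , b≤) , _) →
        let a≤A = ≤-trans (a-bound 0<1 s≤t r) A≥ in
        ℕ.s≤s (ℕₚ.≤-trans (ℕ→ℝ-mono⁻ a≤A) (ℕₚ.m≤m+n A (suc B))) ,
        ℕₚ.≤-trans (ℕ.s≤s (ℕ→ℝ-mono⁻ (≤-trans b≤ (≤-trans (*-monoʳ (≤-trans s≥0 s≤t) a≤A) B≥)))) (ℕₚ.m≤n+m (suc B) (suc A))

    region-sub : s ≤ t → ∀ n {Z : Pred Point 0ℓ} → (∀ {x} → Z x → Closed s t x) → Listing (Region D Z n)
    region-sub s≤t n h = listing-⊆ (region-listing s≤t n) λ (p , z , q) → p , h z , q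

    -- Controls the oscillation of 1/q: on [u, v] the difference 1/lo - 1/hi = (hi - lo) / (lo hi)
    -- is at most K (v - u) / c².
    K′ : ℝ
    K′ = K * (c ⁻¹ * c ⁻¹)

    -- In slope coordinates the region has area ½ ∫ n / q(s) ds = (L v - L u) n / 2, whence the
    -- doubling.
    excess : ℝ → ℝ → ℕ → ℝ
    excess u v n = ℕ→ℝ 2 * ℕ→ℝ (count (Region D (HalfOpen u v) n)) - (L v - L u) * ℕ→ℝ n

    -- The region lies between the triangles a ≤ √(n / hi) and a ≤ √(n / lo).
    narrow-sector : ∀ {u v} → s ≤ u → u ≤ v → v ≤ t → ∀ ε → 0# < ε →
                    ∃[ C ] (∀ n → excess u v n ∈± (K′ * ((v - u) * (v - u)) + ε) * ℕ→ℝ n + C)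
    narrow-sector {u} {v} s≤u u≤v v≤t ε ε>0 = C , λ n → lower-bound n , upper-bound n
      where
      s≤t = ≤-trans s≤u (≤-trans u≤v v≤t)
      u≥0 = ≤-trans s≥0 s≤u
      w = v - u
      w≥0 = gap u≤v
      κ = L v - L u
      l = lo u v
      h = hi u v
      l>0 = lo>0 s≤u u≤v v≤t
      h>0 = <-≤-trans l>0 (lo≤hi s≤u u≤v v≤t)
      i = l ⁻¹
      j = h ⁻¹
      i≥0 = <⇒≤ (inv>0 l>0)
      j≥0 = <⇒≤ (inv>0 h>0)
      li≈1 : l * i ≈ 1#
      li≈1 = inv-right (>⇒≉ l>0)
      hj≈1 : h * j ≈ 1#
      hj≈1 = inv-right (>⇒≉ h>0)
      -- The linear errors are w m, from m (m + 1) against m², and 2m from `triangle-count`. The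
      -- extra w in C pays for the constant term of (m + 1)² in the lower bound.
      k = w + ℕ→ℝ 2
      C = k * k / (ε * c) + w
      ci≤1 : c * i ≤ 1#
      ci≤1 = ≤-respʳ li≈1 (*-monoʳ i≥0 (c≤lo s≤u u≤v v≤t))
      i≤c⁻¹ : i ≤ c ⁻¹
      i≤c⁻¹ = inv-anti c>0 (c≤lo s≤u u≤v v≤t)
      j≤i : j ≤ i
      j≤i = inv-anti l>0 (lo≤hi s≤u u≤v v≤t)
      i-j : w * i - w * j ≤ K′ * (w * w)
      i-j = ≤-resp
        (trans (solve 5 (λ w h l i j → w :* ((h :- l) :* (i :* j)) := w :* (i :* (h :* j)) :- w :* (j :* (l :* i))) refl w h l i j)
          (+-cong (*-congˡ (trans (*-congˡ hj≈1) (*-identityʳ i))) (-‿cong (*-congˡ (trans (*-congˡ li≈1) (*-identityʳ j))))))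
        (solve 3 (λ w K c → w :* ((K :* w) :* c) := K :* c :* (w :* w)) refl w K (c ⁻¹ * c ⁻¹))
        (*-monoˡ w≥0 (*-mono (gap (lo≤hi s≤u u≤v v≤t)) (i≥0 ⊠ j≥0) (hi-lo s≤u u≤v v≤t)
          (*-mono i≥0 j≥0 i≤c⁻¹ (≤-trans j≤i i≤c⁻¹))))
      small : ∀ n m → ℕ→ℝ m * ℕ→ℝ m ≤ ℕ→ℝ n * i → k * ℕ→ℝ m ≤ ε * ℕ→ℝ n + k * k / (ε * c)
      small n m m²≤ = ≤-trans (linear≤quadratic k (ℕ→ℝ m) (ε>0 ⊠⁺ c>0)) (+-mono-≤ _
        (≤-respˡ (sym (*-assoc ε c _)) (*-monoˡ (<⇒≤ ε>0) (≤-trans (*-monoˡ (<⇒≤ c>0) m²≤)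
          (≤-by (ℕ→ℝ≥0 n ⊠ gap ci≤1) (solve 3 (λ n c i → n :* (:1 :- c :* i) := n :- c :* (n :* i)) refl (ℕ→ℝ n) c i))))))
      module _ (n : ℕ) where
        N = ℕ→ℝ n
        N≥0 = ℕ→ℝ≥0 n
        outer = integer-sqrt (N≥0 ⊠ i≥0)
        inner = integer-sqrt (N≥0 ⊠ j≥0)
        M = proj₁ outer
        M′ = proj₁ inner
        listing : Listing (Region D (HalfOpen u v) n)
        listing = region-sub s≤t n λ {x} z → closed-weaken x s≤u v≤t (half-open⇒closed x z)
        ρ = ℕ→ℝ (count (Region D (HalfOpen u v) n))
        R≤ : ρ ≤ ℕ→ℝ (count (Triangle M u v))
        R≤ = ℕ→ℝ-mono (count-⊆ listing (triangle-listing M (≤-trans u≥0 u≤v)) λ { {a , b} (1≤a , z , D≤n) → 1≤a ,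
          sqrt-bound (≤-respʳ (*-comm i N) (≤-respˡ (trans (sym (*-assoc i l _)) (trans (*-congʳ (trans (*-comm i l) li≈1)) (*-identityˡ _)))
            (*-monoˡ i≥0 (≤-trans (D-lo s≤u u≤v v≤t (half-open⇒closed (a , b) z)) (ℕ→ℝ-mono D≤n))))) , z })
          where
          sqrt-bound : ∀ {a} → ℕ→ℝ a * ℕ→ℝ a ≤ N * i → a ℕ.≤ M
          sqrt-bound {a} a²≤ = ℕₚ.≮⇒≥ λ M<a → <⇒≱ (proj₂ (proj₂ outer))
            (≤-trans (*-mono (ℕ→ℝ≥0 (suc M)) (ℕ→ℝ≥0 (suc M)) (ℕ→ℝ-mono M<a) (ℕ→ℝ-mono M<a)) a²≤)
        R≥ : ℕ→ℝ (count (Triangle M′ u v)) ≤ ρ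
        R≥ = ℕ→ℝ-mono (count-⊆ (triangle-listing M′ (≤-trans u≥0 u≤v)) listing λ { {a , b} (1≤a , a≤M′ , z) → 1≤a , z ,
          ℕ→ℝ-mono⁻ (≤-trans (D-hi s≤u u≤v v≤t (half-open⇒closed (a , b) z)) (≤-trans (*-monoˡ (<⇒≤ h>0)
            (≤-trans (*-mono (ℕ→ℝ≥0 a) (ℕ→ℝ≥0 a) (ℕ→ℝ-mono a≤M′) (ℕ→ℝ-mono a≤M′)) (proj₁ (proj₂ inner))))
            (≤-reflexive (trans (solve 3 (λ h n j → h :* (n :* j) := n :* (h :* j)) refl h N j) (trans (*-congˡ hj≈1) (*-identityʳ N)))))) })
        upper-bound : excess u v n ≤ (K′ * (w * w) + ε) * N + C
        upper-bound = ≤-by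
          (ℕ→ℝ≥0 2 ⊠ gap R≤ ⊞ gap (upper (triangle-count M u≥0 u≤v)) ⊞ w≥0 ⊠ gap (proj₁ (proj₂ outer)) ⊞ gap (small n M (proj₁ (proj₂ outer)))
            ⊞ w≥0 ⊞ gap i-j ⊠ N≥0 ⊞ gap (L-lo s≤u u≤v v≤t) ⊠ N≥0)
          (solve 11 (λ T r w m n i j q e K κ → :2 :* (T :- r) :+ (:2 :* m :- (:2 :* T :- w :* (m :* (m :+ :1)))) :+ w :* (n :* i :- m :* m)
               :+ (e :* n :+ q :- (w :+ :2) :* m) :+ w :+ (K :- (w :* i :- w :* j)) :* n :+ (κ :- w :* j) :* n
               := (K :+ e) :* n :+ (q :+ w) :- (:2 :* r :- κ :* n)) refl
            (ℕ→ℝ (count (Triangle M u v))) ρ w (ℕ→ℝ M) N i j (k * k / (ε * c)) ε (K′ * (w * w)) κ)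
        lower-bound : - ((K′ * (w * w) + ε) * N + C) ≤ excess u v n
        lower-bound = ≤-by
          (ℕ→ℝ≥0 2 ⊠ gap R≥ ⊞ gap (lower (triangle-count M′ u≥0 u≤v)) ⊞ w≥0 ⊠ gap (<⇒≤ (proj₂ (proj₂ inner)))
            ⊞ gap (small n M′ (≤-trans (proj₁ (proj₂ inner)) (*-monoˡ N≥0 j≤i)))
            ⊞ gap i-j ⊠ N≥0 ⊞ gap (L-hi s≤u u≤v v≤t) ⊠ N≥0)
          (solve 11 (λ T r w m n i j q e K κ → :2 :* (r :- T) :+ (:2 :* T :- w :* (m :* (m :+ :1)) :- (:- (:2 :* m)))
               :+ w :* ((:1 :+ m) :* (:1 :+ m) :- n :* j) :+ (e :* n :+ q :- (w :+ :2) :* m)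
               :+ (K :- (w :* i :- w :* j)) :* n :+ (w :* i :- κ) :* n
               := :2 :* r :- κ :* n :- (:- ((K :+ e) :* n :+ (q :+ w)))) refl
            (ℕ→ℝ (count (Triangle M′ u v))) ρ w (ℕ→ℝ M′) N i j (k * k / (ε * c)) ε (K′ * (w * w)) κ)

  module _ {s t : ℝ} (F : Form s t) where
    open Form F
    open Sectors F

    opaque
      excess-+ : ∀ {u v w} → s ≤ u → u ≤ v → v ≤ w → w ≤ t → ∀ n → excess u w n ≈ excess u v n + excess v w n
      excess-+ {u} {v} {w} s≤u u≤v v≤w w≤t n = trans
        (+-congʳ (*-congˡ (trans (≡→≈ (≡.cong ℕ→ℝ split)) (ℕ→ℝ-+ (count (part u v)) (count (part v w))))))
        (solve 6 (λ x y a b c n → :2 :* (x :+ y) :- (c :- a) :* n := :2 :* x :- (b :- a) :* n :+ (:2 :* y :- (c :- b) :* n)) refl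
          (ℕ→ℝ (count (part u v))) (ℕ→ℝ (count (part v w))) (L u) (L v) (L w) (ℕ→ℝ n))
        where
        part : ℝ → ℝ → Pred Point 0ℓ
        part u v = Region D (HalfOpen u v) n
        split : count (part u w) ≡ count (part u v) ℕ.+ count (part v w)
        split = count-split
          (region-sub (≤-trans s≤u (≤-trans u≤v (≤-trans v≤w w≤t))) n λ {x} z → closed-weaken x s≤u w≤t (half-open⇒closed x z))
          (λ { {a , b} (1≤a , (h , k) , d) → 1≤a , (h , <-≤-trans k (*-monoˡ (ℕ→ℝ≥0 a) v≤w)) , d })
          (λ { {a , b} (1≤a , (h , k) , d) → 1≤a , (≤-trans (*-monoˡ (ℕ→ℝ≥0 a) u≤v) h , k) , d })
          (λ { {a , b} (1≤a , (h , k) , d) → [ (λ q → inj₂ (1≤a , (q , k) , d)) , (λ q → inj₁ (1≤a , (h , q) , d)) ]′ (≤-or-> (ℕ→ℝ a * v) (ℕ→ℝ b)) })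
          (λ { {a , b} (_ , (_ , k) , _) (_ , (h , _) , _) → <⇒≱ k h })

      excess-empty : ∀ {u v} → s ≤ u → v ≤ t → u ≈ v → ∀ n → excess u v n ≈ 0#
      excess-empty {u} {v} s≤u v≤t u≈v n = trans
        (+-cong (*-congˡ (≡→≈ (≡.cong ℕ→ℝ (count-empty λ {x} → none {x})))) (-‿cong (*-congʳ (gap₀ (L-cong s≤u v≤t u≈v)))))
        (solve 1 (λ n → :2 :* :0 :- :0 :* n := :0) refl (ℕ→ℝ n))
        where
        none : ∀ {x} → ¬ Region D (HalfOpen u v) n x
        none {a , b} (_ , (h , k) , _) = <⇒≱ k (≤-respˡ (*-congˡ u≈v) h)

    opaque
      -- Excesses of adjacent sectors add, and so do the k errors K′ h² + ε. The right end is only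
      -- required to be ≈ u + k h, so that the last one can be v itself.
      subdivide : ∀ {u h} → s ≤ u → 0# ≤ h → ∀ ε → 0# < ε → ∀ k {x} → x ≈ u + ℕ→ℝ k * h → x ≤ t →
                  ∃[ C ] (∀ n → excess u x n ∈± (ℕ→ℝ k * (K′ * (h * h) + ε)) * ℕ→ℝ n + C)
      subdivide {u} {h} s≤u h≥0 ε ε>0 zero {x} e x≤t = 0# , λ n → ±-resp
        (sym (excess-empty s≤u x≤t (sym (trans e (solve 2 (λ u h → u :+ :0 :* h := u) refl u h))) n))
        (solve 2 (λ k n → :0 := :0 :* k :* n :+ :0) refl (K′ * (h * h) + ε) (ℕ→ℝ n))
        (±-0 ≤-refl)
      subdivide {u} {h} s≤u h≥0 ε ε>0 (suc k) {x} e x≤t =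
        let (C₁ , h₁) = subdivide s≤u h≥0 ε ε>0 k refl (≤-trans y≤x x≤t)
            (C₂ , h₂) = narrow-sector (≤-trans s≤u u≤y) y≤x x≤t ε ε>0
        in C₁ + C₂ , λ n → ±-resp
          (sym (excess-+ s≤u u≤y y≤x x≤t n))
          (trans (+-congˡ (+-congʳ (*-congʳ (+-congʳ (*-congˡ (*-cong x-y x-y))))))
            (solve 5 (λ k q n c d → k :* q :* n :+ c :+ (q :* n :+ d) := (:1 :+ k) :* q :* n :+ (c :+ d)) refl
              (ℕ→ℝ k) (K′ * (h * h) + ε) (ℕ→ℝ n) C₁ C₂))
          (±-+ (h₁ n) (h₂ n))
        where
        y : ℝ
        y = u + ℕ→ℝ k * h
        x-y : x - y ≈ h
        x-y = trans (+-congʳ e) (solve 3 (λ u k h → u :+ (:1 :+ k) :* h :- (u :+ k :* h) := h) refl u (ℕ→ℝ k) h)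
        y≤x : y ≤ x
        y≤x = ≤-by h≥0 (sym x-y)
        u≤y : u ≤ y
        u≤y = ≤-by (ℕ→ℝ≥0 k ⊠ h≥0) (solve 2 (λ u q → q := u :+ q :- u) refl u (ℕ→ℝ k * h))

    -- Over N sectors of width w / N the quadratic errors total K′ w² / N, which is at most ε/2 for
    -- large N; the other ε/2 is shared among the N tolerances δ.
    half-open-sector : ∀ {u v} → s ≤ u → u ≤ v → v ≤ t → Negligible (excess u v)
    half-open-sector {u} {v} s≤u u≤v v≤t ε ε>0 =
      let (C , bound) = subdivide {u} {h} s≤u (gap u≤v ⊠ <⇒≤ (inv>0 N>0)) δ δ>0 (suc m)
                          (sym (trans (+-congˡ (trans (*-comm N h) hN)) (solve 2 (λ u v → u :+ (v :- u) := v) refl u v))) v≤t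
      in C , λ n → ±-≤ (+-mono-≤ C (*-monoʳ (ℕ→ℝ≥0 n) total≤)) (bound n)
      where
      w = v - u
      large = archimedean (K′ * (w * w) / half ε)
      m = proj₁ large
      N = ℕ→ℝ (suc m)
      N>0 : 0# < N
      N>0 = ℕ→ℝ>0 m
      h = w / N
      δ = half ε / N
      δ>0 : 0# < δ
      δ>0 = half>0 ε>0 ⊠⁺ inv>0 N>0
      hN : h * N ≈ w
      hN = /-cancel (>⇒≉ N>0)
      δN : δ * N ≈ half ε
      δN = /-cancel (>⇒≉ N>0)
      K′w²≤ : K′ * (w * w) ≤ half ε * N
      K′w²≤ = ≤-trans (≤-respˡ (/-cancel (>⇒≉ (half>0 ε>0))) (*-monoʳ (<⇒≤ (half>0 ε>0)) (proj₂ large)))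
        (≤-by (half>0 ε>0 .proj₁) (solve 2 (λ e m → e := e :* (:1 :+ m) :- m :* e) refl (half ε) (ℕ→ℝ m)))
      total≤ : N * (K′ * (h * h) + δ) ≤ ε
      total≤ = cancel≤ N>0 (≤-by (gap K′w²≤)
        (trans (+-cong (*-congʳ (sym δN)) (-‿cong (*-congˡ (*-cong (sym hN) (sym hN)))))
          (trans (solve 4 (λ N k h d → d :* N :* N :- k :* (h :* N :* (h :* N)) := N :* (d :* N :+ d :* N) :- N :* (N :* (k :* (h :* h) :+ d))) refl N K′ h δ)
            (+-congʳ (*-congˡ (trans (+-cong δN δN) (half-sum ε)))))))

    -- The slopes equal to v contribute at most one point for each a.
    closed-sector : ∀ {u v} → s ≤ u → u ≤ v → v ≤ t →
                    Negligible (λ n → ℕ→ℝ 2 * ℕ→ℝ (count (Region D (Closed u v) n)) - (L v - L u) * ℕ→ℝ n)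
    closed-sector {u} {v} s≤u u≤v v≤t = Negligible-cong
      (λ n → trans
        (solve 4 (λ x y κ n → (:2 :* x :- κ :* n) :+ :2 :* y := :2 :* (x :+ y) :- κ :* n) refl
          (ℕ→ℝ (count (Region D (HalfOpen u v) n))) (ℕ→ℝ (count (ray n))) (L v - L u) (ℕ→ℝ n))
        (+-congʳ (*-congˡ (trans (sym (ℕ→ℝ-+ (count (Region D (HalfOpen u v) n)) (count (ray n)))) (≡→≈ (≡.cong ℕ→ℝ (≡.sym (split n))))))))
      (Negligible-+ (half-open-sector s≤u u≤v v≤t) (Negligible-scale (ℕ→ℝ 2) ray-negligible))
      where
      s≤t = ≤-trans s≤u (≤-trans u≤v v≤t)
      OnRay : Pred Point 0ℓ
      OnRay (a , b) = ℕ→ℝ b ≈ ℕ→ℝ a * v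
      ray : ℕ → Pred Point 0ℓ
      ray = Region D OnRay
      on-ray : ∀ {x} → OnRay x → Closed u v x
      on-ray {a , b} e = ≤-respʳ (sym e) (*-monoˡ (ℕ→ℝ≥0 a) u≤v) , ≤-reflexive e
      split : ∀ n → count (Region D (Closed u v) n) ≡ count (Region D (HalfOpen u v) n) ℕ.+ count (ray n)
      split n = count-split
        (region-sub s≤t n λ {x} → closed-weaken x s≤u v≤t)
        (λ { {x} (p , z , d) → p , half-open⇒closed x z , d })
        (λ { {x} (p , z , d) → p , on-ray {x} z , d })
        (λ { {a , b} (p , (h , k) , d) → [ (λ q → inj₂ (p , ≤-antisym k q , d)) , (λ q → inj₁ (p , (h , q) , d)) ]′ (≤-or-> (ℕ→ℝ a * v) (ℕ→ℝ b)) })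
        (λ { {a , b} (_ , (_ , k) , _) (_ , e , _) → <⇒≱ k (≤-reflexive (sym e)) })
      ray-negligible : Negligible (λ n → ℕ→ℝ (count (ray n)))
      ray-negligible ε ε>0 = q + ℕ→ℝ 2 , λ n → ±-nonneg (ℕ→ℝ≥0 (count (ray n))) (bound n)
        where
        q = 1# * 1# / (ε * c)
        bound : ∀ n → ℕ→ℝ (count (ray n)) ≤ ε * ℕ→ℝ n + (q + ℕ→ℝ 2)
        bound n =
          let (M , ≤M , M<) = ceiling {ε * ℕ→ℝ n + q} (<⇒≤ ε>0 ⊠ ℕ→ℝ≥0 n ⊞ (<⇒≤ 0<1 ⊠ <⇒≤ 0<1) ⊠ <⇒≤ (inv>0 (ε>0 ⊠⁺ c>0)))
              listed = region-sub s≤t n λ {x} z → closed-weaken x s≤u v≤t (on-ray {x} z)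
          in ≤-trans
            (≤-respʳ (≡→≈ (≡.cong ℕ→ℝ (count-row 0 (suc M)))) (ℕ→ℝ-mono (count-injective {Q = λ x → proj₁ x ≡ 0 × proj₂ x ℕ.< suc M} listed
              (listing-bounded (suc M) λ { (≡.refl , b<) → ℕ.s≤s ℕ.z≤n , b< })
              (λ (a , b) → 0 , a)
              (λ { {a , b} (p , z , d) → ≡.refl , ℕ.s≤s (ℕ→ℝ-mono⁻ (≤-trans (a-bound ε>0 s≤t (p , closed-weaken (a , b) s≤u v≤t (on-ray {a , b} z) , d)) ≤M)) })
              (λ { {a , b} {a′ , b′} (_ , z , _) (_ , z′ , _) ≡.refl → ≡.cong (a ,_) (ℕ→ℝ-injective (trans z (sym z′))) }))))
            (≤-by (gap (<⇒≤ M<)) (solve 4 (λ e n q M → e :* n :+ q :+ :1 :- M := e :* n :+ (q :+ :2) :- (:1 :+ M)) refl ε (ℕ→ℝ n) q (ℕ→ℝ M)))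

  -- From all lattice points to primitive ones

  opaque
    -- This is ⌊n / g²⌋ at g = k + 1; the shift keeps the divisor nonzero.
    quot : ℕ → ℕ → ℕ
    quot n k = n DivMod./ (suc k ℕ.* suc k)

    quot-0 : ∀ n → quot n 0 ≡ n
    quot-0 = DivMod.n/1≡n

    ≤-quot : ∀ {m n k} → suc k ℕ.* suc k ℕ.* m ℕ.≤ n → m ℕ.≤ quot n k
    ≤-quot {m} {n} {k} p = ≡.subst (ℕ._≤ quot n k)
      (≡.trans (≡.cong (DivMod._/ (suc k ℕ.* suc k)) (ℕₚ.*-comm (suc k ℕ.* suc k) m)) (DivMod.m*n/n≡m m (suc k ℕ.* suc k)))
      (DivMod./-monoˡ-≤ (suc k ℕ.* suc k) p)

    ≤-quot⁻ : ∀ {m n k} → m ℕ.≤ quot n k → suc k ℕ.* suc k ℕ.* m ℕ.≤ n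
    ≤-quot⁻ {m} {n} {k} p = ℕₚ.≤-trans (ℕₚ.*-monoʳ-≤ (suc k ℕ.* suc k) p)
      (≡.subst (ℕ._≤ n) (ℕₚ.*-comm (quot n k) (suc k ℕ.* suc k)) (DivMod.m/n*n≤m n (suc k ℕ.* suc k)))

  ¾ : ℝ
  ¾ = ℕ→ℝ 3 / ℕ→ℝ 4

  ¾*4 : ¾ * ℕ→ℝ 4 ≈ ℕ→ℝ 3
  ¾*4 = /-cancel (ℕ→ℝ≉0 3)

  ¾≥0 : 0# ≤ ¾
  ¾≥0 = ℕ→ℝ≥0 3 ⊠ <⇒≤ (inv>0 (ℕ→ℝ>0 3))

  -- The term 1/g² at g = k + 2, so that k = 0 is the first term after g = 1.
  recip² : ℕ → ℝ
  recip² k = (ℕ→ℝ (suc (suc k)) * ℕ→ℝ (suc (suc k))) ⁻¹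

  square>0 : ∀ k → 0# < ℕ→ℝ (suc (suc k)) * ℕ→ℝ (suc (suc k))
  square>0 k = ℕ→ℝ>0 (suc k) ⊠⁺ ℕ→ℝ>0 (suc k)

  quot-≤ : ∀ n k → ℕ→ℝ (quot n (suc k)) ≤ recip² k * ℕ→ℝ n
  quot-≤ n k = cancel≤ (square>0 k) (≤-resp
    (trans (ℕ→ℝ-* (suc (suc k) ℕ.* suc (suc k)) (quot n (suc k))) (*-congʳ (ℕ→ℝ-* (suc (suc k)) (suc (suc k)))))
    (sym (trans (sym (*-assoc _ _ _)) (trans (*-congʳ (inv-right (>⇒≉ (square>0 k)))) (*-identityˡ _))))
    (ℕ→ℝ-mono {n = n} (≤-quot⁻ {quot n (suc k)} {n} {suc k} ℕₚ.≤-refl)))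

  -- 1/4 + Σ (1/(k + 2) - 1/(k + 3)) ≤ 3/4; the Tauberian argument only needs a bound below 1.
  ∑-recip² : ∀ G → ∑< G recip² ≤ ¾
  ∑-recip² zero    = ¾≥0
  ∑-recip² (suc G) = cancel≤ (ℕ→ℝ>0 3) (≤-respʳ (trans (sym ¾*4) (*-comm ¾ _)) (≤-trans
    (*-monoˡ (ℕ→ℝ≥0 4) (+-mono ≤-refl (≤-trans (∑-≤ G {λ k → recip² (suc k)} {λ k → (- τ (suc k)) - (- τ k)} λ k _ → step k)
      (≤-reflexive (∑-telescope G (λ k → - τ k))))))
    (≤-by (ℕ→ℝ≥0 4 ⊠ <⇒≤ (inv>0 (ℕ→ℝ>0 (suc G)))) (trans
      (solve 1 (λ t → :4 :* t := con (+ 3) :- (:1 :+ (:2 :- :4 :* t))) refl (τ G))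
      (+-congˡ (-‿cong (trans (+-cong (sym 4recip) (+-congʳ (sym 4τ)))
        (solve 3 (λ r s t → :4 :* r :+ (:4 :* s :- :4 :* t) := :4 :* (r :+ ((:- t) :- (:- s)))) refl (recip² 0) (τ 0) (τ G)))))))))
    where
    τ : ℕ → ℝ
    τ k = ℕ→ℝ (suc (suc k)) ⁻¹
    4recip : ℕ→ℝ 4 * recip² 0 ≈ 1#
    4recip = trans (*-congʳ (solve 0 (:4 := :2 :* :2) refl)) (inv-right (>⇒≉ (square>0 0)))
    4τ : ℕ→ℝ 4 * τ 0 ≈ ℕ→ℝ 2
    4τ = trans (solve 1 (λ t → :4 :* t := :2 :* (:2 :* t)) refl (τ 0)) (trans (*-congˡ (inv-right 2≉0)) (*-identityʳ _))
    step : ∀ k → recip² (suc k) ≤ (- τ (suc k)) - (- τ k)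
    step k = cancel≤ (square>0 (suc k)) (≤-respˡ (sym (inv-right (>⇒≉ (square>0 (suc k)))))
      (≤-by (<⇒≤ (inv>0 (ℕ→ℝ>0 (suc k)))) (sym (trans
        (solve 3 (λ x t s → (:1 :+ x) :* (:1 :+ x) :* ((:- s) :- (:- t)) :- :1
                    := t :+ :2 :* (x :* t) :+ x :* (x :* t) :- (:1 :+ x) :* ((:1 :+ x) :* s) :- :1) refl
          (ℕ→ℝ (suc (suc k))) (τ k) (τ (suc k)))
        (trans (+-congʳ (+-cong (+-cong (+-congˡ (*-congˡ xt≈1)) (*-congˡ xt≈1)) (-‿cong (*-congˡ ys≈1))))
          (solve 2 (λ x t → t :+ :2 :* :1 :+ x :* :1 :- (:1 :+ x) :* :1 :- :1 := t) refl (ℕ→ℝ (suc (suc k))) (τ k)))))))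
      where
      xt≈1 : ℕ→ℝ (suc (suc k)) * τ k ≈ 1#
      xt≈1 = inv-right (ℕ→ℝ≉0 (suc k))
      ys≈1 : ℕ→ℝ (suc (suc (suc k))) * τ (suc k) ≈ 1#
      ys≈1 = inv-right (ℕ→ℝ≉0 (suc (suc k)))

  -- The Tauberian iteration

  Bounded : (ℕ → ℝ) → ℝ → ℝ → Set
  Bounded f k C = ∀ n → f n ∈± k * ℕ→ℝ n + C

  module _ (G : ℕ → ℕ) (G-negligible : Negligible (λ n → ℕ→ℝ (G n))) where

    -- The terms g ≥ 2 of the sum over g contribute at most 3/4 of the bound.
    tail-bound : ∀ {f k C} → 0# ≤ k → Bounded f k C → ∀ ε → 0# < ε →
                 ∃[ C′ ] Bounded (λ n → ∑< (G n) (λ j → f (quot n (suc j)))) (¾ * k + ε) C′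
    tail-bound {f} {k} {C} k≥0 b ε ε>0 =
      -- Each of the G n terms brings its own additive constant C. Their total C · G n is harmless
      -- because the number of terms is o(n).
      let (C″ , g) = Negligible-scale C G-negligible ε ε>0 in
      C″ , λ n → ±-≤
        (≤-trans (+-mono
          (≤-respˡ (sym (trans (∑-cong (G n) {λ j → k * (recip² j * ℕ→ℝ n)} {λ j → k * ℕ→ℝ n * recip² j} λ j _ →
                solve 3 (λ k r n → k :* (r :* n) := k :* n :* r) refl k (recip² j) (ℕ→ℝ n))
              (∑-* (G n) (k * ℕ→ℝ n) recip²)))
            (*-monoˡ (k≥0 ⊠ ℕ→ℝ≥0 n) (∑-recip² (G n))))
          (≤-trans (≤-reflexive (trans (∑-const (G n) C) (*-comm _ C))) (upper (g n))))
          (≤-reflexive (solve 5 (λ k n q e c → k :* n :* q :+ (e :* n :+ c) := (q :* k :+ e) :* n :+ c) refl k (ℕ→ℝ n) ¾ ε C″)))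
        (±-respʳ (∑-+ (G n) (λ j → k * (recip² j * ℕ→ℝ n)) (λ _ → C))
          (∑-± (G n) {λ j → f (quot n (suc j))} {λ j → k * (recip² j * ℕ→ℝ n) + C} λ j _ →
            ±-≤ (+-mono-≤ C (*-monoˡ k≥0 (quot-≤ n j))) (b (quot n (suc j)))))

    module _ {f F : ℕ → ℝ} (sum-of-f : ∀ n → F n ≈ ∑< (suc (G n)) (λ j → f (quot n j))) where

      f≈ : ∀ n → f n ≈ F n - ∑< (G n) (λ j → f (quot n (suc j)))
      f≈ n = trans (solve 2 (λ x y → x := x :+ y :- y) refl (f n) (∑< (G n) (λ j → f (quot n (suc j)))))
        (+-congʳ (trans (+-congʳ (≡→≈ (≡.cong f (≡.sym (quot-0 n))))) (sym (sum-of-f n))))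

      module _ (F-negligible : Negligible F) where

        improve : ∀ {k C} → 0# ≤ k → Bounded f k C → ∀ ε → 0# < ε → ∃[ C′ ] Bounded f (¾ * k + ε) C′
        improve {k} k≥0 b ε ε>0 =
          let (C₁ , h₁) = F-negligible (half ε) (half>0 ε>0)
              (C₂ , h₂) = tail-bound k≥0 b (half ε) (half>0 ε>0)
          in C₁ + C₂ , λ n → ±-resp (sym (f≈ n))
            (trans (solve 5 (λ e n c q d → e :* n :+ c :+ ((q :+ e) :* n :+ d) := (q :+ (e :+ e)) :* n :+ (c :+ d)) refl
                (half ε) (ℕ→ℝ n) C₁ (¾ * k) C₂)
              (+-congʳ (*-congʳ (+-congˡ (half-sum ε)))))
            (±-- (h₁ n) (h₂ n))

        -- Improving ε + t to ε + 3t/4 repeatedly brings t below 3 t₀ / (3 + j) in j steps.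
        descend : ∀ {t₀ C₀} → 0# ≤ t₀ → Bounded f t₀ C₀ → ∀ ε → 0# < ε → ∀ j {t} → 0# ≤ t →
                  ℕ→ℝ 3 * t₀ ≤ ℕ→ℝ (3 ℕ.+ j) * t → ∃[ C ] Bounded f (ε + t) C
        descend {t₀} {C₀} t₀≥0 b ε ε>0 zero {t} t≥0 p = C₀ , λ n → ±-≤
          (+-mono-≤ C₀ (*-monoʳ (ℕ→ℝ≥0 n) (≤-by (<⇒≤ ε>0 ⊞ gap (cancel≤ (ℕ→ℝ>0 2) p))
            (solve 3 (λ e t s → e :+ (t :- s) := e :+ t :- s) refl ε t t₀)))) (b n)
        descend {t₀} {C₀} t₀≥0 b ε ε>0 (suc j) {t} t≥0 p =
          let (C , bound) = descend t₀≥0 b ε ε>0 j t′≥0 enough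
              (C′ , bound′) = improve (<⇒≤ ε>0 ⊞ t′≥0) bound (half (half ε)) (half>0 (half>0 ε>0))
          in C′ , λ n → ±-respʳ (+-congʳ (*-congʳ simplify)) (bound′ n)
          where
          -- The bound ε + t is the improvement of ε + t′: one has ¾ t′ = t, and the tolerance ε/4
          -- restores ¾ ε to ε.
          t′ = t * ℕ→ℝ 4 / ℕ→ℝ 3
          t′*3 : t′ * ℕ→ℝ 3 ≈ t * ℕ→ℝ 4
          t′*3 = /-cancel (ℕ→ℝ≉0 2)
          t′≥0 : 0# ≤ t′
          t′≥0 = t≥0 ⊠ ℕ→ℝ≥0 4 ⊠ <⇒≤ (inv>0 (ℕ→ℝ>0 2))
          -- Holds because (3 + j) · 4/3 ≥ 4 + j. This is Bernoulli's inequality for powers of 4/3,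
          -- so no powers are needed.
          enough : ℕ→ℝ 3 * t₀ ≤ ℕ→ℝ (3 ℕ.+ j) * t′
          enough = cancel≤ (ℕ→ℝ>0 2) (≤-by (ℕ→ℝ≥0 3 ⊠ gap p ⊞ ℕ→ℝ≥0 j ⊠ t≥0) (trans
            (solve 3 (λ j t s → con (+ 3) :* ((:1 :+ (:1 :+ (:1 :+ (:1 :+ j)))) :* t :- con (+ 3) :* s) :+ j :* t
                        := (:1 :+ (:1 :+ (:1 :+ j))) :* (t :* :4) :- con (+ 3) :* (con (+ 3) :* s)) refl (ℕ→ℝ j) t t₀)
            (+-congʳ (trans (*-congˡ (sym t′*3))
              (solve 2 (λ j t → (:1 :+ (:1 :+ (:1 :+ j))) :* (t :* con (+ 3)) := con (+ 3) :* ((:1 :+ (:1 :+ (:1 :+ j))) :* t)) refl (ℕ→ℝ j) t′)))))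
          simplify : ¾ * (ε + t′) + half (half ε) ≈ ε + t
          simplify = cancel≈ {ℕ→ℝ 4} (ℕ→ℝ≉0 3) (trans
            (solve 4 (λ q e t h → :4 :* (q :* (e :+ t) :+ h) := (q :* :4) :* (e :+ t) :+ :2 :* (h :+ h)) refl ¾ ε t′ (half (half ε)))
            (trans (+-cong (*-congʳ ¾*4) (*-congˡ (half-sum (half ε))))
              (trans (solve 3 (λ e t h → con (+ 3) :* (e :+ t) :+ :2 :* h := t :* con (+ 3) :+ con (+ 3) :* e :+ (h :+ h)) refl ε t′ (half ε))
                (trans (+-cong (+-congʳ t′*3) (half-sum ε)) (solve 2 (λ e t → t :* :4 :+ con (+ 3) :* e :+ e := :4 :* (e :+ t)) refl ε t)))))

        tauberian : ∀ {t₀ C₀} → 0# ≤ t₀ → Bounded f t₀ C₀ → Negligible f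
        tauberian {t₀} {C₀} t₀≥0 b ε ε>0 =
          let (j , j≥) = archimedean (ℕ→ℝ 3 * t₀ / half ε)
              (C , bound) = descend t₀≥0 b (half ε) (half>0 ε>0) j (<⇒≤ (half>0 ε>0))
                (≤-respˡ (/-cancel (>⇒≉ (half>0 ε>0))) (*-monoʳ (<⇒≤ (half>0 ε>0)) (≤-trans j≥
                  (≤-by (ℕ→ℝ≥0 3) (solve 1 (λ j → con (+ 3) := (:1 :+ (:1 :+ (:1 :+ j))) :- j) refl (ℕ→ℝ j))))))
          in C , λ n → ±-respʳ (+-congʳ (*-congʳ (half-sum ε))) (bound n)

  -- Counting primitive points

  module Primitive {s t : ℝ} (F : Form s t) (s≤t : s ≤ t) where
    open Form F
    open Sectors F

    All′ Prim : ℝ → ℝ → ℕ → Pred Point 0ℓ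
    All′ u v n = Region D (Closed u v) n
    Prim u v n p = All′ u v n p × gcd (proj₁ p) (proj₂ p) ≡ 1

    all prim : ℝ → ℝ → ℕ → ℝ
    all  u v n = ℕ→ℝ (count (All′ u v n))
    prim u v n = ℕ→ℝ (count (Prim u v n))

    root : ∀ n → ∃[ m ] (ℕ→ℝ m * ℕ→ℝ m ≤ ℕ→ℝ n / c × ℕ→ℝ n / c < ℕ→ℝ (suc m) * ℕ→ℝ (suc m))
    root n = integer-sqrt (ℕ→ℝ≥0 n ⊠ <⇒≤ (inv>0 c>0))

    -- This is ⌊√(n/c)⌋. From c a² ≤ n and gcd ≤ a every gcd occurring is at most `suc (G n)`, so
    -- the sum over gcds can stop there: the term g = 1 followed by G n further terms.
    G : ℕ → ℕ
    G n = proj₁ (root n)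

    G-negligible : Negligible (λ n → ℕ→ℝ (G n))
    G-negligible ε ε>0 = 1# * 1# / (ε * c) , λ n → ±-nonneg (ℕ→ℝ≥0 (G n)) (≤-respˡ (*-identityˡ _)
      (≤-trans (linear≤quadratic 1# (ℕ→ℝ (G n)) (ε>0 ⊠⁺ c>0)) (+-mono-≤ _
        (≤-respˡ (sym (*-assoc ε c _)) (*-monoˡ (<⇒≤ ε>0) (≤-respʳ (trans (*-comm c _) (/-cancel (>⇒≉ c>0)))
          (*-monoˡ (<⇒≤ c>0) (proj₁ (proj₂ (root n))))))))))

    a≤G : ∀ {n a b} → Region D (Closed s t) n (a , b) → a ℕ.≤ suc (G n)
    a≤G {n} {a} r = ℕₚ.≮⇒≥ λ G<a → <⇒≱ (proj₂ (proj₂ (root n)))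
      (≤-trans (*-mono (ℕ→ℝ≥0 (suc (G n))) (ℕ→ℝ≥0 (suc (G n))) (ℕ→ℝ-mono (ℕₚ.<⇒≤ G<a)) (ℕ→ℝ-mono (ℕₚ.<⇒≤ G<a)))
        (cancel≤ c>0 (≤-respʳ (sym (trans (*-comm c _) (/-cancel (>⇒≉ c>0)))) (a²≤ s≤t r))))

    module _ {u v : ℝ} (s≤u : s ≤ u) (v≤t : v ≤ t) where

      listing-all : ∀ n → Listing (All′ u v n)
      listing-all n = region-sub s≤t n λ {x} → closed-weaken x s≤u v≤t

      listing-prim : ∀ n → Listing (Prim u v n)
      listing-prim n = listing-⊆ (listing-all n) proj₁

      Level Levels : ℕ → ℕ → Pred Point 0ℓ
      Level  n g p = All′ u v n p × gcd (proj₁ p) (proj₂ p) ≡ g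
      Levels n g p = All′ u v n p × gcd (proj₁ p) (proj₂ p) ℕ.≤ g

      gcd≥1 : ∀ {n p} → All′ u v n p → 1 ℕ.≤ gcd (proj₁ p) (proj₂ p)
      gcd≥1 {n} {a , b} (1≤a , _) = ℕₚ.n≢0⇒n>0 λ e → ℕₚ.<⇒≢ 1≤a (≡.sym (gcd[m,n]≡0⇒m≡0 {a} {b} e))

      closed-scale : ∀ g {a b} → Closed u v (a , b) → Closed u v (suc g ℕ.* a , suc g ℕ.* b)
      closed-scale g {a} {b} (h , k) =
        ≤-resp (trans (sym (*-assoc _ _ _)) (*-congʳ (sym (ℕ→ℝ-* (suc g) a)))) (sym (ℕ→ℝ-* (suc g) b)) (*-monoˡ (ℕ→ℝ≥0 (suc g)) h) ,
        ≤-resp (sym (ℕ→ℝ-* (suc g) b)) (trans (sym (*-assoc _ _ _)) (*-congʳ (sym (ℕ→ℝ-* (suc g) a)))) (*-monoˡ (ℕ→ℝ≥0 (suc g)) k)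

      closed-unscale : ∀ g {a b} → Closed u v (suc g ℕ.* a , suc g ℕ.* b) → Closed u v (a , b)
      closed-unscale g {a} {b} (h , k) =
        cancel≤ (ℕ→ℝ>0 g) (≤-resp (trans (*-congʳ (ℕ→ℝ-* (suc g) a)) (*-assoc _ _ _)) (ℕ→ℝ-* (suc g) b) h) ,
        cancel≤ (ℕ→ℝ>0 g) (≤-resp (ℕ→ℝ-* (suc g) b) (trans (*-congʳ (ℕ→ℝ-* (suc g) a)) (*-assoc _ _ _)) k)

      up : ∀ n k {a b} → Prim u v (quot n k) (a , b) → Level n (suc k) (suc k ℕ.* a , suc k ℕ.* b)
      up n k {a} {b} ((1≤a , z , d) , e) =
        (ℕₚ.≤-trans 1≤a (ℕₚ.m≤m+n a _) , closed-scale k {a} {b} z ,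
          ≡.subst (ℕ._≤ n) (≡.sym (homogeneous (suc k) a b)) (≤-quot⁻ {k = k} d)) ,
        ≡.trans (≡.sym (c*gcd[m,n]≡gcd[cm,cn] (suc k) a b)) (≡.trans (≡.cong (suc k ℕ.*_) e) (ℕₚ.*-identityʳ (suc k)))

      down : ∀ n k {a b} → Level n (suc k) (suc k ℕ.* a , suc k ℕ.* b) → Prim u v (quot n k) (a , b)
      down n k {a} {b} ((1≤a , z , d) , e) =
        (ℕₚ.n≢0⇒n>0 (λ { ≡.refl → ℕₚ.n≮0 (≡.subst (1 ℕ.≤_) (ℕₚ.*-zeroʳ k) 1≤a) }) , closed-unscale k {a} {b} z ,
          ≤-quot {k = k} (≡.subst (ℕ._≤ n) (homogeneous (suc k) a b) d)) ,
        ℕₚ.*-cancelˡ-≡ (gcd a b) 1 (suc k) (≡.trans (c*gcd[m,n]≡gcd[cm,cn] (suc k) a b) (≡.trans e (≡.sym (ℕₚ.*-identityʳ (suc k)))))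

      -- Division by g = k + 1 keeps the slope and divides D by g², as D is homogeneous of degree 2,
      -- so points with gcd g correspond to primitive points with bound n / g².
      count-level : ∀ n k → count (Level n (suc k)) ≡ count (Prim u v (quot n k))
      count-level n k = ℕₚ.≤-antisym
        (count-injective listing-level (listing-prim (quot n k)) divide
          (λ { {a , b} l@(_ , e) → down n k (≡.subst (Level n (suc k)) (≡.sym (multiply-divide (a , b) e)) l) })
          (λ { {x} {y} (_ , e) (_ , e′) q → ≡.trans (≡.sym (multiply-divide x e)) (≡.trans (≡.cong multiply q) (multiply-divide y e′)) }))
        (count-injective (listing-prim (quot n k)) listing-level multiply
          (λ { {a , b} → up n k })
          (λ {x} {y} _ _ q → ≡.cong₂ _,_ (ℕₚ.*-cancelˡ-≡ (proj₁ x) (proj₁ y) (suc k) (≡.cong proj₁ q)) (ℕₚ.*-cancelˡ-≡ (proj₂ x) (proj₂ y) (suc k) (≡.cong proj₂ q))))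
        where
        listing-level : Listing (Level n (suc k))
        listing-level = listing-⊆ (listing-all n) proj₁
        multiply divide : Point → Point
        multiply (a , b) = suc k ℕ.* a , suc k ℕ.* b
        divide (a , b) = a DivMod./ suc k , b DivMod./ suc k
        multiply-divide : ∀ x → gcd (proj₁ x) (proj₂ x) ≡ suc k → multiply (divide x) ≡ x
        multiply-divide (a , b) e = ≡.cong₂ _,_ (DivMod.m*[n/m]≡n (≡.subst (Div._∣ a) e (gcd[m,n]∣m a b)))
                                                (DivMod.m*[n/m]≡n (≡.subst (Div._∣ b) e (gcd[m,n]∣n a b)))

      count-levels : ∀ n g → ℕ→ℝ (count (Levels n g)) ≈ ∑< g (λ k → prim u v (quot n k))
      count-levels n zero = ≡→≈ (≡.cong ℕ→ℝ (count-empty λ { {p} (r , e) → ℕₚ.<⇒≱ (gcd≥1 {p = p} r) e }))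
      count-levels n (suc g) = trans (≡→≈ (≡.cong ℕ→ℝ split)) (trans (ℕ→ℝ-+ (count (Levels n g)) (count (Level n (suc g))))
        (trans (+-cong (count-levels n g) (≡→≈ (≡.cong ℕ→ℝ (count-level n g)))) (sym (∑-snoc g (λ k → prim u v (quot n k))))))
        where
        split : count (Levels n (suc g)) ≡ count (Levels n g) ℕ.+ count (Level n (suc g))
        split = count-split (listing-⊆ (listing-all n) proj₁)
          (λ (r , e) → r , ℕₚ.m≤n⇒m≤1+n e)
          (λ (r , e) → r , ℕₚ.≤-reflexive e)
          (λ (r , e) → [ (λ q → inj₁ (r , ℕₚ.≤-pred q)) , (λ q → inj₂ (r , q)) ]′ (ℕₚ.m≤n⇒m<n∨m≡n e))
          (λ (_ , e) (_ , e′) → ℕₚ.<⇒≢ (ℕ.s≤s e) e′)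

      all≈∑prim : ∀ n → all u v n ≈ ∑< (suc (G n)) (λ k → prim u v (quot n k))
      all≈∑prim n = trans (≡→≈ (≡.cong ℕ→ℝ (count-≐ (listing-all n) (listing-⊆ (listing-all n) proj₁)
        (λ { {a , b} r@(1≤a , z , d) → r , ℕₚ.≤-trans (gcd≤ a b 1≤a) (a≤G (1≤a , closed-weaken (a , b) s≤u v≤t z , d)) })
        proj₁))) (count-levels n (suc (G n)))
        where
        gcd≤ : ∀ a b → 1 ℕ.≤ a → gcd a b ℕ.≤ a
        gcd≤ a b 1≤a = Div.∣⇒≤ {{ℕ.>-nonZero 1≤a}} (gcd[m,n]∣m a b)

      prim≤all : ∀ n → prim u v n ≤ all u v n
      prim≤all n = ℕ→ℝ-mono (count-⊆ (listing-prim n) (listing-all n) proj₁)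

      module _ (u≤v : u ≤ v) where

        κ : ℝ
        κ = L v - L u

        κ≥0 : 0# ≤ κ
        κ≥0 = ≤-trans (gap u≤v ⊠ <⇒≤ (inv>0 (<-≤-trans (lo>0 s≤u u≤v v≤t) (lo≤hi s≤u u≤v v≤t)))) (L-lo s≤u u≤v v≤t)

        all-asymptotic : Negligible (λ n → ℕ→ℝ 2 * all u v n - κ * ℕ→ℝ n)
        all-asymptotic = closed-sector F s≤u u≤v v≤t

        -- A crude linear bound, from comparison with all points, which gives the iteration its
        -- starting value.
        twice-prim-bounded : ∀ ε → 0# < ε → ∃[ C ] Bounded (λ n → ℕ→ℝ 2 * prim u v n) (κ + ε) C
        twice-prim-bounded ε ε>0 = let (C , h) = all-asymptotic ε ε>0 in C , λ n →
          ±-nonneg (ℕ→ℝ≥0 2 ⊠ ℕ→ℝ≥0 (count (Prim u v n))) (≤-by (ℕ→ℝ≥0 2 ⊠ gap (prim≤all n) ⊞ gap (upper (h n)))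
            (solve 6 (λ p a k e n c → :2 :* (a :- p) :+ (e :* n :+ c :- (:2 :* a :- k :* n)) := (k :+ e) :* n :+ c :- :2 :* p) refl
              (prim u v n) (all u v n) κ ε (ℕ→ℝ n) C))

        -- Positive because 1 - Σ_{g ≥ 2} 1/g² ≥ 1/4.
        prim-lower : 0# < κ → ∃[ δ ] (0# < δ × ∃[ C ] (∀ n → δ * ℕ→ℝ n ≤ prim u v n + C))
        prim-lower κ>0 =
          let (C₁ , h₁) = all-asymptotic e e>0
              (C₂ , h₂) = twice-prim-bounded e e>0
              (C₃ , h₃) = tail-bound G G-negligible (κ≥0 ⊞ <⇒≤ e>0) h₂ e e>0
          in δ , half>0 d>0 , half (C₁ + C₃) , λ n → cancel≤ (ℕ→ℝ>0 1) (≤-by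
            (gap (lower (h₁ n)) ⊞ gap (upper (h₃ n)))
            (trans (+-congʳ (+-congʳ (+-congʳ (trans (*-congˡ (all≈∑prim n)) (trans (distribˡ _ _ _)
                  (+-cong (*-congˡ (≡→≈ (≡.cong (prim u v) (quot-0 n)))) (sym (∑-* (G n) (ℕ→ℝ 2) (λ k → prim u v (quot n (suc k)))))))))))
              (trans (solve 8 (λ p T k n e c q d → (:2 :* p :+ T :- k :* n) :- (:- (e :* n :+ c)) :+ ((q :* (k :+ e) :+ e) :* n :+ d :- T)
                  := :2 :* p :+ (c :+ d) :- (k :- e :- q :* (k :+ e) :- e) :* n) refl
                  (prim u v n) (∑< (G n) (λ k → ℕ→ℝ 2 * prim u v (quot n (suc k)))) κ (ℕ→ℝ n) e C₁ ¾ C₃)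
                (trans (+-cong (+-congˡ (sym (half-sum (C₁ + C₃)))) (-‿cong (*-congʳ (sym (half-sum d)))))
                  (solve 4 (λ p c δ n → :2 :* p :+ (c :+ c) :- (δ :+ δ) :* n := :2 :* (p :+ c) :- :2 :* (δ :* n)) refl
                    (prim u v n) (half (C₁ + C₃)) δ (ℕ→ℝ n))))))
          where
          -- With e = κ/16 the constant d below is κ/4 - 11e/4 = 5e/4 > 0; any sufficiently small
          -- multiple of κ would do.
          e = half (half (half (half κ)))
          e>0 : 0# < e
          e>0 = half>0 (half>0 (half>0 (half>0 κ>0)))
          16e : ℕ→ℝ 16 * e ≈ κ
          16e = trans (solve 1 (λ e → con (+ 16) :* e := con (+ 8) :* (e :+ e)) refl e) (trans (*-congˡ (half-sum _))
            (trans (solve 1 (λ e → con (+ 8) :* e := con (+ 4) :* (e :+ e)) refl _) (trans (*-congˡ (half-sum _))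
            (trans (solve 1 (λ e → con (+ 4) :* e := con (+ 2) :* (e :+ e)) refl _) (trans (*-congˡ (half-sum _))
            (trans (solve 1 (λ e → con (+ 2) :* e := e :+ e) refl _) (half-sum κ)))))))
          d = κ - e - ¾ * (κ + e) - e
          δ = half d
          d>0 : 0# < d
          d>0 = ≰⇒> λ d≤0 → <⇒≱ (ℕ→ℝ>0 4 ⊠⁺ e>0) (≤-by (ℕ→ℝ≥0 4 ⊠ gap d≤0) (trans
            (solve 3 (λ k e q → :4 :* (:0 :- (k :- e :- q :* (k :+ e) :- e)) := (q :* :4) :* (k :+ e) :- (:4 :* k :- con (+ 8) :* e)) refl κ e ¾)
            (trans (+-congʳ (*-congʳ ¾*4)) (trans (solve 2 (λ k e → con (+ 3) :* (k :+ e) :- (:4 :* k :- con (+ 8) :* e) := con (+ 11) :* e :- k) refl κ e)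
              (trans (+-congˡ (-‿cong (sym 16e))) (solve 1 (λ e → con (+ 11) :* e :- con (+ 16) :* e := :0 :- con (+ 5) :* e) refl e))))))

    module _ {u v u′ v′ : ℝ} (s≤u : s ≤ u) (u≤v : u ≤ v) (v≤t : v ≤ t) (s≤u′ : s ≤ u′) (u′≤v′ : u′ ≤ v′) (v′≤t : v′ ≤ t) where

      κI κJ : ℝ
      κI = L v - L u
      κJ = L v′ - L u′

      cross : ℕ → ℝ
      cross n = κJ * (ℕ→ℝ 2 * prim u v n) - κI * (ℕ→ℝ 2 * prim u′ v′ n)

      -- The main terms cancel in κJ A_I - κI A_J, so the Tauberian argument applies to κJ P_I - κI P_J.
      cross-negligible : Negligible cross
      cross-negligible =
        let (C₁ , h₁) = twice-prim-bounded s≤u v≤t u≤v 1# 0<1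
            (C₂ , h₂) = twice-prim-bounded s≤u′ v′≤t u′≤v′ 1# 0<1
        in tauberian G G-negligible {cross} {λ n → κJ * (ℕ→ℝ 2 * all u v n) - κI * (ℕ→ℝ 2 * all u′ v′ n)}
          cross-sum
          (Negligible-cong
            (λ n → solve 5 (λ x y i j n → j :* (x :- i :* n) :+ :- i :* (y :- j :* n) := j :* x :- i :* y) refl
              (ℕ→ℝ 2 * all u v n) (ℕ→ℝ 2 * all u′ v′ n) κI κJ (ℕ→ℝ n))
            (Negligible-+ (Negligible-scale κJ (all-asymptotic s≤u v≤t u≤v)) (Negligible-scale (- κI) (all-asymptotic s≤u′ v′≤t u′≤v′))))
          {κJ * (κI + 1#) + κI * (κJ + 1#)} {κJ * C₁ + κI * C₂}
          (κJ≥0 ⊠ (κI≥0 ⊞ <⇒≤ 0<1) ⊞ κI≥0 ⊠ (κJ≥0 ⊞ <⇒≤ 0<1))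
          λ n → ±-respʳ
            (solve 5 (λ i j n c d → j :* ((i :+ :1) :* n :+ c) :+ i :* ((j :+ :1) :* n :+ d) := (j :* (i :+ :1) :+ i :* (j :+ :1)) :* n :+ (j :* c :+ i :* d)) refl
              κI κJ (ℕ→ℝ n) C₁ C₂)
            (±-- (±-scale κJ≥0 (h₁ n)) (±-scale κI≥0 (h₂ n)))
        where
        κI≥0 : 0# ≤ κI
        κI≥0 = κ≥0 s≤u v≤t u≤v
        κJ≥0 : 0# ≤ κJ
        κJ≥0 = κ≥0 s≤u′ v′≤t u′≤v′
        cross-sum : ∀ n → κJ * (ℕ→ℝ 2 * all u v n) - κI * (ℕ→ℝ 2 * all u′ v′ n) ≈ ∑< (suc (G n)) (λ k → cross (quot n k))
        cross-sum n = trans (+-cong (*-congˡ (*-congˡ (all≈∑prim s≤u v≤t n))) (-‿cong (*-congˡ (*-congˡ (all≈∑prim s≤u′ v′≤t n)))))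
          (go (suc (G n)) (λ k → prim u v (quot n k)) (λ k → prim u′ v′ (quot n k)))
          where
          go : ∀ m (p q : ℕ → ℝ) → κJ * (ℕ→ℝ 2 * ∑< m p) - κI * (ℕ→ℝ 2 * ∑< m q) ≈ ∑< m (λ k → κJ * (ℕ→ℝ 2 * p k) - κI * (ℕ→ℝ 2 * q k))
          go zero    p q = solve 2 (λ i j → j :* (:2 :* :0) :- i :* (:2 :* :0) := :0) refl κI κJ
          go (suc m) p q = trans
            (solve 6 (λ i j x y P Q → j :* (:2 :* (x :+ P)) :- i :* (:2 :* (y :+ Q))
                        := (j :* (:2 :* x) :- i :* (:2 :* y)) :+ (j :* (:2 :* P) :- i :* (:2 :* Q))) refl
              κI κJ (p 0) (q 0) (∑< m (λ k → p (suc k))) (∑< m (λ k → q (suc k))))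
            (+-congˡ (go m (λ k → p (suc k)) (λ k → q (suc k))))

      -- The difference of the ratios is `cross n` divided by κJ · 2 P_J. The numerator is o(n), and
      -- `prim-lower` bounds n by a multiple of P_J up to a constant.
      prim-ratio : 0# < κJ → ∀ ε → 0# < ε → ∃[ N ] (∀ n → N ℕ.≤ n → ∣ prim u v n / prim u′ v′ n - κI / κJ ∣ < ε)
      prim-ratio κJ>0 ε ε>0 =
        let (δ , δ>0 , C₁ , low) = prim-lower s≤u′ v′≤t u′≤v′ κJ>0
            k>0 : 0# < half ε * κJ
            k>0 = half>0 ε>0 ⊠⁺ κJ>0
            -- The factor δ in the tolerance is spent when `prim-lower` replaces δ n by P_J. Below,
            -- N absorbs the additive constants, and N′ ensures P_J ≥ 1, so that the quotient is a
            -- genuine one.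
            (C₂ , h) = cross-negligible (half ε * κJ * δ) (k>0 ⊠⁺ δ>0)
            (N , N≥) = archimedean ((C₂ + ℕ→ℝ 2 * (half ε * κJ) * C₁) / (half ε * κJ * δ))
            (N′ , N′≥) = archimedean ((C₁ + 1#) / δ)
        in N ℕ.+ N′ , λ n n≥ →
          let P>0 : 0# < prim u′ v′ n
              P>0 = <-≤-trans 0<1 (≤-by (gap (low n) ⊞ gap (≤-respˡ (/-cancel (>⇒≉ δ>0))
                      (*-monoʳ (<⇒≤ δ>0) (≤-trans N′≥ (ℕ→ℝ-mono (ℕₚ.≤-trans (ℕₚ.m≤n+m N′ N) n≥))))))
                      (solve 4 (λ p c d n → (p :+ c :- d :* n) :+ (n :* d :- (c :+ :1)) := p :- :1) refl (prim u′ v′ n) C₁ δ (ℕ→ℝ n)))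
              n-large : C₂ + ℕ→ℝ 2 * (half ε * κJ) * C₁ ≤ ℕ→ℝ n * (half ε * κJ * δ)
              n-large = ≤-respˡ (/-cancel (>⇒≉ (k>0 ⊠⁺ δ>0))) (*-monoʳ (<⇒≤ (k>0 ⊠⁺ δ>0)) (≤-trans N≥ (ℕ→ℝ-mono (ℕₚ.≤-trans (ℕₚ.m≤m+n N N′) n≥))))
          in abs-< (quotient-± κJ>0 P>0 (±-≤ (≤-by (gap n-large ⊞ (ℕ→ℝ≥0 2 ⊠ <⇒≤ k>0) ⊠ gap (low n))
              (solve 6 (λ k d n c e p → (n :* (k :* d) :- (c :+ :2 :* k :* e)) :+ :2 :* k :* (p :+ e :- d :* n) := k :* (:2 :* p) :- (k :* d :* n :+ c)) refl
                (half ε * κJ) δ (ℕ→ℝ n) C₂ C₁ (prim u′ v′ n))) (h n))) (half<self ε>0)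
        where
        quotient-± : ∀ {P Q e} → 0# < κJ → 0# < Q → κJ * (ℕ→ℝ 2 * P) - κI * (ℕ→ℝ 2 * Q) ∈± e * κJ * (ℕ→ℝ 2 * Q) → P / Q - κI / κJ ∈± e
        quotient-± {P} {Q} {e} κ>0 Q>0 p = cancel-± (κ>0 ⊠⁺ (ℕ→ℝ>0 1 ⊠⁺ Q>0)) (±-resp
          (sym (trans (solve 4 (λ k q x y → k :* (:2 :* q) :* (x :- y) := k :* (:2 :* (x :* q)) :- y :* k :* (:2 :* q)) refl κJ Q (P / Q) (κI / κJ))
            (+-cong (*-congˡ (*-congˡ (/-cancel (>⇒≉ Q>0)))) (-‿cong (*-congʳ (/-cancel (>⇒≉ κ>0)))))))
          (solve 3 (λ e k q → e :* k :* (:2 :* q) := k :* (:2 :* q) :* e) refl e κJ Q) p)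

  -- Cardinalities of sets of complex numbers

  ≈ᶜ-sym : ∀ {z w} → z ≈ᶜ w → w ≈ᶜ z
  ≈ᶜ-sym (p , q) = sym p , sym q

  ≈ᶜ-trans : ∀ {z w v} → z ≈ᶜ w → w ≈ᶜ v → z ≈ᶜ v
  ≈ᶜ-trans (p , q) (r , s) = trans p r , trans q s

  ≡→≈ᶜ : ∀ {z w} → z ≡ w → z ≈ᶜ w
  ≡→≈ᶜ ≡.refl = refl , refl

  bijection-≤ : ∀ {P m n} → Bijection (≡-setoid (Fin m)) (subset P) → Bijection (≡-setoid (Fin n)) (subset P) → m ℕ.≤ n
  bijection-≤ {P} {m} {n} f g = Finₚ.injective⇒≤ {f = h} λ {i} {j} e →
    f.injective {i} {j} (≈ᶜ-trans (≈ᶜ-sym (hits i)) (≈ᶜ-trans (≡→≈ᶜ (≡.cong (λ k → proj₁ (g.to k)) e)) (hits j)))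
    where
    module f = Bijection f
    module g = Bijection g
    h : Fin m → Fin n
    h i = proj₁ (g.surjective (f.to i))
    hits : ∀ i → proj₁ (g.to (h i)) ≈ᶜ proj₁ (f.to i)
    hits i = proj₂ (g.surjective (f.to i)) ≡.refl

  #-count : ∀ {P : Pred ℂ 0ℓ} {Q : Pred Point 0ℓ} → Listing Q → (φ : Point → ℂ) → (∀ {x} → Q x → P (φ x)) →
            (∀ {x y} → Q x → Q y → φ x ≈ᶜ φ y → x ≡ y) → (∀ {z} → P z → ∃[ x ] (Q x × φ x ≈ᶜ z)) → # P ≡ count Q
  #-count {P} {Q} l φ into inj onto = ≡.trans (ℕₚ.≤-antisym (bijection-≤ {P} chosen bijection) (bijection-≤ {P} bijection chosen)) (≡.sym (count-size l))
    where
    Q-lookup : ∀ i → Q (lookup (elements l) i)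
    Q-lookup i = sound l (∈-lookup {xs = elements l} i)
    bijection : Bijection (≡-setoid (Fin (size l))) (subset P)
    bijection = record
      { to = λ i → φ (lookup (elements l) i) , into (Q-lookup i)
      ; cong = λ { ≡.refl → refl , refl }
      ; bijective = (λ {i} {j} e → lookup-injective (distinct l) i j (inj (Q-lookup i) (Q-lookup j) e)) ,
          λ (z , z∈) → let (x , q , e) = onto z∈ ; x∈ = complete l q in index x∈ ,
            λ { ≡.refl → ≡.subst (λ y → φ y ≈ᶜ z) (lookup-index x∈) e } }
    -- The cardinality is some index size picked by `the`; the explicit bijection rules out the
    -- default 0, and comparing the two bijections in both directions shows that the sizes agree.
    chosen : Bijection (≡-setoid (Fin (# P))) (subset P)
    chosen = the-∈ {d = 0} {λ n → Bijection (≡-setoid (Fin n)) (subset P)} (size l , bijection)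

  -- CM points

  ℤ→ℝ-zero : ∀ k → ℤ→ℝ k ≈ 0# → k ≡ + 0
  ℤ→ℝ-zero (+ n)    e = ≡.cong +_ (ℕ→ℝ-injective e)
  ℤ→ℝ-zero -[1+ n ] e = ⊥-elim (ℕ→ℝ≉0 n (trans (solve 1 (λ x → x := :- (:- x)) refl (ℕ→ℝ (suc n))) (trans (-‿cong e) (solve 0 (:- :0 := :0) refl))))

  ℤ→ℝ-injective : ∀ {i j} → ℤ→ℝ i ≈ ℤ→ℝ j → i ≡ j
  ℤ→ℝ-injective {i} {j} e = ℤₚ.i-j≡0⇒i≡j i j (ℤ→ℝ-zero (i ℤ.- j)
    (trans (ℤ→ℝ-+ i (ℤ.- j)) (trans (+-congˡ (ℤ→ℝ-neg j)) (gap₀ (sym e)))))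

  nonneg-integer : ∀ i → 0# ≤ ℤ→ℝ i → ∃[ n ] (i ≡ + n)
  nonneg-integer (+ n)    _ = n , ≡.refl
  nonneg-integer -[1+ n ] p = ⊥-elim (<⇒≱ (ℕ→ℝ>0 n) (≤-by p (solve 1 (λ x → :- x := :0 :- x) refl (ℕ→ℝ (suc n)))))

  module CMPoint {x y : ℝ} {d : ℤ} (p : IsCMPointOfDiscriminant (x , y) d) where
    open IsCMPointOfDiscriminant p renaming (c to c′)

    A B C′ : ℝ
    A = ℤ→ℝ a
    B = ℤ→ℝ b
    C′ = ℤ→ℝ c′

    -- The imaginary part of the quadratic equation is y (2 A x + B) = 0 with y > 0. Substituted
    -- into the real part this gives `c-equation`; together they say that -b/a and c/a are the trace
    -- and the norm of τ.
    b-equation : B ≈ - (ℕ→ℝ 2 * (A * x))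
    b-equation = ≈-by {t = - (ℕ→ℝ 2 * (A * x) + B)}
      (trans (-‿cong (zero-product {y} (trans
        (solve 4 (λ A B x y → y :* (:2 :* (A :* x) :+ B)
                    := (A :* (x :* y :+ y :* x) :+ :0 :* (x :* x :- y :* y)) :+ (B :* y :+ :0 :* x) :+ :0) refl A B x y)
        (proj₂ root)) (>⇒≉ τ∈ℋ))) (solve 0 (:- :0 := :0) refl))
      (solve 2 (λ t b → :- (t :+ b) := (:- t) :- b) refl (ℕ→ℝ 2 * (A * x)) B)

    c-equation : C′ ≈ A * (x * x + y * y)
    c-equation = ≈-by {t = - 0#} (solve 0 (:- :0 := :0) refl) (trans (-‿cong (sym (proj₁ root)))
      (trans (-‿cong (+-congʳ (+-congˡ (+-congʳ (*-congʳ b-equation)))))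
        (solve 4 (λ A C x y → :- ((A :* (x :* x :- y :* y) :- :0 :* (x :* y :+ y :* x)) :+ ((:- (:2 :* (A :* x))) :* x :- :0 :* y) :+ C)
                    := A :* (x :* x :+ y :* y) :- C) refl A C′ x y)))

    d-equation : ℤ→ℝ d ≈ B * B - ℕ→ℝ 4 * A * C′
    d-equation = trans (≡→≈ (≡.cong ℤ→ℝ discriminant)) (trans (ℤ→ℝ-+ (b ℤ.* b) (ℤ.- (+ 4 ℤ.* a ℤ.* c′)))
      (+-cong (ℤ→ℝ-* b b) (trans (ℤ→ℝ-neg (+ 4 ℤ.* a ℤ.* c′)) (-‿cong (trans (ℤ→ℝ-* (+ 4 ℤ.* a) c′) (*-congʳ (ℤ→ℝ-* (+ 4) a)))))))

    positive-a : ∃[ n ] (1 ℕ.≤ n × a ≡ + n)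
    positive-a = positive a≥1
      where
      positive : ∀ {i} → + 1 ℤ.≤ i → ∃[ n ] (1 ℕ.≤ n × i ≡ + n)
      positive (ℤ.+≤+ q) = _ , q , ≡.refl

  mk-CMPoint : ∀ {x y} (a : ℕ) (b c : ℤ) → 0# < y → 1 ℕ.≤ a → ℤGCD.gcd (+ a) (ℤGCD.gcd b c) ≡ + 1 →
               ℤ→ℝ b ≈ - (ℕ→ℝ 2 * (ℕ→ℝ a * x)) → ℤ→ℝ c ≈ ℕ→ℝ a * (x * x + y * y) →
               IsCMPointOfDiscriminant (x , y) (b ℤ.* b ℤ.- + 4 ℤ.* + a ℤ.* c)
  mk-CMPoint {x} {y} a b c y>0 1≤a g eb ec = record
    { τ∈ℋ = y>0 ; a = + a ; b = b ; c = c ; a≥1 = ℤ.+≤+ 1≤a ; coprime = g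
    ; root = trans (+-cong (+-congˡ (+-congʳ (*-congʳ eb))) ec)
               (solve 3 (λ A x y → (A :* (x :* x :- y :* y) :- :0 :* (x :* y :+ y :* x)) :+ ((:- (:2 :* (A :* x))) :* x :- :0 :* y) :+ A :* (x :* x :+ y :* y) := :0) refl (ℕ→ℝ a) x y) ,
             trans (+-congʳ (+-congˡ (+-congʳ (*-congʳ eb))))
               (solve 3 (λ A x y → (A :* (x :* y :+ y :* x) :+ :0 :* (x :* x :- y :* y)) :+ ((:- (:2 :* (A :* x))) :* y :+ :0 :* x) :+ :0 := :0) refl (ℕ→ℝ a) x y)
    ; discriminant = ≡.refl }

  abs-discriminant : ∀ d n → ℤ→ℝ d ≈ - ℕ→ℝ n → ℤ.∣ d ∣ ≡ n
  abs-discriminant d n e = ≡.trans (≡.cong ℤ.∣_∣ (ℤ→ℝ-injective {d} {ℤ.- (+ n)} (trans e (sym (ℤ→ℝ-neg (+ n)))))) (ℤₚ.∣-i∣≡∣i∣ (+ n))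

  -- As a is coprime to b and divides a′ b, it divides a′; by symmetry a = a′, and then b = b′ by
  -- cancellation.
  cross-coprime : ∀ {a b a′ b′} → 1 ℕ.≤ a → gcd a b ≡ 1 → gcd a′ b′ ≡ 1 → a ℕ.* b′ ≡ a′ ℕ.* b → _≡_ {A = Point} (a , b) (a′ , b′)
  cross-coprime {a} {b} {a′} {b′} 1≤a g g′ e = ≡.cong₂ _,_ a≡a′ (≡.sym (ℕₚ.*-cancelˡ-≡ b′ b a {{ℕ.>-nonZero 1≤a}}
    (≡.trans e (≡.cong (ℕ._* b) (≡.sym a≡a′)))))
    where
    a≡a′ : a ≡ a′
    a≡a′ = Div.∣-antisym
      (coprime-divisor (gcd≡1⇒coprime g) (≡.subst (a Div.∣_) (≡.trans e (ℕₚ.*-comm a′ b)) (Div.m∣m*n b′)))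
      (coprime-divisor (gcd≡1⇒coprime g′) (≡.subst (a′ Div.∣_) (≡.trans (≡.sym e) (ℕₚ.*-comm a b′)) (Div.m∣m*n b)))

  -- The forms [a, a, c] and [a, b, a] repeat a coefficient, and this reduces their primitivity to
  -- coprimality of the pair.
  gcd-repeat : ∀ a b → gcd a (gcd a b) ≡ gcd a b
  gcd-repeat a b = Div.∣-antisym (gcd[m,n]∣n a (gcd a b)) (gcd-greatest (gcd[m,n]∣m a b) Div.∣-refl)

  -- Limits along real Δ of quotients of counts that only depend on ⌊Δ⌋

  floor : ∀ {Δ} → 0# ≤ Δ → ∃[ n ] (ℕ→ℝ n ≤ Δ × Δ < ℕ→ℝ (suc n))
  floor {Δ} Δ≥0 =
    let (N , Δ≤N) = archimedean Δ
        (n , p , q) = last-true (λ n → ℕ→ℝ n ≤ Δ) (suc N) Δ≥0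
          (λ r → <⇒≱ (<-by {1#} 0<1 (solve 1 (λ n → :1 := :1 :+ n :- n) refl (ℕ→ℝ N))) (≤-trans r Δ≤N))
    in n , p , ≰⇒> q

  ratio-limit : ∀ {f g : ℝ → ℕ} {p q : ℕ → ℕ} {L L′} →
    (∀ {Δ n} → ℕ→ℝ n ≤ Δ → Δ < ℕ→ℝ (suc n) → f Δ ≡ p n) →
    (∀ {Δ n} → ℕ→ℝ n ≤ Δ → Δ < ℕ→ℝ (suc n) → g Δ ≡ q n) →
    (∀ ε → 0# < ε → ∃[ N ] (∀ n → N ℕ.≤ n → ∣ ℕ→ℝ (p n) / ℕ→ℝ (q n) - L ∣ < ε)) → L ≈ L′ →
    (λ Δ → ℕ→ℝ (f Δ) / ℕ→ℝ (g Δ)) ⟶ L′ [at-∞]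
  ratio-limit {f} {g} {p} {q} {L} {L′} ef eg h L≈L′ ε ε>0 =
    let (N , bound) = h ε ε>0 in ℕ→ℝ N , λ Δ N≤Δ →
      let (n , n≤Δ , Δ<n+1) = floor (≤-trans (ℕ→ℝ≥0 N) N≤Δ)
      in ≤-<-trans (abs-≤ (±-respˡ
           (+-cong (≡→≈ (≡.cong₂ (λ x y → ℕ→ℝ x / ℕ→ℝ y) (≡.sym (ef n≤Δ Δ<n+1)) (≡.sym (eg n≤Δ Δ<n+1)))) (-‿cong L≈L′))
           (±-abs (ℕ→ℝ (p n) / ℕ→ℝ (q n) - L))))
         (bound n (ℕₚ.≤-pred (ℕ→ℝ-mono<⁻ (≤-<-trans N≤Δ Δ<n+1))))

  -- The left boundary

  ℕ→ℝ-∸ : ∀ m n → n ℕ.≤ m → ℕ→ℝ (m ℕ.∸ n) ≈ ℕ→ℝ m - ℕ→ℝ n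
  ℕ→ℝ-∸ m n n≤m = trans (solve 2 (λ d n → d := n :+ d :- n) refl (ℕ→ℝ (m ℕ.∸ n)) (ℕ→ℝ n))
    (+-congʳ (trans (sym (ℕ→ℝ-+ n (m ℕ.∸ n))) (≡→≈ (≡.cong ℕ→ℝ (ℕₚ.m+[n∸m]≡n n≤m)))))

  ≥1⇒ℕ→ℝ>0 : ∀ {n} → 1 ℕ.≤ n → 0# < ℕ→ℝ n
  ≥1⇒ℕ→ℝ>0 {suc n} _ = ℕ→ℝ>0 n

  quarter : ℝ → ℝ
  quarter x = half (half x)

  4*quarter : ∀ x → ℕ→ℝ 4 * quarter x ≈ x
  4*quarter x = trans (solve 1 (λ q → :4 :* q := (q :+ q) :+ (q :+ q)) refl (quarter x))
    (trans (+-cong (half-sum (half x)) (half-sum (half x))) (half-sum x))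

  2*quarter : ∀ x → ℕ→ℝ 2 * quarter x ≈ half x
  2*quarter x = trans (solve 1 (λ q → :2 :* q := q :+ q) refl (quarter x)) (half-sum (half x))

  log-cong : ∀ {x y} → 1# ≤ x → x ≈ y → log x ≈ log y
  log-cong {x} p e = Deriv.H-cong (Deriv-log {x}) (p , ≤-refl) (≤-respʳ e p , ≤-reflexive (sym e)) e

  slope-≥ : ∀ {u v} a b → 1 ℕ.≤ a → Closed u v (a , b) → u ≤ ℕ→ℝ b / ℕ→ℝ a
  slope-≥ a b 1≤a (h , _) = cancel≤ (≥1⇒ℕ→ℝ>0 1≤a) (≤-respʳ (sym (trans (*-comm _ _) (/-cancel (>⇒≉ (≥1⇒ℕ→ℝ>0 1≤a))))) h)

  slope-≤ : ∀ {u v} a b → 1 ℕ.≤ a → Closed u v (a , b) → ℕ→ℝ b / ℕ→ℝ a ≤ v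
  slope-≤ a b 1≤a (_ , k) = cancel≤ (≥1⇒ℕ→ℝ>0 1≤a) (≤-respˡ (sym (trans (*-comm _ _) (/-cancel (>⇒≉ (≥1⇒ℕ→ℝ>0 1≤a))))) k)

  slope-injective : ∀ a b a′ b′ → 1 ℕ.≤ a → 1 ℕ.≤ a′ → ℕ→ℝ b / ℕ→ℝ a ≈ ℕ→ℝ b′ / ℕ→ℝ a′ → a ℕ.* b′ ≡ a′ ℕ.* b
  slope-injective a b a′ b′ 1≤a 1≤a′ e = ℕ→ℝ-injective (trans (ℕ→ℝ-* a b′) (trans
    (trans (*-congˡ (sym (/-cancel (>⇒≉ (≥1⇒ℕ→ℝ>0 1≤a′))))) (trans (*-congˡ (*-congʳ (sym e)))
      (solve 3 (λ a s a′ → a :* (s :* a′) := a′ :* (s :* a)) refl (ℕ→ℝ a) (ℕ→ℝ b / ℕ→ℝ a) (ℕ→ℝ a′))))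
    (trans (*-congˡ (/-cancel (>⇒≉ (≥1⇒ℕ→ℝ>0 1≤a)))) (sym (ℕ→ℝ-* a′ b)))))

  gcd-nonneg : ∀ {a b c a′ b′ c′} → a ≡ + a′ → b ≡ + b′ → c ≡ + c′ → ℤGCD.gcd a (ℤGCD.gcd b c) ≡ + 1 → gcd a′ (gcd b′ c′) ≡ 1
  gcd-nonneg ≡.refl ≡.refl ≡.refl e = ℤₚ.+-injective e

  double-ratio : ∀ {x y} → ¬ (y ≈ 0#) → x / y ≈ (ℕ→ℝ 2 * x) / (ℕ→ℝ 2 * y)
  double-ratio {x} {y} n = /-unique (λ e → n (zero-product e 2≉0))
    (trans (solve 2 (λ q y → q :* (:2 :* y) := :2 :* (q :* y)) refl (x / y) y) (*-congˡ (/-cancel n)))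

  module LeftBoundaryForm where

    -- The absolute discriminant of [a, a, c]. Slopes of at least 1 mean a ≤ c, so the truncated
    -- subtraction is exact there.
    D₁ : ℕ → ℕ → ℕ
    D₁ a c = a ℕ.* (4 ℕ.* c ℕ.∸ a)

    D₁-homogeneous : ∀ g a c → D₁ (g ℕ.* a) (g ℕ.* c) ≡ g ℕ.* g ℕ.* D₁ a c
    D₁-homogeneous g a c = ≡.trans
      (≡.cong (g ℕ.* a ℕ.*_) (≡.trans
        (≡.cong (ℕ._∸ g ℕ.* a) (≡.trans (≡.sym (ℕₚ.*-assoc 4 g c)) (≡.trans (≡.cong (ℕ._* c) (ℕₚ.*-comm 4 g)) (ℕₚ.*-assoc g 4 c))))
        (≡.sym (ℕₚ.*-distribˡ-∸ g (4 ℕ.* c) a))))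
      (ℕₚ.[m*n]*[o*p]≡[m*o]*[n*p] g a g (4 ℕ.* c ℕ.∸ a))

    D₁-real : ∀ a c → ℕ→ℝ a ≤ ℕ→ℝ c → ℕ→ℝ (D₁ a c) ≈ ℕ→ℝ a * (ℕ→ℝ 4 * ℕ→ℝ c - ℕ→ℝ a)
    D₁-real a c a≤c = trans (ℕ→ℝ-* a (4 ℕ.* c ℕ.∸ a)) (*-congˡ (trans
      (ℕ→ℝ-∸ (4 ℕ.* c) a (ℕₚ.≤-trans (ℕ→ℝ-mono⁻ a≤c) (ℕₚ.m≤m+n c _))) (+-congʳ (ℕ→ℝ-* 4 c))))

    b≥a : ∀ {u v a b} → 1# ≤ u → Closed u v (a , b) → ℕ→ℝ a ≤ ℕ→ℝ b
    b≥a {a = a} 1≤u (h , _) = ≤-trans (≤-respˡ (*-identityʳ _) (*-monoˡ (ℕ→ℝ≥0 a) 1≤u)) h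

    -- The function q of this family: D = a² (4s - 1) at slope s = c/a.
    level : ℝ → ℝ
    level x = ℕ→ℝ 4 * x - 1#

    level≥3 : ∀ {x} → 1# ≤ x → ℕ→ℝ 3 ≤ level x
    level≥3 {x} p = ≤-by (ℕ→ℝ≥0 4 ⊠ gap p) (solve 1 (λ x → :4 :* (x :- :1) := :4 :* x :- :1 :- con (+ 3)) refl x)

    1≤3 : 1# ≤ ℕ→ℝ 3
    1≤3 = ≤-by (ℕ→ℝ≥0 2) (solve 0 (:2 := con (+ 3) :- :1) refl)

    level≥1 : ∀ {x} → 1# ≤ x → 1# ≤ level x
    level≥1 p = ≤-trans 1≤3 (level≥3 p)

    level-mono : ∀ {u v} → u ≤ v → level u ≤ level v
    level-mono {u} {v} p = ≤-by (ℕ→ℝ≥0 4 ⊠ gap p) (solve 2 (λ u v → :4 :* (v :- u) := (:4 :* v :- :1) :- (:4 :* u :- :1)) refl u v)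

    L₁ : ℝ → ℝ
    L₁ x = quarter (log (level x))

    4ΔL₁ : ∀ u v → log (level v) - log (level u) ≈ ℕ→ℝ 4 * (L₁ v - L₁ u)
    4ΔL₁ u v = trans (+-cong (sym (4*quarter _)) (-‿cong (sym (4*quarter _))))
      (solve 2 (λ x y → :4 :* y :- :4 :* x := :4 :* (y :- x)) refl (L₁ u) (L₁ v))

    form₁ : ∀ t → Form 1# t
    form₁ t = record
      { D = D₁ ; homogeneous = D₁-homogeneous ; L = L₁
      -- As `level` is increasing, its extremes on [u, v] are the values at the ends; slopes of at
      -- least 1 give the constant 3.
      ; lo = λ u v → level u ; hi = λ u v → level v ; c = ℕ→ℝ 3 ; K = ℕ→ℝ 4
      ; s≥0 = <⇒≤ 0<1 ; c>0 = ℕ→ℝ>0 2 ; K≥0 = ℕ→ℝ≥0 4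
      ; c≤lo = λ p _ _ → level≥3 p
      ; lo≤hi = λ _ p _ → level-mono p
      ; hi-lo = λ {u} {v} _ _ _ → ≤-reflexive (solve 2 (λ u v → (:4 :* v :- :1) :- (:4 :* u :- :1) := :4 :* (v :- u)) refl u v)
      ; D-lo = λ {u} {v} p _ _ {a} {b} z → ≤-respʳ (sym (D₁-real a b (b≥a {a = a} {b} p z)))
          (≤-by (ℕ→ℝ≥0 4 ⊠ ℕ→ℝ≥0 a ⊠ gap (proj₁ z))
            (solve 3 (λ u a b → :4 :* a :* (b :- a :* u) := a :* (:4 :* b :- a) :- (:4 :* u :- :1) :* (a :* a)) refl u (ℕ→ℝ a) (ℕ→ℝ b)))
      ; D-hi = λ {u} {v} p _ _ {a} {b} z → ≤-respˡ (sym (D₁-real a b (b≥a {a = a} {b} p z)))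
          (≤-by (ℕ→ℝ≥0 4 ⊠ ℕ→ℝ≥0 a ⊠ gap (proj₂ z))
            (solve 3 (λ v a b → :4 :* a :* (a :* v :- b) := (:4 :* v :- :1) :* (a :* a) :- a :* (:4 :* b :- a)) refl v (ℕ→ℝ a) (ℕ→ℝ b)))
      ; L-lo = λ {u} {v} p q _ → cancel≤ (ℕ→ℝ>0 3) (≤-resp (difference u v _) (4ΔL₁ u v) (log-lower (level≥1 p) (level-mono q)))
      ; L-hi = λ {u} {v} p q _ → cancel≤ (ℕ→ℝ>0 3) (≤-resp (4ΔL₁ u v) (difference u v _) (log-upper (level≥1 p) (level-mono q)))
      }
      where
      difference : ∀ u v i → (level v - level u) * i ≈ ℕ→ℝ 4 * ((v - u) * i)
      difference = solve 3 (λ u v i → ((:4 :* v :- :1) :- (:4 :* u :- :1)) :* i := :4 :* ((v :- u) :* i)) refl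

  open LeftBoundaryForm

  √3/2>0 : 0# < √3/2
  √3/2>0 = (proj₁ (√-spec (ℕ→ℝ≥0 3)) , λ e → ℕ→ℝ≉0 2 (trans (sym (proj₂ (√-spec (ℕ→ℝ≥0 3))))
    (trans (*-congʳ (sym e)) (zeroˡ _)))) ⊠⁺ inv>0 (ℕ→ℝ>0 1)

  4*√3/2² : ℕ→ℝ 4 * (√3/2 * √3/2) ≈ ℕ→ℝ 3
  4*√3/2² = trans (solve 1 (λ q → :4 :* (q :* q) := (q :* :2) :* (q :* :2)) refl √3/2)
    (trans (*-cong (/-cancel 2≉0) (/-cancel 2≉0)) (proj₂ (√-spec (ℕ→ℝ≥0 3))))

  4*½² : ℕ→ℝ 4 * (½ * ½) ≈ 1#
  4*½² = trans (solve 1 (λ h → :4 :* (h :* h) := (h :+ h) :* (h :+ h)) refl ½) (trans (*-cong ½+½ ½+½) (*-identityˡ 1#))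

  -- |τ|² for τ = -½ + i y, which is the slope c/a.
  norm² : ℝ → ℝ
  norm² y = y * y + ½ * ½

  level-norm² : ∀ y → level (norm² y) ≈ ℕ→ℝ 4 * (y * y)
  level-norm² y = trans (solve 2 (λ y h → :4 :* (y :* y :+ h) :- :1 := :4 :* (y :* y) :+ (:4 :* h :- :1)) refl y (½ * ½))
    (trans (+-congˡ (gap₀ (sym 4*½²))) (+-identityʳ _))

  norm²-mono : ∀ {x y} → 0# ≤ x → x ≤ y → norm² x ≤ norm² y
  norm²-mono p q = +-mono-≤ _ (*-mono p p q q)

  norm²≥1 : ∀ {y} → √3/2 ≤ y → 1# ≤ norm² y
  norm²≥1 {y} p = cancel≤ (ℕ→ℝ>0 3) (≤-by (ℕ→ℝ≥0 4 ⊠ gap (*-mono (<⇒≤ √3/2>0) (<⇒≤ √3/2>0) p p)) (trans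
    (solve 2 (λ y q → :4 :* (y :* y :- q) := :4 :* (y :* y) :- :4 :* q) refl y (√3/2 * √3/2))
    (trans (+-congˡ (-‿cong 4*√3/2²)) (trans
      (solve 1 (λ y → :4 :* (y :* y) :- con (+ 3) := :4 :* (y :* y) :+ :1 :- :4 :* :1) refl y)
      (+-congʳ (trans (+-congˡ (sym 4*½²)) (sym (distribˡ _ _ _))))))))

  -- At s = y² + ¼ one has 4s - 1 = 4y², so 2 L₁ becomes ½ log (4y²) with derivative 1/y. The factor
  -- 4 stays inside the logarithm because y may be smaller than 1, while 4y² ≥ 3.
  ∫-1/y : ∀ {X Y} → √3/2 ≤ X → X ≤ Y → ∫ X Y (λ y → 1# / y) ≈ ℕ→ℝ 2 * (L₁ (norm² Y) - L₁ (norm² X))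
  ∫-1/y {X} {Y} √3/2≤X X≤Y = trans (∫-Deriv X≤Y derivative) (trans
    (+-cong (antiderivative (≤-trans √3/2≤X X≤Y)) (-‿cong (antiderivative √3/2≤X)))
    (solve 2 (λ x y → :2 :* y :- :2 :* x := :2 :* (y :- x)) refl (L₁ (norm² X)) (L₁ (norm² Y))))
    where
    H : ℝ → ℝ
    H y = ½ * log (ℕ→ℝ 4 * (y * y))
    antiderivative : ∀ {y} → √3/2 ≤ y → H y ≈ ℕ→ℝ 2 * L₁ (norm² y)
    antiderivative {y} p = sym (trans (2*quarter _) (trans (half≈½* _) (*-congˡ (log-cong (level≥1 (norm²≥1 p)) (level-norm² y)))))
    inside : ∀ {y} → y ∈[ X , Y ] → ℕ→ℝ 4 * (y * y) ∈[ 1# , ℕ→ℝ 4 * (Y * Y) ]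
    inside {y} (p , q) = ≤-respʳ (level-norm² y) (level≥1 (norm²≥1 (≤-trans √3/2≤X p))) ,
      *-monoˡ (ℕ→ℝ≥0 4) (*-mono y≥0 y≥0 q q)
      where
      y≥0 = ≤-trans (<⇒≤ √3/2>0) (≤-trans √3/2≤X p)
    derivative : Deriv X Y H (λ y → 1# / y)
    derivative = Deriv-cong (λ _ → refl)
      (λ {y} y∈ → let i = (ℕ→ℝ 4 * (y * y)) ⁻¹ in trans (inv-unique (trans
          (solve 3 (λ y i h → y :* (h :* (:1 :* i :* (:4 :* (:1 :* y :+ y :* :1)))) := (h :+ h) :* (:4 :* (y :* y) :* i)) refl y i ½)
          (trans (*-cong ½+½ (inv-right (>⇒≉ (≥1⇒>0 (proj₁ (inside y∈)))))) (*-identityˡ 1#)))) (sym (*-identityˡ _)))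
      (Deriv-scale ½ (Deriv-∘ inside Deriv-log (Deriv-scale (ℕ→ℝ 4) (Deriv-* Deriv-id Deriv-id))))

  module _ {K : ℝ} (√3/2<K : √3/2 < K) where
    private
      s≤t : 1# ≤ norm² K
      s≤t = norm²≥1 (<⇒≤ √3/2<K)

    open Primitive (form₁ (norm² K)) s≤t

    module _ {X Y : ℝ} (√3/2≤X : √3/2 ≤ X) (X≤Y : X ≤ Y) (Y≤K : Y ≤ K) where
      private
        X≥0 : 0# ≤ X
        X≥0 = ≤-trans (<⇒≤ √3/2>0) √3/2≤X
        Y≥0 : 0# ≤ Y
        Y≥0 = ≤-trans X≥0 X≤Y
        Y≤ : norm² Y ≤ norm² K
        Y≤ = norm²-mono Y≥0 Y≤K
        u = norm² X
        v = norm² Y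

        -- The root in ℋ of the form [a, a, c].
        point : Point → ℂ
        point (a , c) = - ½ , √ (ℕ→ℝ c / ℕ→ℝ a - ½ * ½)

        Segment : ℝ → Pred ℂ 0ℓ
        Segment Δ τ = τ ∈ CMᴸᴮ Δ × X ≤ im τ × im τ ≤ Y

        module Ordinate {n a c : ℕ} (q : Prim u v n (a , c)) where
          1≤a = proj₁ (proj₁ q)
          y = √ (ℕ→ℝ c / ℕ→ℝ a - ½ * ½)
          X²≤ : X * X ≤ ℕ→ℝ c / ℕ→ℝ a - ½ * ½
          X²≤ = ≤-by (gap (slope-≥ a c 1≤a (proj₁ (proj₂ (proj₁ q)))))
            (solve 3 (λ s x h → s :- (x :+ h) := s :- h :- x) refl (ℕ→ℝ c / ℕ→ℝ a) (X * X) (½ * ½))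
          ≤Y² : ℕ→ℝ c / ℕ→ℝ a - ½ * ½ ≤ Y * Y
          ≤Y² = ≤-by (gap (slope-≤ a c 1≤a (proj₁ (proj₂ (proj₁ q)))))
            (solve 3 (λ s x h → (x :+ h) :- s := x :- (s :- h)) refl (ℕ→ℝ c / ℕ→ℝ a) (Y * Y) (½ * ½))
          y≥0 : 0# ≤ y
          y≥0 = proj₁ (√-spec (≤-trans (sq≥0 X) X²≤))
          y² : y * y ≈ ℕ→ℝ c / ℕ→ℝ a - ½ * ½
          y² = proj₂ (√-spec (≤-trans (sq≥0 X) X²≤))
          X≤y : X ≤ y
          X≤y = sq-cancel≤ y≥0 (≤-respʳ (sym y²) X²≤)
          y≤Y : y ≤ Y
          y≤Y = sq-cancel≤ Y≥0 (≤-respˡ (sym y²) ≤Y²)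

      module _ {Δ : ℝ} {n : ℕ} (n≤Δ : ℕ→ℝ n ≤ Δ) (Δ<n+1 : Δ < ℕ→ℝ (suc n)) where
        private
          into : ∀ {x} → Prim u v n x → Segment Δ (point x)
          into {a , c} q@((_ , z , d≤n) , g) =
            ((_ , cm , ≤-trans (≤-respˡ (≡→≈ (≡.cong ℕ→ℝ (≡.sym disc))) (ℕ→ℝ-mono d≤n)) n≤Δ) ,
             (y , ≤-trans √3/2≤X X≤y , (refl , refl))) , X≤y , y≤Y
            where
            open Ordinate q
            A = ℕ→ℝ a
            C′ = ℕ→ℝ c
            cm = mk-CMPoint { - ½} {y} a (+ a) (+ c) (<-≤-trans √3/2>0 (≤-trans √3/2≤X X≤y)) 1≤a
              (≡.cong +_ (≡.trans (gcd-repeat a c) g))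
              (trans (sym (trans (*-congˡ ½+½) (*-identityʳ A))) (solve 2 (λ A h → A :* (h :+ h) := :- (:2 :* (A :* (:- h)))) refl A ½))
              (trans (sym (/-cancel (>⇒≉ (≥1⇒ℕ→ℝ>0 1≤a)))) (trans
                (solve 3 (λ s A h → s :* A := A :* ((:- h) :* (:- h) :+ (s :- h :* h))) refl (C′ / A) A ½)
                (*-congˡ (+-congˡ (sym y²)))))
            disc = abs-discriminant (+ a ℤ.* + a ℤ.- + 4 ℤ.* + a ℤ.* + c) (D₁ a c) (trans (CMPoint.d-equation cm) (trans
              (solve 2 (λ A C → A :* A :- :4 :* A :* C := :- (A :* (:4 :* C :- A))) refl A C′)
              (-‿cong (sym (D₁-real a c (b≥a {a = a} {c} (norm²≥1 √3/2≤X) z))))))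

          injective : ∀ {x x′} → Prim u v n x → Prim u v n x′ → point x ≈ᶜ point x′ → x ≡ x′
          injective {a , c} {a′ , c′} q q′ (_ , e) = cross-coprime (proj₁ (proj₁ q)) (proj₂ q) (proj₂ q′)
            (slope-injective a c a′ c′ (proj₁ (proj₁ q)) (proj₁ (proj₁ q′)) (≈-by (gap₀ (trans (sym (Ordinate.y² q)) (trans (*-cong e e) (Ordinate.y² q′))))
              (solve 3 (λ s s′ h → s′ :- h :- (s :- h) := s′ :- s) refl (ℕ→ℝ c / ℕ→ℝ a) (ℕ→ℝ c′ / ℕ→ℝ a′) (½ * ½))))

          onto : ∀ {τ} → Segment Δ τ → ∃[ x ] (Prim u v n x × point x ≈ᶜ τ)
          onto {x , y} (((d , cm , d≤Δ) , (y₀ , √3/2≤y₀ , (x≈ , _))) , X≤y , y≤Y) =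
            (a′ , c′) , (((1≤a′ , closed , d≤n) , ≡.trans (≡.sym (gcd-repeat a′ c′)) (gcd-nonneg a≡ (≡.trans b≡a a≡) c≡ coprime)) ,
              (sym x≈ , √-unique (≤-trans X≥0 X≤y) (trans (solve 2 (λ y h → y := (y :+ h) :- h) refl (y * y) (½ * ½)) (+-congʳ slope))))
            where
            open IsCMPointOfDiscriminant cm
            open CMPoint cm
            a′ = proj₁ positive-a
            1≤a′ = proj₁ (proj₂ positive-a)
            a≡ = proj₂ (proj₂ positive-a)
            A≈ : A ≈ ℕ→ℝ a′
            A≈ = ≡→≈ (≡.cong ℤ→ℝ a≡)
            A≥0 : 0# ≤ A
            A≥0 = ≤-respʳ (sym A≈) (ℕ→ℝ≥0 a′)
            -- The trace of τ is -1, which forces b = a.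
            B≈A : B ≈ A
            B≈A = trans b-equation (trans (-‿cong (*-congˡ (*-congˡ x≈))) (trans
              (solve 2 (λ A h → :- (:2 :* (A :* (:- h))) := A :* (h :+ h)) refl A ½) (trans (*-congˡ ½+½) (*-identityʳ A))))
            b≡a : b ≡ a
            b≡a = ℤ→ℝ-injective B≈A
            C≈ : C′ ≈ A * norm² y
            C≈ = trans c-equation (*-congˡ (trans (+-congʳ (*-cong x≈ x≈)) (solve 2 (λ h y → (:- h) :* (:- h) :+ y := y :+ h :* h) refl ½ (y * y))))
            nat-c = nonneg-integer c (≤-respʳ (sym C≈) (A≥0 ⊠ (sq≥0 y ⊞ sq≥0 ½)))
            c′ = proj₁ nat-c
            c≡ = proj₂ nat-c
            rc≈ : ℕ→ℝ c′ ≈ ℕ→ℝ a′ * norm² y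
            rc≈ = trans (sym (≡→≈ (≡.cong ℤ→ℝ c≡))) (trans C≈ (*-congʳ A≈))
            closed : Closed u v (a′ , c′)
            closed = ≤-respʳ (sym rc≈) (*-monoˡ (ℕ→ℝ≥0 a′) (norm²-mono X≥0 X≤y)) ,
                     ≤-respˡ (sym rc≈) (*-monoˡ (ℕ→ℝ≥0 a′) (norm²-mono (≤-trans X≥0 X≤y) y≤Y))
            slope : norm² y ≈ ℕ→ℝ c′ / ℕ→ℝ a′
            slope = /-unique (>⇒≉ (≥1⇒ℕ→ℝ>0 1≤a′)) (trans (*-comm _ _) (sym rc≈))
            disc : ℤ.∣ d ∣ ≡ D₁ a′ c′
            disc = abs-discriminant d (D₁ a′ c′) (trans d-equation (trans
              (+-cong (*-cong (trans B≈A A≈) (trans B≈A A≈)) (-‿cong (*-cong (*-congˡ A≈) (≡→≈ (≡.cong ℤ→ℝ c≡)))))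
              (trans (solve 2 (λ A C → A :* A :- :4 :* A :* C := :- (A :* (:4 :* C :- A))) refl (ℕ→ℝ a′) (ℕ→ℝ c′))
                (-‿cong (sym (D₁-real a′ c′ (b≥a {a = a′} {c′} (norm²≥1 √3/2≤X) closed)))))))
            -- The discriminant is an integer, so a bound by Δ < n + 1 is a bound by n.
            d≤n : D₁ a′ c′ ℕ.≤ n
            d≤n = ≡.subst (ℕ._≤ n) disc (ℕₚ.≤-pred (ℕ→ℝ-mono<⁻ (≤-<-trans d≤Δ Δ<n+1)))

        #-segment : # Segment Δ ≡ count (Prim u v n)
        #-segment = #-count (listing-prim (norm²≥1 √3/2≤X) Y≤ n) point into injective onto

  left-boundary : (K : ℝ) → √3/2 < K → (X Y : ℝ) → √3/2 ≤ X → X ≤ Y → Y ≤ K →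
    (λ Δ → ℕ→ℝ (# (λ τ → τ ∈ CMᴸᴮ Δ × X ≤ im τ × im τ ≤ Y))
         / ℕ→ℝ (# (λ τ → τ ∈ CMᴸᴮ Δ × √3/2 ≤ im τ × im τ ≤ K)))
    ⟶ ∫ X Y (λ y → 1# / y) / ∫ √3/2 K (λ y → 1# / y) [at-∞]
  left-boundary K √3/2<K X Y √3/2≤X X≤Y Y≤K = ratio-limit
    (#-segment √3/2<K √3/2≤X X≤Y Y≤K)
    (#-segment √3/2<K ≤-refl (<⇒≤ √3/2<K) ≤-refl)
    (prim-ratio (norm²≥1 √3/2≤X) (norm²-mono X≥0 X≤Y) (norm²-mono (≤-trans X≥0 X≤Y) Y≤K)
      (norm²≥1 ≤-refl) (norm²-mono (<⇒≤ √3/2>0) (<⇒≤ √3/2<K)) ≤-refl κ>0)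
    -- Each integral is twice the corresponding increment of `L₁`, and the factor 2 cancels in the
    -- quotient.
    (trans (double-ratio (>⇒≉ κ>0)) (sym (/-cong ∫≉0 (∫-1/y √3/2≤X X≤Y) (∫-1/y ≤-refl (<⇒≤ √3/2<K)))))
    where
    open Primitive (form₁ (norm² K)) (norm²≥1 (<⇒≤ √3/2<K))
    X≥0 : 0# ≤ X
    X≥0 = ≤-trans (<⇒≤ √3/2>0) √3/2≤X
    κ>0 : 0# < L₁ (norm² K) - L₁ (norm² √3/2)
    κ>0 = <-≤-trans
      (<-by (gap⁺ √3/2<K ⊠⁺ (√3/2>0 ⊞⁺ <⇒≤ (<-trans √3/2>0 √3/2<K)))
        (solve 3 (λ x y h → (y :- x) :* (x :+ y) := (y :* y :+ h :- (x :* x :+ h)) :- :0) refl √3/2 K (½ * ½))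
        ⊠⁺ inv>0 (≥1⇒>0 (level≥1 (norm²≥1 (<⇒≤ √3/2<K)))))
      (Form.L-lo (form₁ (norm² K)) (norm²≥1 ≤-refl) (norm²-mono (<⇒≤ √3/2>0) (<⇒≤ √3/2<K)) ≤-refl)
    ∫≉0 : ¬ (∫ √3/2 K (λ y → 1# / y) ≈ 0#)
    ∫≉0 e = >⇒≉ κ>0 (zero-product (trans (sym (∫-1/y ≤-refl (<⇒≤ √3/2<K))) e) 2≉0)

  -- The lower arc

  inv-sum : ∀ {x y} → ¬ (x ≈ 0#) → ¬ (y ≈ 0#) → x ⁻¹ + y ⁻¹ ≈ x ⁻¹ * y ⁻¹ * (x + y)
  inv-sum {x} {y} p q = sym (trans
    (solve 4 (λ x y i j → i :* j :* (x :+ y) := (x :* i) :* j :+ (y :* j) :* i) refl x y (x ⁻¹) (y ⁻¹))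
    (trans (+-cong (trans (*-congʳ (inv-right p)) (*-identityˡ _)) (trans (*-congʳ (inv-right q)) (*-identityˡ _))) (+-comm _ _)))

  inv-product : ∀ {x y} → ¬ (x ≈ 0#) → ¬ (y ≈ 0#) → x ⁻¹ * y ⁻¹ ≈ (x * y) ⁻¹
  inv-product {x} {y} p q = inv-unique (trans
    (solve 4 (λ x y i j → x :* y :* (i :* j) := (x :* i) :* (y :* j)) refl x y (x ⁻¹) (y ⁻¹))
    (trans (*-cong (inv-right p) (inv-right q)) (*-identityˡ 1#)))

  module LowerArcForm where

    -- The absolute discriminant of [a, b, a]; on slopes in [0, 1] one has b ≤ a, so the truncated
    -- subtraction is exact.
    D₂ : ℕ → ℕ → ℕ
    D₂ a b = 4 ℕ.* (a ℕ.* a) ℕ.∸ b ℕ.* b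

    D₂-homogeneous : ∀ g a b → D₂ (g ℕ.* a) (g ℕ.* b) ≡ g ℕ.* g ℕ.* D₂ a b
    D₂-homogeneous g a b = ≡.trans
      (≡.cong₂ ℕ._∸_
        (≡.trans (≡.cong (4 ℕ.*_) (ℕₚ.[m*n]*[o*p]≡[m*o]*[n*p] g a g a))
          (≡.trans (≡.sym (ℕₚ.*-assoc 4 (g ℕ.* g) (a ℕ.* a)))
            (≡.trans (≡.cong (ℕ._* (a ℕ.* a)) (ℕₚ.*-comm 4 (g ℕ.* g))) (ℕₚ.*-assoc (g ℕ.* g) 4 (a ℕ.* a)))))
        (ℕₚ.[m*n]*[o*p]≡[m*o]*[n*p] g b g b))
      (≡.sym (ℕₚ.*-distribˡ-∸ (g ℕ.* g) (4 ℕ.* (a ℕ.* a)) (b ℕ.* b)))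

    D₂-real : ∀ a b → ℕ→ℝ b ≤ ℕ→ℝ a → ℕ→ℝ (D₂ a b) ≈ ℕ→ℝ 4 * (ℕ→ℝ a * ℕ→ℝ a) - ℕ→ℝ b * ℕ→ℝ b
    D₂-real a b b≤a = trans
      (ℕ→ℝ-∸ (4 ℕ.* (a ℕ.* a)) (b ℕ.* b) (ℕₚ.≤-trans (ℕₚ.*-mono-≤ (ℕ→ℝ-mono⁻ {b} {a} b≤a) (ℕ→ℝ-mono⁻ {b} {a} b≤a)) (ℕₚ.m≤m+n (a ℕ.* a) (3 ℕ.* (a ℕ.* a)))))
      (+-cong (trans (ℕ→ℝ-* 4 (a ℕ.* a)) (*-congˡ (ℕ→ℝ-* a a))) (-‿cong (ℕ→ℝ-* b b)))

    b≤a : ∀ {u v a b} → v ≤ 1# → Closed u v (a , b) → ℕ→ℝ b ≤ ℕ→ℝ a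
    b≤a {a = a} v≤1 (_ , k) = ≤-trans k (≤-respʳ (*-identityʳ _) (*-monoˡ (ℕ→ℝ≥0 a) v≤1))

    -- The factors of q(x) = 4 - x² = (2 + x)(2 - x). On [0, 1] both are at least 1, inside the
    -- domain of `log`.
    plus minus : ℝ → ℝ
    plus  x = ℕ→ℝ 2 + x
    minus x = ℕ→ℝ 2 - x

    plus≥1 : ∀ {x} → 0# ≤ x → 1# ≤ plus x
    plus≥1 {x} p = ≤-by (<⇒≤ 0<1 ⊞ p) (solve 1 (λ x → :1 :+ x := :2 :+ x :- :1) refl x)

    minus≥1 : ∀ {x} → x ≤ 1# → 1# ≤ minus x
    minus≥1 {x} p = ≤-by (gap p) (solve 1 (λ x → :1 :- x := :2 :- x :- :1) refl x)

    plus-mono : ∀ {u v} → u ≤ v → plus u ≤ plus v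
    plus-mono p = +-mono ≤-refl p

    minus-anti : ∀ {u v} → u ≤ v → minus v ≤ minus u
    minus-anti p = +-mono ≤-refl (neg-mono p)

    -- The primitive of 1 / (4 - x²) given by partial fractions.
    L₂ : ℝ → ℝ
    L₂ x = quarter (log (plus x) - log (minus x))

    4ΔL₂ : ∀ u v → ℕ→ℝ 4 * (L₂ v - L₂ u) ≈ (log (plus v) - log (plus u)) + (log (minus u) - log (minus v))
    4ΔL₂ u v = trans (solve 2 (λ x y → :4 :* (y :- x) := :4 :* y :- :4 :* x) refl (L₂ u) (L₂ v))
      (trans (+-cong (4*quarter _) (-‿cong (4*quarter _)))
        (solve 4 (λ a b c d → (c :- d) :- (a :- b) := (c :- a) :+ (b :- d)) refl (log (plus u)) (log (minus u)) (log (plus v)) (log (minus v))))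

    -- With w = v - u, i = 1/(2 + v) and j = 1/(2 - u), the two logarithms contribute at least w (i
    -- + j) = w i j (4 + w), and the nonnegative w² i j is dropped. In `L₂-upper` the sum i + j is i
    -- j (4 - w), so the sign of that term is again favourable.
    L₂-lower : ∀ {u v} → 0# ≤ u → u ≤ v → v ≤ 1# → (v - u) / (plus v * minus u) ≤ L₂ v - L₂ u
    L₂-lower {u} {v} 0≤u u≤v v≤1 = cancel≤ (ℕ→ℝ>0 3) (≤-respˡ (*-congˡ (*-congˡ (inv-product p≉0 m≉0)))
      (≤-by (gap u≤v ⊠ gap u≤v ⊠ (i≥0 ⊠ j≥0) ⊞ gap (log-lower (plus≥1 0≤u) (plus-mono u≤v)) ⊞ gap (log-lower (minus≥1 v≤1) (minus-anti u≤v)))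
        (trans (solve 8 (λ u v i j a b c d → (v :- u) :* (v :- u) :* (i :* j) :+ (a :- b :- (:2 :+ v :- (:2 :+ u)) :* i) :+ (c :- d :- (:2 :- u :- (:2 :- v)) :* j)
                    := (a :- b) :+ (c :- d) :- (v :- u) :* ((i :+ j) :- i :* j :* (v :- u))) refl
            u v i j (log (plus v)) (log (plus u)) (log (minus u)) (log (minus v)))
          (+-cong (sym (4ΔL₂ u v)) (-‿cong (trans (*-congˡ (+-congʳ (inv-sum p≉0 m≉0)))
            (solve 4 (λ u v i j → (v :- u) :* (i :* j :* ((:2 :+ v) :+ (:2 :- u)) :- i :* j :* (v :- u)) := :4 :* ((v :- u) :* (i :* j))) refl u v i j)))))))
      where
      p>0 = ≥1⇒>0 (plus≥1 (≤-trans 0≤u u≤v))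
      m>0 = ≥1⇒>0 (minus≥1 (≤-trans u≤v v≤1))
      p≉0 = >⇒≉ p>0
      m≉0 = >⇒≉ m>0
      i = plus v ⁻¹
      j = minus u ⁻¹
      i≥0 = <⇒≤ (inv>0 p>0)
      j≥0 = <⇒≤ (inv>0 m>0)

    L₂-upper : ∀ {u v} → 0# ≤ u → u ≤ v → v ≤ 1# → L₂ v - L₂ u ≤ (v - u) / (plus u * minus v)
    L₂-upper {u} {v} 0≤u u≤v v≤1 = cancel≤ (ℕ→ℝ>0 3) (≤-respʳ (*-congˡ (*-congˡ (inv-product p≉0 m≉0)))
      (≤-by (gap u≤v ⊠ gap u≤v ⊠ (i≥0 ⊠ j≥0) ⊞ gap (log-upper (plus≥1 0≤u) (plus-mono u≤v)) ⊞ gap (log-upper (minus≥1 v≤1) (minus-anti u≤v)))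
        (trans (solve 8 (λ u v i j a b c d → (v :- u) :* (v :- u) :* (i :* j) :+ ((:2 :+ v :- (:2 :+ u)) :* i :- (a :- b)) :+ ((:2 :- u :- (:2 :- v)) :* j :- (c :- d))
                    := (v :- u) :* ((i :+ j) :+ i :* j :* (v :- u)) :- ((a :- b) :+ (c :- d))) refl
            u v i j (log (plus v)) (log (plus u)) (log (minus u)) (log (minus v)))
          (+-cong (trans (*-congˡ (+-congʳ (inv-sum p≉0 m≉0)))
            (solve 4 (λ u v i j → (v :- u) :* (i :* j :* ((:2 :+ u) :+ (:2 :- v)) :+ i :* j :* (v :- u)) := :4 :* ((v :- u) :* (i :* j))) refl u v i j))
            (-‿cong (sym (4ΔL₂ u v)))))))
      where
      p>0 = ≥1⇒>0 (plus≥1 0≤u)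
      m>0 = ≥1⇒>0 (minus≥1 v≤1)
      p≉0 = >⇒≉ p>0
      m≉0 = >⇒≉ m>0
      i = plus u ⁻¹
      j = minus v ⁻¹
      i≥0 = <⇒≤ (inv>0 p>0)
      j≥0 = <⇒≤ (inv>0 m>0)

    form₂ : Form 0# 1#
    form₂ = record
      { D = D₂ ; homogeneous = D₂-homogeneous ; L = L₂
      -- Each monotone factor is bounded at its own end. These mixed products are coarser than the
      -- exact extremes, but they are what the logarithm estimates produce, and they differ by
      -- exactly 4 (v - u).
      ; lo = λ u v → plus u * minus v ; hi = λ u v → plus v * minus u ; c = ℕ→ℝ 2 ; K = ℕ→ℝ 4
      ; s≥0 = ≤-refl ; c>0 = ℕ→ℝ>0 1 ; K≥0 = ℕ→ℝ≥0 4
      ; c≤lo = λ {u} {v} p _ q → ≤-by (ℕ→ℝ≥0 2 ⊠ gap q ⊞ p ⊠ gap q ⊞ p)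
          (solve 2 (λ u v → :2 :* (:1 :- v) :+ u :* (:1 :- v) :+ u := (:2 :+ u) :* (:2 :- v) :- :2) refl u v)
      ; lo≤hi = λ {u} {v} _ p _ → ≤-by (ℕ→ℝ≥0 4 ⊠ gap p)
          (solve 2 (λ u v → :4 :* (v :- u) := (:2 :+ v) :* (:2 :- u) :- (:2 :+ u) :* (:2 :- v)) refl u v)
      ; hi-lo = λ {u} {v} _ _ _ → ≤-reflexive
          (solve 2 (λ u v → (:2 :+ v) :* (:2 :- u) :- (:2 :+ u) :* (:2 :- v) := :4 :* (v :- u)) refl u v)
      ; D-lo = λ {u} {v} p _ r {a} {b} z → ≤-respʳ (sym (D₂-real a b (b≤a {a = a} {b} r z)))
          (≤-by (gap (proj₁ z) ⊠ (2-v≥0 r ⊠ ℕ→ℝ≥0 a) ⊞ gap (proj₂ z) ⊠ ((ℕ→ℝ≥0 2 ⊞ p) ⊠ ℕ→ℝ≥0 a) ⊞ gap (proj₁ z) ⊠ gap (proj₂ z))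
            (solve 4 (λ u v a b → (b :- a :* u) :* ((:2 :- v) :* a) :+ (a :* v :- b) :* ((:2 :+ u) :* a) :+ (b :- a :* u) :* (a :* v :- b)
                        := :4 :* (a :* a) :- b :* b :- (:2 :+ u) :* (:2 :- v) :* (a :* a)) refl u v (ℕ→ℝ a) (ℕ→ℝ b)))
      ; D-hi = λ {u} {v} _ p r {a} {b} z → ≤-respˡ (sym (D₂-real a b (b≤a {a = a} {b} r z)))
          (≤-by (gap (proj₂ z) ⊠ (2-v≥0 (≤-trans p r) ⊠ ℕ→ℝ≥0 a) ⊞ gap (proj₁ z) ⊠ (ℕ→ℝ≥0 2 ⊠ ℕ→ℝ≥0 a ⊞ ℕ→ℝ≥0 b))
            (solve 4 (λ u v a b → (a :* v :- b) :* ((:2 :- u) :* a) :+ (b :- a :* u) :* (:2 :* a :+ b)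
                        := (:2 :+ v) :* (:2 :- u) :* (a :* a) :- (:4 :* (a :* a) :- b :* b)) refl u v (ℕ→ℝ a) (ℕ→ℝ b)))
      ; L-lo = L₂-lower
      ; L-hi = L₂-upper
      }
      where
      2-v≥0 : ∀ {v} → v ≤ 1# → 0# ≤ ℕ→ℝ 2 - v
      2-v≥0 p = ≤-trans (<⇒≤ 0<1) (minus≥1 p)

  open LowerArcForm

  -- The slope b/a of the form [a, b, a] with root e^iθ.
  slope : ℝ → ℝ
  slope θ = - (ℕ→ℝ 2 * cos θ)

  slope-π/2 : slope π/2 ≈ 0#
  slope-π/2 = trans (-‿cong (*-congˡ cos-π/2)) (solve 0 (:- (:2 :* :0) := :0) refl)

  slope-2π/3 : slope 2π/3 ≈ 1#
  slope-2π/3 = trans (-‿cong cos-2π/3) (solve 0 (:- (:- :1) := :1) refl)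

  module _ {θ : ℝ} (π/2≤θ : π/2 ≤ θ) (θ≤2π/3 : θ ≤ 2π/3) where

    θ>0 : 0# < θ
    θ>0 = <-≤-trans π/2>0 π/2≤θ

    θ<π : θ < π
    θ<π = ≤-<-trans θ≤2π/3 2π/3<π

    -π<θ : - π < θ
    -π<θ = <-by (π>0 ⊞⁺ <⇒≤ θ>0) (solve 2 (λ p t → p :+ t := t :- (:- p)) refl π θ)

  slope-mono : ∀ x y → 0# ≤ x → x ≤ y → y ≤ π → slope x ≤ slope y
  slope-mono x y p q r = neg-mono (*-monoˡ (ℕ→ℝ≥0 2) (cos-decreasing p q r))

  slope-reflects-≤ : ∀ x y → 0# ≤ y → x ≤ π → slope x ≤ slope y → x ≤ y
  slope-reflects-≤ x y p q r = cos-reflects-≤ p q (cancel≤ (ℕ→ℝ>0 1)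
    (≤-by (gap r) (solve 2 (λ c d → (:- (:2 :* d)) :- (:- (:2 :* c)) := :2 :* c :- :2 :* d) refl (cos x) (cos y))))

  slope≥0 : ∀ θ → π/2 ≤ θ → θ ≤ 2π/3 → 0# ≤ slope θ
  slope≥0 θ p q = ≤-respˡ slope-π/2 (slope-mono π/2 θ (<⇒≤ π/2>0) p (<⇒≤ (θ<π p q)))

  slope≤1 : ∀ θ → π/2 ≤ θ → θ ≤ 2π/3 → slope θ ≤ 1#
  slope≤1 θ p q = ≤-respʳ slope-2π/3 (slope-mono θ 2π/3 (<⇒≤ (θ>0 p q)) q (<⇒≤ 2π/3<π))

  Deriv-slope : Deriv π/2 2π/3 slope (λ θ → - (ℕ→ℝ 2 * (- sin θ)))
  Deriv-slope = Deriv-sub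
    (≤-by (<⇒≤ π>0 ⊞ <⇒≤ π/2>0) (solve 2 (λ p t → p :+ t := t :- (:- p)) refl π π/2)) (<⇒≤ 2π/3<π)
    (Deriv-neg (Deriv-scale (ℕ→ℝ 2) (Deriv-cos π (<⇒≤ π>0))))

  opaque
    slope-Lipschitz : ∃[ M ] (0# ≤ M × Lipschitz π/2 2π/3 M (λ θ → - slope θ))
    slope-Lipschitz = let (M , M≥0 , lip) = Deriv.H-Lipschitz (Deriv-neg Deriv-slope) in
      M , M≥0 , λ p q r s h → lip (p , q) (r , s) h

  opaque
    -- The slope runs continuously from 0 at π/2 to 1 at 2π/3, so `first-zero` applies to q - slope.
    -- The value q = 0 is split off because a strictly positive starting value is required there.
    slope-surjective : ∀ {q} → 0# ≤ q → q ≤ 1# → ∃[ θ ] (π/2 ≤ θ × θ ≤ 2π/3 × slope θ ≈ q)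
    slope-surjective {q} q≥0 q≤1 = [ (λ q≤0 → π/2 , ≤-refl , <⇒≤ π/2<2π/3 , trans slope-π/2 (≤-antisym q≥0 q≤0)) , inner ]′ (≤-or-> q 0#)
      where
      M : ℝ
      M = proj₁ slope-Lipschitz
      M≥0 : 0# ≤ M
      M≥0 = proj₁ (proj₂ slope-Lipschitz)
      lip : Lipschitz π/2 2π/3 (M + 1#) (λ θ → q - slope θ)
      lip {x} {y} p q′ r s h = ±-respˡ
        (solve 3 (λ q x y → (:- y) :- (:- x) := (q :- y) :- (q :- x)) refl q (slope x) (slope y))
        (±-≤ (*-monoʳ (±-≥0 h) (≤-+1 M))
          (proj₂ (proj₂ slope-Lipschitz) p q′ r s h))
      at-π/2 : 0# < q → 0# < q - slope π/2
      at-π/2 q>0 = <-respʳ (trans (solve 1 (λ q → q := q :- :0) refl q) (+-congˡ (-‿cong (sym slope-π/2)))) q>0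
      at-2π/3 : q - slope 2π/3 ≤ 0#
      at-2π/3 = ≤-by (gap q≤1) (trans (solve 1 (λ q → :1 :- q := :0 :- (q :- :1)) refl q) (+-congˡ (-‿cong (+-congˡ (-‿cong (sym slope-2π/3))))))
      inner : 0# < q → ∃[ θ ] (π/2 ≤ θ × θ ≤ 2π/3 × slope θ ≈ q)
      inner q>0 =
        let (θ , p , r , e , _) = first-zero {π/2} {2π/3} {M + 1#} {λ θ → q - slope θ} (+1>0 M≥0)
                                    lip (<⇒≤ π/2<2π/3) (at-π/2 q>0) at-2π/3
        in θ , p , r , ≈-by {x = slope θ} {q} e refl

  -- At s = -2 cos θ one has 4 - s² = 4 sin² θ and ds = 2 sin θ dθ, so 2 L₂ (slope θ) has derivative
  -- 1 / sin θ.
  ∫-1/sin : ∀ {α β} → π/2 ≤ α → α ≤ β → β ≤ 2π/3 → ∫ α β (λ θ → 1# / sin θ) ≈ ℕ→ℝ 2 * (L₂ (slope β) - L₂ (slope α))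
  ∫-1/sin {α} {β} π/2≤α α≤β β≤2π/3 = trans (∫-Deriv α≤β derivative) (trans
    (+-cong (antiderivative β) (-‿cong (antiderivative α)))
    (solve 2 (λ x y → :2 :* y :- :2 :* x := :2 :* (y :- x)) refl (L₂ (slope α)) (L₂ (slope β))))
    where
    H : ℝ → ℝ
    H θ = ½ * (log (plus (slope θ)) + - log (ℕ→ℝ 2 + - slope θ))
    antiderivative : ∀ θ → H θ ≈ ℕ→ℝ 2 * L₂ (slope θ)
    antiderivative θ = sym (trans (2*quarter _) (half≈½* _))
    inside₊ : ∀ {θ} → θ ∈[ π/2 , 2π/3 ] → plus (slope θ) ∈[ 1# , ℕ→ℝ 3 ]
    inside₊ {θ} (p , q) = plus≥1 (slope≥0 θ p q) , ≤-by (gap (slope≤1 θ p q)) (solve 1 (λ s → :1 :- s := con (+ 3) :- (:2 :+ s)) refl (slope θ))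
    inside₋ : ∀ {θ} → θ ∈[ π/2 , 2π/3 ] → ℕ→ℝ 2 + - slope θ ∈[ 1# , ℕ→ℝ 3 ]
    inside₋ {θ} (p , q) = minus≥1 (slope≤1 θ p q) , ≤-by (<⇒≤ 0<1 ⊞ slope≥0 θ p q) (solve 1 (λ s → :1 :+ s := con (+ 3) :- (:2 :+ :- s)) refl (slope θ))
    simplify : ∀ {θ} → θ ∈[ π/2 , 2π/3 ] →
               ½ * (1# / plus (slope θ) * (0# + - (ℕ→ℝ 2 * (- sin θ))) + - (1# / (ℕ→ℝ 2 + - slope θ) * (0# + - (- (ℕ→ℝ 2 * (- sin θ)))))) ≈ 1# / sin θ
    simplify {θ} θ∈ = trans (inv-unique (begin
      S * (½ * (1# * i * (0# + - (ℕ→ℝ 2 * (- S))) + - (1# * j * (0# + - (- (ℕ→ℝ 2 * (- S)))))))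
        ≈⟨ solve 4 (λ s h i j → s :* (h :* (:1 :* i :* (:0 :+ :- (:2 :* (:- s))) :+ :- (:1 :* j :* (:0 :+ :- (:- (:2 :* (:- s)))))))
                      := (h :+ h) :* (s :* s :* (i :+ j))) refl S ½ i j ⟩
      (½ + ½) * (S * S * (i + j))
        ≈⟨ *-cong ½+½ (*-congˡ (inv-sum p≉0 m≉0)) ⟩
      1# * (S * S * (i * j * (plus (slope θ) + minus (slope θ))))
        ≈⟨ solve 4 (λ s c i j → :1 :* (s :* s :* (i :* j :* ((:2 :+ :- (:2 :* c)) :+ (:2 :- :- (:2 :* c)))))
                      := ((:2 :+ :- (:2 :* c)) :* i) :* ((:2 :- :- (:2 :* c)) :* j) :+ :4 :* (i :* j) :* (s :* s :+ c :* c :- :1)) refl S (cos θ) i j ⟩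
      (plus (slope θ) * i) * (minus (slope θ) * j) + ℕ→ℝ 4 * (i * j) * (S * S + cos θ * cos θ - 1#)
        ≈⟨ +-cong (*-cong (inv-right p≉0) (inv-right m≉0)) (*-congˡ (gap₀ (sym (sin²+cos² θ)))) ⟩
      1# * 1# + ℕ→ℝ 4 * (i * j) * 0#
        ≈⟨ solve 1 (λ k → :1 :* :1 :+ k :* :0 := :1) refl (ℕ→ℝ 4 * (i * j)) ⟩
      1# ∎)) (sym (*-identityˡ _))
      where
      S = sin θ
      i = plus (slope θ) ⁻¹
      j = minus (slope θ) ⁻¹
      p≉0 = >⇒≉ (≥1⇒>0 (proj₁ (inside₊ θ∈)))
      m≉0 = >⇒≉ (≥1⇒>0 (proj₁ (inside₋ θ∈)))
    derivative : Deriv α β H (λ θ → 1# / sin θ)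
    derivative = Deriv-sub π/2≤α β≤2π/3 (Deriv-cong (λ _ → refl) simplify
      (Deriv-scale ½ (Deriv-+
        (Deriv-∘ inside₊ Deriv-log (Deriv-+ (Deriv-const (ℕ→ℝ 2)) Deriv-slope))
        (Deriv-neg (Deriv-∘ inside₋ Deriv-log (Deriv-+ (Deriv-const (ℕ→ℝ 2)) (Deriv-neg Deriv-slope)))))))

  open Primitive form₂ (<⇒≤ 0<1)

  module _ {α β : ℝ} (π/2≤α : π/2 ≤ α) (α≤β : α ≤ β) (β≤2π/3 : β ≤ 2π/3) where
    private
      α≤2π/3 = ≤-trans α≤β β≤2π/3
      π/2≤β = ≤-trans π/2≤α α≤β
      u = slope α
      v = slope β
      0≤u : 0# ≤ u
      0≤u = slope≥0 α π/2≤α α≤2π/3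
      v≤1 : v ≤ 1#
      v≤1 = slope≤1 β π/2≤β β≤2π/3

      -- The root in ℋ of the form [a, b, a]: it has norm 1 and real part -b/(2a).
      point : Point → ℂ
      point (a , b) = - half (ℕ→ℝ b / ℕ→ℝ a) , √ (1# - half (ℕ→ℝ b / ℕ→ℝ a) * half (ℕ→ℝ b / ℕ→ℝ a))

      Arc : ℝ → Pred ℂ 0ℓ
      Arc Δ τ = τ ∈ CMᴸᴬ Δ × α ≤ arg τ × arg τ ≤ β

      cos≈ : ∀ {θ q} → slope θ ≈ q → - half q ≈ cos θ
      cos≈ {θ} {q} e = cancel≈ 2≉0 (trans (solve 1 (λ h → :2 :* (:- h) := :- (h :+ h)) refl (half q))
        (trans (-‿cong (trans (half-sum q) (sym e))) (solve 1 (λ c → :- (:- c) := c) refl (ℕ→ℝ 2 * cos θ))))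

      point≈ : ∀ {θ a b} → π/2 ≤ θ → θ ≤ 2π/3 → slope θ ≈ ℕ→ℝ b / ℕ→ℝ a → point (a , b) ≈ᶜ e^i θ
      point≈ {θ} {a} {b} p r e = cos≈ e , √-unique (<⇒≤ (sin>0 (θ>0 p r) (θ<π p r))) (trans
        (solve 2 (λ s c → s :* s := (s :* s :+ c :* c) :- c :* c) refl (sin θ) (cos θ))
        (+-cong (sin²+cos² θ) (-‿cong (trans (*-cong (sym (cos≈ e)) (sym (cos≈ e)))
          (solve 1 (λ h → (:- h) :* (:- h) := h :* h) refl (half (ℕ→ℝ b / ℕ→ℝ a)))))))

      arg≈ : ∀ {τ θ} → π/2 ≤ θ → θ ≤ 2π/3 → τ ≈ᶜ e^i θ → arg τ ≈ θ
      arg≈ p r e = arg-spec (-π<θ p r) (<⇒≤ (θ<π p r)) e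

    module _ {Δ : ℝ} {n : ℕ} (n≤Δ : ℕ→ℝ n ≤ Δ) (Δ<n+1 : Δ < ℕ→ℝ (suc n)) where
      private
        into : ∀ {x} → Prim u v n x → Arc Δ (point x)
        into {a , b} ((1≤a , z , d≤n) , g) =
          ((_ , cm , ≤-trans (≤-respˡ (≡→≈ (≡.cong ℕ→ℝ (≡.sym disc))) (ℕ→ℝ-mono d≤n)) n≤Δ) , (θ , p , r , e)) ,
          ≤-respʳ (sym (arg≈ p r e)) (slope-reflects-≤ α θ (<⇒≤ (θ>0 p r)) (<⇒≤ (θ<π π/2≤α α≤2π/3)) (≤-respʳ (sym sθ) (slope-≥ a b 1≤a z))) ,
          ≤-respˡ (sym (arg≈ p r e)) (slope-reflects-≤ θ β (<⇒≤ (θ>0 π/2≤β β≤2π/3)) (<⇒≤ (θ<π p r)) (≤-respˡ (sym sθ) (slope-≤ a b 1≤a z)))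
          where
          q = ℕ→ℝ b / ℕ→ℝ a
          A = ℕ→ℝ a
          -- The angle supplied here takes the place of an arccosine.
          arc = slope-surjective (≤-trans 0≤u (slope-≥ a b 1≤a z)) (≤-trans (slope-≤ a b 1≤a z) v≤1)
          θ = proj₁ arc
          p = proj₁ (proj₂ arc)
          r = proj₁ (proj₂ (proj₂ arc))
          sθ = proj₂ (proj₂ (proj₂ arc))
          e : point (a , b) ≈ᶜ e^i θ
          e = point≈ {a = a} {b} p r sθ
          x = proj₁ (point (a , b))
          y = proj₂ (point (a , b))
          qA : q * A ≈ ℕ→ℝ b
          qA = /-cancel (>⇒≉ (≥1⇒ℕ→ℝ>0 1≤a))
          cm = mk-CMPoint {x} {y} a (+ b) (+ a) (<-respʳ (sym (proj₂ e)) (sin>0 (θ>0 p r) (θ<π p r))) 1≤a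
            (≡.cong +_ (≡.trans (≡.cong (gcd a) (gcd-comm b a)) (≡.trans (gcd-repeat a b) g)))
            (trans (sym qA) (trans (*-congʳ (sym (half-sum q))) (solve 2 (λ A h → (h :+ h) :* A := :- (:2 :* (A :* (:- h)))) refl A (half q))))
            (trans (sym (*-identityʳ A)) (*-congˡ (sym (trans (+-cong (*-cong (proj₁ e) (proj₁ e)) (*-cong (proj₂ e) (proj₂ e)))
              (trans (+-comm _ _) (sin²+cos² θ))))))
          disc = abs-discriminant (+ b ℤ.* + b ℤ.- + 4 ℤ.* + a ℤ.* + a) (D₂ a b) (trans (CMPoint.d-equation cm) (trans
            (solve 2 (λ A B → B :* B :- :4 :* A :* A := :- (:4 :* (A :* A) :- B :* B)) refl A (ℕ→ℝ b))
            (-‿cong (sym (D₂-real a b (b≤a {a = a} {b} v≤1 z))))))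

        injective : ∀ {x x′} → Prim u v n x → Prim u v n x′ → point x ≈ᶜ point x′ → x ≡ x′
        injective {a , b} {a′ , b′} q q′ (e , _) = cross-coprime (proj₁ (proj₁ q)) (proj₂ q) (proj₂ q′)
          (slope-injective a b a′ b′ (proj₁ (proj₁ q)) (proj₁ (proj₁ q′)) (trans (sym (half-sum _)) (trans (+-cong half≈ half≈) (half-sum _))))
          where
          half≈ : half (ℕ→ℝ b / ℕ→ℝ a) ≈ half (ℕ→ℝ b′ / ℕ→ℝ a′)
          half≈ = trans (solve 1 (λ h → h := :- (:- h)) refl (half (ℕ→ℝ b / ℕ→ℝ a)))
            (trans (-‿cong e) (solve 1 (λ h → :- (:- h) := h) refl (half (ℕ→ℝ b′ / ℕ→ℝ a′))))

        onto : ∀ {τ} → Arc Δ τ → ∃[ x ] (Prim u v n x × point x ≈ᶜ τ)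
        onto {x , y} (((d , cm , d≤Δ) , (θ , p , r , (x≈ , y≈))) , α≤ , ≤β) =
          (a′ , b′) , (((1≤a′ , closed , d≤n) , ≡.trans (≡.sym (gcd-repeat a′ b′)) (≡.trans (≡.cong (gcd a′) (gcd-comm a′ b′)) (gcd-nonneg a≡ b≡ (≡.trans c≡a a≡) coprime))) ,
            ≈ᶜ-trans (point≈ {a = a′} {b′} p r (/-unique (>⇒≉ (≥1⇒ℕ→ℝ>0 1≤a′)) (trans (*-comm _ _) (sym rb≈)))) (≈ᶜ-sym (x≈ , y≈)))
          where
          open IsCMPointOfDiscriminant cm
          open CMPoint cm
          a′ = proj₁ positive-a
          1≤a′ = proj₁ (proj₂ positive-a)
          a≡ = proj₂ (proj₂ positive-a)
          A≈ : A ≈ ℕ→ℝ a′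
          A≈ = ≡→≈ (≡.cong ℤ→ℝ a≡)
          C≈A : C′ ≈ A
          -- The norm of τ is 1, which forces c = a.
          C≈A = trans c-equation (trans (*-congˡ (trans (+-cong (*-cong x≈ x≈) (*-cong y≈ y≈)) (trans (+-comm _ _) (sin²+cos² θ)))) (*-identityʳ A))
          c≡a : c ≡ a
          c≡a = ℤ→ℝ-injective C≈A
          B≈ : B ≈ ℕ→ℝ a′ * slope θ
          B≈ = trans b-equation (trans (-‿cong (*-congˡ (*-cong A≈ x≈))) (solve 2 (λ A c → :- (:2 :* (A :* c)) := A :* (:- (:2 :* c))) refl (ℕ→ℝ a′) (cos θ)))
          nat-b = nonneg-integer b (≤-respʳ (sym B≈) (ℕ→ℝ≥0 a′ ⊠ slope≥0 θ p r))
          b′ = proj₁ nat-b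
          b≡ = proj₂ nat-b
          rb≈ : ℕ→ℝ b′ ≈ ℕ→ℝ a′ * slope θ
          rb≈ = trans (sym (≡→≈ (≡.cong ℤ→ℝ b≡))) B≈
          arg≈θ = arg≈ p r (x≈ , y≈)
          closed : Closed u v (a′ , b′)
          closed = ≤-respʳ (sym rb≈) (*-monoˡ (ℕ→ℝ≥0 a′) (slope-mono α θ (<⇒≤ (θ>0 π/2≤α α≤2π/3)) (≤-respʳ arg≈θ α≤) (<⇒≤ (θ<π p r)))) ,
                   ≤-respˡ (sym rb≈) (*-monoˡ (ℕ→ℝ≥0 a′) (slope-mono θ β (<⇒≤ (θ>0 p r)) (≤-respˡ arg≈θ ≤β) (<⇒≤ (θ<π π/2≤β β≤2π/3))))
          disc : ℤ.∣ d ∣ ≡ D₂ a′ b′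
          disc = abs-discriminant d (D₂ a′ b′) (trans d-equation (trans
            (+-cong (*-cong (≡→≈ (≡.cong ℤ→ℝ b≡)) (≡→≈ (≡.cong ℤ→ℝ b≡))) (-‿cong (*-cong (*-congˡ A≈) (trans C≈A A≈))))
            (trans (solve 2 (λ A B → B :* B :- :4 :* A :* A := :- (:4 :* (A :* A) :- B :* B)) refl (ℕ→ℝ a′) (ℕ→ℝ b′))
              (-‿cong (sym (D₂-real a′ b′ (b≤a {a = a′} {b′} v≤1 closed)))))))
          d≤n : D₂ a′ b′ ℕ.≤ n
          d≤n = ≡.subst (ℕ._≤ n) disc (ℕₚ.≤-pred (ℕ→ℝ-mono<⁻ (≤-<-trans d≤Δ Δ<n+1)))

      #-arc : # Arc Δ ≡ count (Prim u v n)
      #-arc = #-count (listing-prim 0≤u v≤1 n) point into injective onto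

      #-whole-arc : α ≡ π/2 → β ≡ 2π/3 → # CMᴸᴬ Δ ≡ count (Prim u v n)
      #-whole-arc α≡ β≡ = #-count (listing-prim 0≤u v≤1 n) point (λ q → proj₁ (into q)) injective
        -- On the arc `arg τ` equals the angle θ of the point, so the condition on the argument
        -- holds for every point when the interval is the whole range.
        λ { {τ} τ∈@(_ , (θ , p , r , e)) → onto (τ∈ ,
          ≤-respʳ (sym (arg≈ p r e)) (≡.subst (_≤ θ) (≡.sym α≡) p) , ≤-respˡ (sym (arg≈ p r e)) (≡.subst (θ ≤_) (≡.sym β≡) r)) }

  lower-arc : (α β : ℝ) → π/2 ≤ α → α ≤ β → β ≤ 2π/3 →
    (λ Δ → ℕ→ℝ (# (λ τ → τ ∈ CMᴸᴬ Δ × α ≤ arg τ × arg τ ≤ β)) / ℕ→ℝ (# (CMᴸᴬ Δ)))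
    ⟶ ∫ α β (λ θ → 1# / sin θ) / ∫ π/2 2π/3 (λ θ → 1# / sin θ) [at-∞]
  lower-arc α β π/2≤α α≤β β≤2π/3 = ratio-limit
    {λ Δ → # (λ τ → τ ∈ CMᴸᴬ Δ × α ≤ arg τ × arg τ ≤ β)} {λ Δ → # CMᴸᴬ Δ}
    {λ n → count (Prim (slope α) (slope β) n)} {λ n → count (Prim (slope π/2) (slope 2π/3) n)} {κ₁ / κ₀}
    numerator denominator convergence target
    where
    κ₁ κ₀ : ℝ
    κ₁ = L₂ (slope β) - L₂ (slope α)
    κ₀ = L₂ (slope 2π/3) - L₂ (slope π/2)
    π/2≤2π/3 : π/2 ≤ 2π/3
    π/2≤2π/3 = <⇒≤ π/2<2π/3
    α≤2π/3 : α ≤ 2π/3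
    α≤2π/3 = ≤-trans α≤β β≤2π/3
    π/2≤β : π/2 ≤ β
    π/2≤β = ≤-trans π/2≤α α≤β
    slope≤slope : slope π/2 ≤ slope 2π/3
    slope≤slope = slope-mono π/2 2π/3 (<⇒≤ π/2>0) π/2≤2π/3 (<⇒≤ 2π/3<π)
    κ>0 : 0# < κ₀
    κ>0 = <-≤-trans
      (<-respʳ (trans (solve 0 (:1 := :1 :- :0) refl) (+-cong (sym slope-2π/3) (-‿cong (sym slope-π/2)))) 0<1
        ⊠⁺ inv>0 (≥1⇒>0 (plus≥1 (slope≥0 2π/3 π/2≤2π/3 ≤-refl)) ⊠⁺ ≥1⇒>0 (minus≥1 (slope≤1 π/2 ≤-refl π/2≤2π/3))))
      (L₂-lower (slope≥0 π/2 ≤-refl π/2≤2π/3) slope≤slope (slope≤1 2π/3 π/2≤2π/3 ≤-refl))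
    ∫≉0 : ¬ (∫ π/2 2π/3 (λ θ → 1# / sin θ) ≈ 0#)
    ∫≉0 e = >⇒≉ κ>0 (zero-product (trans (sym (∫-1/sin ≤-refl π/2≤2π/3 ≤-refl)) e) 2≉0)
    target : κ₁ / κ₀ ≈ ∫ α β (λ θ → 1# / sin θ) / ∫ π/2 2π/3 (λ θ → 1# / sin θ)
    target = trans (double-ratio {κ₁} {κ₀} (>⇒≉ κ>0))
      (sym (/-cong ∫≉0 (∫-1/sin π/2≤α α≤β β≤2π/3) (∫-1/sin ≤-refl π/2≤2π/3 ≤-refl)))
    convergence : ∀ ε → 0# < ε → ∃[ N ] (∀ n → N ℕ.≤ n →
      ∣ prim (slope α) (slope β) n / prim (slope π/2) (slope 2π/3) n - κ₁ / κ₀ ∣ < ε)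
    convergence = prim-ratio (slope≥0 α π/2≤α α≤2π/3) (slope-mono α β (<⇒≤ (θ>0 π/2≤α α≤2π/3)) α≤β (<⇒≤ (θ<π π/2≤β β≤2π/3)))
      (slope≤1 β π/2≤β β≤2π/3) (slope≥0 π/2 ≤-refl π/2≤2π/3) slope≤slope (slope≤1 2π/3 π/2≤2π/3 ≤-refl) κ>0
    numerator : ∀ {Δ n} → ℕ→ℝ n ≤ Δ → Δ < ℕ→ℝ (suc n) →
      # (λ τ → τ ∈ CMᴸᴬ Δ × α ≤ arg τ × arg τ ≤ β) ≡ count (Prim (slope α) (slope β) n)
    numerator {Δ} {n} p q = #-arc π/2≤α α≤β β≤2π/3 {Δ} {n} p q
    denominator : ∀ {Δ n} → ℕ→ℝ n ≤ Δ → Δ < ℕ→ℝ (suc n) → # CMᴸᴬ Δ ≡ count (Prim (slope π/2) (slope 2π/3) n)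
    denominator {Δ} {n} p q = #-whole-arc ≤-refl π/2≤2π/3 ≤-refl {Δ} {n} p q ≡.refl ≡.refl

theorem1p1 : (em : ExcludedMiddle 0ℓ) (R : CompleteOrderedField) →
    let open Analysis em R in
      ((K : ℝ) → √3/2 < K →
        (X Y : ℝ) → √3/2 ≤ X → X ≤ Y → Y ≤ K →
        (λ Δ → ℕ→ℝ (# (λ τ → τ ∈ CMᴸᴮ Δ × X ≤ im τ × im τ ≤ Y))
             / ℕ→ℝ (# (λ τ → τ ∈ CMᴸᴮ Δ × √3/2 ≤ im τ × im τ ≤ K)))
        ⟶ ∫ X Y (λ y → 1# / y) / ∫ √3/2 K (λ y → 1# / y) [at-∞])
      ×
      ((α β : ℝ) → π/2 ≤ α → α ≤ β → β ≤ 2π/3 →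
        (λ Δ → ℕ→ℝ (# (λ τ → τ ∈ CMᴸᴬ Δ × α ≤ arg τ × arg τ ≤ β))
             / ℕ→ℝ (# (CMᴸᴬ Δ)))
        ⟶ ∫ α β (λ θ → 1# / sin θ) / ∫ π/2 2π/3 (λ θ → 1# / sin θ) [at-∞])
theorem1p1 em R = left-boundary , lower-arc
  where open Development em R using (left-boundary; lower-arc)
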